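{- Let $L$ be a language and $T$ a complete first-order $L$-theory. Assume $T$ has NIP. Let $M\models T$ and let $M\prec N$ and $(N,M)\prec (N',M')$ be sufficiently saturated elementary extensions, where $(N,M)$ and $(N',M')$ are $L\cup\{P\}$-structures and $P$ is a unary predicate, not in $L$, such that $P(N)=M$ and $P(N')=M'$. Let $A\subseteq M'$ be a small non-constant $L$-indiscernible sequence. Then there is a small $L$-indiscernible sequence $A'\subseteq M'$ which extends $A$ and has the following property: for every complete $L$-type $q(\bar x)$ over $A'$ with $\bar x=(x_1,\dots,x_n)$, if $q(\bar x)$ is finitely realised in $A'$, then $q(\bar x)\cup\{P(x_1),\dots,P(x_n)\}$ implies a complete $L$-type over $N$.
   Context: Structures may be many-sorted; in that case $P$ stands for a family $(P_s)$ of unary predicates, one for each sort $s$, with $P_s(N_s)=M_s$. "Sufficiently saturated" and "small" follow the usual convention: $N$ is a sufficiently saturated $L$-elementary extension of $M$ (relative to $|M|+|L|$), and $(N',M')$ is an $L\cup\{P\}$-elementary extension of $(N,M)$ that is saturated and strongly homogeneous up to a large (e.g. strong limit) cardinal $\kappa>|N|+|L|$; "small" means of cardinality less than $\kappa$. A non-constant indiscernible sequence $(a_i)_{i\in I}$ (indexed by a linear order $I$) is identified with the ordered set $\{a_i:i\in I\}$, where $a_i<a_j$ if and only if $i<j$. $A\subseteq M'$ means that $A$ is a subset of a finite cartesian power of sorts of $M'$, so the elements of the sequence may be finite tuples. $A'$ extends $A$ means $A\subseteq A'$ as ordered sets (the order of $A'$ restricts to that of $A$). Each variable $x_i$ is of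 the sort (cartesian power of sorts) of elements of $A$, and $P(x_i)$ says all coordinates of $x_i$ lie in $P$. $q(\bar x)$ is finitely realised in $A'$ if every formula in $q$ (equivalently every finite part of $q$) is satisfied by some $n$-tuple of elements of $A'$. The conclusion "$q(\bar x)\cup\{P(x_1),\dots,P(x_n)\}$ implies a complete $L$-type over $N$" means that any two $n$-tuples with entries in $M'$ realising $q$ have the same $L$-type over $N$ (computed in $N'$). -}

module Defs where

open import Level using (Level; suc)
open import Data.Empty.Polymorphic using (⊥)
open import Data.Fin as Fin using (Fin)
open import Data.Fin.Subset using (Subset) renaming (_∈_ to _∈ˢ_)
open import Data.List using (List; []; _∷_; _++_)
open import Data.List.Membership.Propositional using (_∈_)
open import Data.List.Relation.Unary.All as All using (All; []; _∷_)
open import Data.List.Relation.Unary.All.Properties using (++⁺)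
open import Data.Nat using (ℕ)
open import Data.Product using (Σ; ∃; _×_; _,_)
open import Data.Sum using (_⊎_)
open import Function using (_⇔_; _↣_; _∘_)
open import Relation.Binary.PropositionalEquality using (_≡_; _≢_)
open import Relation.Binary.Structures using (IsStrictTotalOrder)
open import Relation.Nullary using (¬_)

------------------------------------------------------------------------
-- Cardinalities

-- |X| < |K|; cardinals are represented by types.
_⋖_ : ∀ {ℓ} → Set ℓ → Set ℓ → Set ℓ
X ⋖ K = (X ↣ K) × ¬ (K ↣ X)

------------------------------------------------------------------------
-- Many-sorted first-order logic with equality

record Language (ℓ : Level) : Set (suc ℓ) where
  field
    Sort : Set ℓ
    Fun  : List Sort → Sort → Set ℓ
    Rel  : List Sort → Set ℓ

open Language public

module _ {ℓ : Level} (L : Language ℓ) where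

  -- A list of sorts serves both as a finite cartesian product of sorts
  -- and as a context of free variables (a variable is a position in it).
  Ctx : Set ℓ
  Ctx = List (Sort L)

  data Term (Γ : Ctx) : Sort L → Set ℓ where
    var : ∀ {s} → s ∈ Γ → Term Γ s
    app : ∀ {ss s} → Fun L ss s → All (Term Γ) ss → Term Γ s

  -- The remaining connectives and ∃ are the usual classical abbreviations;
  -- all results are stated under excluded middle.
  data Formula : Ctx → Set ℓ where
    false : ∀ {Γ} → Formula Γ
    _≐_   : ∀ {Γ s} → Term Γ s → Term Γ s → Formula Γ
    rel   : ∀ {Γ ss} → Rel L ss → All (Term Γ) ss → Formula Γ
    _⇒_   : ∀ {Γ} → Formula Γ → Formula Γ → Formula Γ
    all   : ∀ {Γ} s → Formula (s ∷ Γ) → Formula Γ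

  -- |L| is, as usual, the number of L-formulas (so |L| ≥ ℵ₀).
  ∣_∣ᴸ : Set ℓ
  ∣_∣ᴸ = Σ Ctx Formula

  record Structure : Set (suc ℓ) where
    field
      Carrier   : Sort L → Set ℓ
      fun       : ∀ {ss s} → Fun L ss s → All Carrier ss → Carrier s
      relation  : ∀ {ss} → Rel L ss → All Carrier ss → Set ℓ
      inhabited : ∀ s → Carrier s

open Structure public

module _ {ℓ : Level} {L : Language ℓ} where

  ~_ : ∀ {Γ} → Formula L Γ → Formula L Γ
  ~ φ = φ ⇒ false

  Tuple : Structure L → Ctx L → Set ℓ
  Tuple 𝔐 Γ = All (Carrier 𝔐) Γ

  ∣_∣ : Structure L → Set ℓ
  ∣ 𝔐 ∣ = Σ (Sort L) (Carrier 𝔐)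

  module _ (𝔐 : Structure L) where

    mutual
      eval : ∀ {Γ s} → Tuple 𝔐 Γ → Term L Γ s → Carrier 𝔐 s
      eval v (var x)    = All.lookup v x
      eval v (app f ts) = fun 𝔐 f (evals v ts)

      evals : ∀ {Γ ss} → Tuple 𝔐 Γ → All (Term L Γ) ss → Tuple 𝔐 ss
      evals v []       = []
      evals v (t ∷ ts) = eval v t ∷ evals v ts

    _⊨_[_] : ∀ {Γ} → Formula L Γ → Tuple 𝔐 Γ → Set ℓ
    _⊨_[_] false      v = ⊥
    _⊨_[_] (t ≐ u)    v = eval v t ≡ eval v u
    _⊨_[_] (rel R ts) v = relation 𝔐 R (evals v ts)
    _⊨_[_] (φ ⇒ ψ)    v = _⊨_[_] φ v → _⊨_[_] ψ v
    _⊨_[_] (all s φ)  v = ∀ x → _⊨_[_] φ (x ∷ v)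

  -- M ≺ N, with the inclusion replaced by an elementary embedding.
  record _≺_ (𝔐 𝔑 : Structure L) : Set ℓ where
    field
      to         : ∀ {s} → Carrier 𝔐 s → Carrier 𝔑 s
      elementary : ∀ {Γ} (φ : Formula L Γ) (v : Tuple 𝔐 Γ) →
                   (𝔐 ⊨ φ [ v ]) ⇔ (𝔑 ⊨ φ [ All.map to v ])

  record Automorphism (𝔐 : Structure L) : Set ℓ where
    field
      to       : ∀ {s} → Carrier 𝔐 s → Carrier 𝔐 s
      from     : ∀ {s} → Carrier 𝔐 s → Carrier 𝔐 s
      to-from  : ∀ {s} (x : Carrier 𝔐 s) → to (from x) ≡ x
      from-to  : ∀ {s} (x : Carrier 𝔐 s) → from (to x) ≡ x
      fun-hom  : ∀ {ss s} (f : Fun L ss s) (xs : Tuple 𝔐 ss) →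
                 to (fun 𝔐 f xs) ≡ fun 𝔐 f (All.map to xs)
      rel-hom  : ∀ {ss} (R : Rel L ss) (xs : Tuple 𝔐 ss) →
                 relation 𝔐 R xs ⇔ relation 𝔐 R (All.map to xs)

open _≺_ public using (to; elementary)

------------------------------------------------------------------------
-- Theories and NIP

module _ {ℓ : Level} (L : Language ℓ) where

  Theory : Set (suc ℓ)
  Theory = Formula L [] → Set ℓ

module _ {ℓ : Level} {L : Language ℓ} where

  _⊨ᵀ_ : Structure L → Theory L → Set ℓ
  𝔐 ⊨ᵀ T = ∀ φ → T φ → 𝔐 ⊨ φ [ [] ]

  _⊢_ : Theory L → Formula L [] → Set (suc ℓ)
  T ⊢ φ = ∀ 𝔐 → 𝔐 ⊨ᵀ T → 𝔐 ⊨ φ [ [] ]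

  Complete : Theory L → Set (suc ℓ)
  Complete T = (∃ λ 𝔐 → 𝔐 ⊨ᵀ T) × (∀ φ → (T ⊢ φ) ⊎ (T ⊢ (~ φ)))

  -- φ(x;y), with x of sort Γ and y of sort Δ, has the independence
  -- property in 𝔐: for every n it shatters some a₁,…,aₙ (the finitary form
  -- of the independence property).
  HasIP : (𝔐 : Structure L) (Γ Δ : Ctx L) → Formula L (Γ ++ Δ) → Set ℓ
  HasIP 𝔐 Γ Δ φ = ∀ n →
    Σ (Fin n → Tuple 𝔐 Γ) λ a → Σ (Subset n → Tuple 𝔐 Δ) λ b →
    ∀ i S → (𝔐 ⊨ φ [ ++⁺ (a i) (b S) ]) ⇔ (i ∈ˢ S)

  NIP : Theory L → Set (suc ℓ)
  NIP T = ∀ Γ Δ (φ : Formula L (Γ ++ Δ)) 𝔐 → 𝔐 ⊨ᵀ T → ¬ HasIP 𝔐 Γ Δ φ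

------------------------------------------------------------------------
-- Parameters and types

  -- A parameter set in 𝔐 is given as a sort-indexed family B of names with
  -- a valuation B s → Carrier 𝔐 s.  A formula φ(x,b) over it consists of
  -- an L-formula φ(x,y) and a tuple b of names.
  record FormulaOver (B : Sort L → Set ℓ) (Γ : Ctx L) : Set ℓ where
    constructor _at_
    field
      {Δ}     : Ctx L
      formula : Formula L (Γ ++ Δ)
      params  : All B Δ

  ~ᵒ_ : ∀ {B Γ} → FormulaOver B Γ → FormulaOver B Γ
  ~ᵒ (φ at b) = (~ φ) at b

  -- A set of formulas over B in the variables Γ.
  PartialType : (B : Sort L → Set ℓ) → Ctx L → Set (suc ℓ)
  PartialType B Γ = FormulaOver B Γ → Set ℓ

  module _ (𝔐 : Structure L) {B : Sort L → Set ℓ}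
           (val : ∀ {s} → B s → Carrier 𝔐 s) where

    Sat : ∀ {Γ} → Tuple 𝔐 Γ → FormulaOver B Γ → Set ℓ
    Sat v (φ at b) = 𝔐 ⊨ φ [ ++⁺ v (All.map val b) ]

    Realises : ∀ {Γ} → Tuple 𝔐 Γ → PartialType B Γ → Set ℓ
    Realises v p = ∀ ψ → p ψ → Sat v ψ

    FinitelySatisfiable : ∀ {Γ} → PartialType B Γ → Set ℓ
    FinitelySatisfiable p = ∀ ψs → All p ψs → ∃ λ v → All (Sat v) ψs

    -- A complete type over B, computed in 𝔐.
    IsCompleteType : ∀ {Γ} → PartialType B Γ → Set ℓ
    IsCompleteType p = FinitelySatisfiable p × (∀ ψ → p ψ ⊎ p (~ᵒ ψ))

    SameType : ∀ {Γ} → Tuple 𝔐 Γ → Tuple 𝔐 Γ → Set ℓ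
    SameType {Γ} v w = ∀ (ψ : FormulaOver B Γ) → Sat v ψ ⇔ Sat w ψ

------------------------------------------------------------------------
-- Saturation and homogeneity, relative to a notion of small set

  Saturated : (Small : Set ℓ → Set ℓ) → Structure L → Set (suc ℓ)
  Saturated Small 𝔐 =
    ∀ (B : Sort L → Set ℓ) → Small (Σ (Sort L) B) →
    ∀ (val : ∀ {s} → B s → Carrier 𝔐 s) {Γ} (p : PartialType B Γ) →
    FinitelySatisfiable 𝔐 val p → ∃ λ v → Realises 𝔐 val v p

  StronglyHomogeneous : (Small : Set ℓ → Set ℓ) → Structure L → Set (suc ℓ)
  StronglyHomogeneous Small 𝔐 =
    ∀ (B : Sort L → Set ℓ) → Small (Σ (Sort L) B) →
    ∀ (b c : ∀ {s} → B s → Carrier 𝔐 s) →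
    (∀ {Δ} (φ : Formula L Δ) (d : All B Δ) →
       (𝔐 ⊨ φ [ All.map b d ]) ⇔ (𝔐 ⊨ φ [ All.map c d ])) →
    Σ (Automorphism 𝔐) λ σ → ∀ {s} (x : B s) → Automorphism.to σ (b x) ≡ c x

------------------------------------------------------------------------
-- The language L ∪ {P}

module _ {ℓ : Level} (L : Language ℓ) where

  data RelP : List (Sort L) → Set ℓ where
    old : ∀ {ss} → Rel L ss → RelP ss
    P   : ∀ s → RelP (s ∷ [])

  _∪P : Language ℓ
  _∪P = record { Sort = Sort L ; Fun = Fun L ; Rel = RelP }

module _ {ℓ : Level} {L : Language ℓ} where

  expand : (𝔐 : Structure L) → (∀ {s} → Carrier 𝔐 s → Set ℓ) → Structure (L ∪P)
  expand 𝔐 Q = record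
    { Carrier   = Carrier 𝔐
    ; fun       = fun 𝔐
    ; relation  = λ { (old R) xs → relation 𝔐 R xs ; (P s) (x ∷ []) → Q x }
    ; inhabited = inhabited 𝔐
    }

  -- The pair (N,M): the predicate P names the copy of M inside N.
  pair : {𝔐 𝔑 : Structure L} → 𝔐 ≺ 𝔑 → Structure (L ∪P)
  pair {𝔐} {𝔑} ι = expand 𝔑 (λ {s} x → Σ (Carrier 𝔐 s) λ m → to ι m ≡ x)

  AllIn : (𝔐 : Structure L) → (∀ {s} → Carrier 𝔐 s → Set ℓ) →
          ∀ {Γ} → Tuple 𝔐 Γ → Set ℓ
  AllIn 𝔐 Q {Γ} v = ∀ {s} (x : s ∈ Γ) → Q (All.lookup v x)

------------------------------------------------------------------------
-- Sequences of finite tuples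

  _^_ : Ctx L → ℕ → Ctx L
  σ ^ ℕ.zero  = []
  σ ^ ℕ.suc n = σ ++ (σ ^ n)

  join : (𝔐 : Structure L) {σ : Ctx L} (n : ℕ) →
         (Fin n → Tuple 𝔐 σ) → Tuple 𝔐 (σ ^ n)
  join 𝔐 ℕ.zero    t = []
  join 𝔐 (ℕ.suc n) t = ++⁺ (t Fin.zero) (join 𝔐 n (t ∘ Fin.suc))

  record Sequence (𝔐 : Structure L) (σ : Ctx L) : Set (suc ℓ) where
    field
      Index   : Set ℓ
      _<_     : Index → Index → Set ℓ
      isOrder : IsStrictTotalOrder _≡_ _<_
      elem    : Index → Tuple 𝔐 σ

  open Sequence

  module _ {𝔐 : Structure L} {σ : Ctx L} where

    Increasing : (A : Sequence 𝔐 σ) {n : ℕ} → (Fin n → Index A) → Set ℓ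
    Increasing A t = ∀ {i j} → i Fin.< j → _<_ A (t i) (t j)

    Indiscernible : Sequence 𝔐 σ → Set ℓ
    Indiscernible A = ∀ n (φ : Formula L (σ ^ n)) (t u : Fin n → Index A) →
      Increasing A t → Increasing A u →
      (𝔐 ⊨ φ [ join 𝔐 n (elem A ∘ t) ]) ⇔ (𝔐 ⊨ φ [ join 𝔐 n (elem A ∘ u) ])

    NonConstant : Sequence 𝔐 σ → Set ℓ
    NonConstant A = ∃ λ i → ∃ λ j → elem A i ≢ elem A j

    SequenceIn : (∀ {s} → Carrier 𝔐 s → Set ℓ) → Sequence 𝔐 σ → Set ℓ
    SequenceIn Q A = ∀ i → AllIn 𝔐 Q (elem A i)

    -- A′ Extends A.  For non-constant indiscernible sequences elem is
    -- injective, so this is inclusion of ordered sets.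
    _Extends_ : Sequence 𝔐 σ → Sequence 𝔐 σ → Set ℓ
    A′ Extends A = Σ (Index A → Index A′) λ e →
      (∀ {i j} → _<_ A i j → _<_ A′ (e i) (e j)) ×
      (∀ i → elem A′ (e i) ≡ elem A i)

    -- The parameters named by a sequence are the coordinates of its elements.
    Coord : Sequence 𝔐 σ → Sort L → Set ℓ
    Coord A s = Index A × (s ∈ σ)

    coord : (A : Sequence 𝔐 σ) → ∀ {s} → Coord A s → Carrier 𝔐 s
    coord A (i , x) = All.lookup (elem A i) x

    FinitelyRealisedIn : (A : Sequence 𝔐 σ) (n : ℕ) →
                         PartialType (Coord A) (σ ^ n) → Set ℓ
    FinitelyRealisedIn A n q = ∀ ψs → All q ψs →
      Σ (Fin n → Index A) λ t →
      All (Sat 𝔐 (coord A) (join 𝔐 n (elem A ∘ t))) ψs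

open Sequence public using (Index; elem; isOrder)

-- A new point of the sequence is always a limit, along an ultrafilter on
-- tuples of the sequence, so every extension built below is finitely
-- satisfiable in the sequence it extends ("coheir").  For a formula φ(x;b),
-- b ∈ N, call a sequence B handled if finitely many sets of formulas over B
-- cover the n-tuples of B, each of them deciding φ(x;b) on P.  This persists in
-- coheir extensions, and if every φ(x;b) is handled then a type finitely
-- realised in B contains one of the covering sets, hence decides φ(x;b) on P.
--
-- If B is not handled, some ultrafilter on the n-tuples of B avoids all
-- deciding sets, and by saturation it has two limits in P which differ on
-- φ(x;b).  Adding both and repeating ω times gives pairs of twins.  A new
-- coordinate of a later stage is either a limit of the initial sequence, and
-- then it does not separate earlier twins, or equal to an earlier new point.
-- At most n stages are concerned by the latter, so that one finds arbitrarily
-- many independent stages; exchanging twins there does not change the order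
-- type, so indiscernibility turns the twins into a shattered set.  Hence by
-- NIP finitely many steps handle φ(x;b), and Zorn's lemma handles all formulas.
module Submission where

open import Defs
open import Axiom.ExcludedMiddle using (ExcludedMiddle)
open import Axiom.Extensionality.Propositional using (Extensionality)
open import Data.Bool using (Bool; true; false; T; T?; not)
open import Data.Bool.Properties using (T-irrelevant; T-≡; ⇔→≡)
open import Data.Empty using (⊥; ⊥-elim)
open import Data.Fin as Fin using (Fin)
import Data.Fin.Properties as Fin
open import Data.List as List using (List; []; _∷_; _++_; length; filter; downFrom)
open import Data.List.Membership.Propositional using (_∈_)
open import Data.List.Membership.Propositional.Properties
  using (∈-++⁺ˡ; ∈-++⁺ʳ; ∈-allFin; ∈-filter⁻; ∈-lookup; ∈-tabulate⁺)
open import Data.List.Properties using (∷-injective; filter-accept; filter-all; filter-reject; length-downFrom)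
open import Data.List.Relation.Unary.All as All using (All; []; _∷_)
open import Data.List.Relation.Unary.All.Properties using (++⁺; ++⁻; map⁺; map⁻)
open import Data.List.Relation.Unary.AllPairs using (AllPairs; []; _∷_)
import Data.List.Relation.Unary.AllPairs.Properties as AllPairs
open import Data.List.Relation.Unary.Any as Any using (Any; here; there)
import Data.List.Relation.Unary.Any.Properties as Any
open import Data.Nat as ℕ using (ℕ; zero; suc; _+_; _*_)
import Data.Nat.Properties as ℕ
open import Data.Product using (Σ; ∃; _×_; _,_; proj₁; proj₂; map₂)
open import Data.Sum as Sum using (_⊎_; inj₁; inj₂; [_,_]′)
open import Data.Vec using (lookup)
open import Data.Vec.Properties using (lookup⇒[]=; []=⇒lookup)
open import Function using (_∘_; const; id; _⇔_; mk⇔; Equivalence; _↣_; mk↣; Injection)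
open import Function.Construct.Composition using (_⇔-∘_; _↣-∘_)
open import Function.Construct.Identity using (⇔-id)
open import Function.Construct.Symmetry using (⇔-sym)
open import Level using (Lift; lift; lower; _⊔_)
open import Relation.Binary.Definitions using (Trichotomous; tri<; tri≈; tri>)
open import Relation.Binary.PropositionalEquality
open import Relation.Binary.Structures using (IsStrictTotalOrder)
open import Relation.Nullary using (¬_; Dec; yes; no; ¬?; contradiction)
open import Relation.Nullary.Decidable using (isYes; toWitness; fromWitness)

open Equivalence renaming (to to fwd; from to bwd)
open Injection using (injective) renaming (to to _⟨$⟩_)

-- The order of the sequence need not be definable, so realising a limit type does not assign a
-- place in the sequence. Both the place and indiscernibility are read off the ultrafilter, which is
-- therefore kept as data. For the same reason twins come from one ultrafilter, and not merely from
-- one type over `B`. The ultrafilter lives on n-tuples because φ relates the coordinates. A single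
-- coordinate may well be principal, even at an earlier twin; exchanging that earlier twin could
-- then change its order relation to the later pair. This is the obstacle to exchanging the twins of
-- all stages at once. Size is the other concern: a maximal extension comes with no evident bound on
-- its cardinality. Every added point therefore carries a label made of an instance and a number,
-- and an injective labelling bounds the sequence by the given one together with the instances over
-- `N`.

Decreasing : List ℕ → Set
Decreasing = AllPairs ℕ._>_

delete : ℕ → List ℕ → List ℕ
delete r = filter (λ y → ¬? (r ℕ.≟ y))

-- A decreasing list has no repetitions, so a given value occurs at most once.
length-delete : ∀ r {xs} → Decreasing xs → length xs ℕ.≤ suc (length (delete r xs))
length-delete r [] = ℕ.z≤n
length-delete r {x ∷ xs} (x> ∷ dec) with r ℕ.≟ x
... | no r≢x = subst (λ ys → suc (length xs) ℕ.≤ suc (length ys))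
        (sym (filter-accept (λ y → ¬? (r ℕ.≟ y)) r≢x)) (ℕ.s≤s (length-delete r dec))
... | yes refl = ℕ.s≤s (ℕ.≤-reflexive (cong length (sym (trans
        (filter-reject (λ y → ¬? (r ℕ.≟ y)) (λ r≢r → r≢r refl))
        (filter-all (λ y → ¬? (r ℕ.≟ y)) (All.map (λ y<x x≡y → ℕ.<⇒≢ y<x (sym x≡y)) x>))))))

deleteAll : ∀ n → (Fin n → ℕ) → List ℕ → List ℕ
deleteAll zero r xs = xs
deleteAll (suc n) r xs = delete (r Fin.zero) (deleteAll n (r ∘ Fin.suc) xs)

decreasing-deleteAll : ∀ n r {xs} → Decreasing xs → Decreasing (deleteAll n r xs)
decreasing-deleteAll zero r dec = dec
decreasing-deleteAll (suc n) r dec = AllPairs.filter⁺ _ (decreasing-deleteAll n (r ∘ Fin.suc) dec)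

length-deleteAll : ∀ n r {xs} → Decreasing xs → length xs ℕ.≤ n + length (deleteAll n r xs)
length-deleteAll zero r dec = ℕ.≤-refl
length-deleteAll (suc n) r {xs} dec = begin
  length xs                                            ≤⟨ length-deleteAll n (r ∘ Fin.suc) dec ⟩
  n + length (deleteAll n (r ∘ Fin.suc) xs)            ≤⟨ ℕ.+-monoʳ-≤ n (length-delete (r Fin.zero) dec′) ⟩
  n + suc (length (deleteAll (suc n) r xs))            ≡⟨ ℕ.+-suc n _ ⟩
  suc n + length (deleteAll (suc n) r xs)              ∎
  where
  open ℕ.≤-Reasoning
  dec′ = decreasing-deleteAll n (r ∘ Fin.suc) dec

∈-deleteAll : ∀ n r {xs y} → y ∈ deleteAll n r xs → y ∈ xs × (∀ k → r k ≢ y)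
∈-deleteAll zero r h = h , λ ()
∈-deleteAll (suc n) r {xs} h =
  let (h′ , r₀≢) = ∈-filter⁻ (λ y → ¬? (r Fin.zero ℕ.≟ y)) {xs = deleteAll n (r ∘ Fin.suc) xs} h
      (h″ , r≢) = ∈-deleteAll n (r ∘ Fin.suc) h′
  in h″ , λ { Fin.zero → r₀≢ ; (Fin.suc k) → r≢ k }

-- Greedy choice: every chosen stage excludes at most n earlier ones.
independent : ∀ n (ref : ℕ → Fin n → ℕ) K → ∃ λ (s : Fin K → ℕ) →
              ∀ {i j} → i Fin.< j → s j ℕ.< s i × (∀ k → ref (s i) k ≢ s j)
independent n ref K =
  -- Each round uses up one entry for the choice and at most `n` for the deletions, so `K` rounds
  -- need `K * suc n` candidates. Scanning downwards makes every later choice an earlier stage.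
  let (s , _ , h) = select K (downFrom (K * suc n)) (decreasing-downFrom (K * suc n))
                      (ℕ.≤-reflexive (sym (length-downFrom (K * suc n))))
  in s , h
  where
  select : ∀ K xs → Decreasing xs → K * suc n ℕ.≤ length xs → ∃ λ (s : Fin K → ℕ) →
           (∀ i → s i ∈ xs) × (∀ {i j} → i Fin.< j → s j ℕ.< s i × (∀ k → ref (s i) k ≢ s j))
  select zero xs dec len = (λ ()) , (λ ()) , λ {i} → λ { {()} }
  select (suc K) (x ∷ xs) (x> ∷ dec) len =
    let ys = deleteAll n (ref x) xs
        (s , s∈ , h) = select K ys (decreasing-deleteAll n (ref x) dec)
          (ℕ.+-cancelˡ-≤ n _ _ (ℕ.≤-trans (ℕ.s≤s⁻¹ len) (length-deleteAll n (ref x) dec)))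
    in (λ { Fin.zero → x ; (Fin.suc i) → s i })
     , (λ { Fin.zero → here refl ; (Fin.suc i) → there (proj₁ (∈-deleteAll n (ref x) (s∈ i))) })
     , λ { {Fin.zero} {Fin.suc j} _ → All.lookup x> (proj₁ (∈-deleteAll n (ref x) (s∈ j)))
                                     , proj₂ (∈-deleteAll n (ref x) (s∈ j))
         ; {Fin.suc i} {Fin.suc j} i<j → h (ℕ.s≤s⁻¹ i<j) }

  decreasing-downFrom : ∀ m → Decreasing (downFrom m)
  decreasing-downFrom zero = []
  decreasing-downFrom (suc m) = below m ℕ.≤-refl ∷ decreasing-downFrom m
    where
    below : ∀ k → k ℕ.≤ m → All (m ℕ.>_) (downFrom k)
    below zero _ = []
    below (suc k) k<m = k<m ∷ below k (ℕ.<⇒≤ k<m)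

-- Classical logic and Zorn's lemma

module Classical (em : ∀ {a} → ExcludedMiddle a) (ext : ∀ {a b} → Extensionality a b) where

  -- Subsets are Bool-valued, so that quantifying over them does not raise the
  -- universe level.
  ⌊_⌋ : ∀ {a} → Set a → Bool
  ⌊ X ⌋ = isYes (em {P = X})

  holds : ∀ {a} {X : Set a} → T ⌊ X ⌋ → X
  holds {X = X} = toWitness {a? = em {P = X}}

  check : ∀ {a} {X : Set a} → X → T ⌊ X ⌋
  check {X = X} = fromWitness {a? = em {P = X}}

  dne : ∀ {a} {X : Set a} → ¬ ¬ X → X
  dne {X = X} h with em {P = X}
  ... | yes p = p
  ... | no ¬p = ⊥-elim (h ¬p)

  ¬T⇒T-not : ∀ {b} → ¬ T b → T (not b)
  ¬T⇒T-not {true} h = h _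
  ¬T⇒T-not {false} h = _

  T-not⇒¬T : ∀ {b} → T (not b) → ¬ T b
  T-not⇒¬T {false} _ ()

  module _ {a} {W : Set a} where

    _⊆_ : (W → Bool) → (W → Bool) → Set a
    C ⊆ D = ∀ x → T (C x) → T (D x)

    ⊆-antisym : ∀ {C D} → C ⊆ D → D ⊆ C → C ≡ D
    ⊆-antisym {C} {D} p q = ext λ x → ⇔→≡ {C x} {D x} {true} (mk⇔
      (λ e → Equivalence.to T-≡ (p x (Equivalence.from T-≡ e)))
      (λ e → Equivalence.to T-≡ (q x (Equivalence.from T-≡ e))))

    ⋃ : ((W → Bool) → Bool) → W → Bool
    ⋃ 𝒟 x = ⌊ (∃ λ D → T (𝒟 D) × T (D x)) ⌋

    -- Bourbaki–Witt: the stages form a chain, and their union is closed under succ.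
    module Tower (succ : (W → Bool) → (W → Bool)) (succ-⊇ : ∀ C → C ⊆ succ C) where

      data Stage : (W → Bool) → Set a where
        step : ∀ {C} → Stage C → Stage (succ C)
        lim  : ∀ 𝒟 → (∀ D → T (𝒟 D) → Stage D) → Stage (⋃ 𝒟)

      -- The extreme points from the classical proof of the Bourbaki-Witt theorem. Extremality of
      -- `C` yields comparability with all stages, and comparability then shows by induction that
      -- all stages are extreme.
      Extreme : (W → Bool) → Set a
      Extreme C = ∀ {D} → Stage D → D ⊆ C → ¬ (C ⊆ D) → succ D ⊆ C

      extreme-split : ∀ {C} → Extreme C → ∀ {D} → Stage D → (D ⊆ C) ⊎ (succ C ⊆ D)
      extreme-split {C} ex (step {D} s) with extreme-split ex s
      ... | inj₂ q = inj₂ λ x h → succ-⊇ D x (q x h)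
      ... | inj₁ p with em {P = C ⊆ D}
      ...   | yes q = inj₂ (subst (λ E → succ C ⊆ succ E) (⊆-antisym q p) λ _ → id)
      ...   | no ¬q = inj₁ (ex s p ¬q)
      extreme-split {C} ex (lim 𝒟 s) with em {P = ∃ λ D → T (𝒟 D) × (succ C ⊆ D)}
      ... | yes (D , d , q) = inj₂ λ x h → check (D , d , q x h)
      ... | no ¬e = inj₁ λ x h → let (D , d , y) = holds h in
        [ (λ p → p x y) , (λ q → ⊥-elim (¬e (D , d , q))) ]′ (extreme-split ex (s D d))

      extreme : ∀ {C} → Stage C → Extreme C
      extreme (step {C} s) t p ¬q with extreme-split (extreme s) t
      ... | inj₂ q = ⊥-elim (¬q q)
      ... | inj₁ D⊆C with em {P = C ⊆ _}
      ...   | yes C⊆D = subst (λ E → succ E ⊆ succ C) (⊆-antisym C⊆D D⊆C) λ _ → id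
      ...   | no ¬C⊆D = λ x h → succ-⊇ C x (extreme s t D⊆C ¬C⊆D x h)
      extreme (lim 𝒟 s) {D} t p ¬q x h
        with em {P = ∃ λ C → Σ (T (𝒟 C)) λ _ → ¬ (C ⊆ D)}
      ... | no ¬e = ⊥-elim (¬q λ y k → let (C , c , Cy) = holds k in
                      dne (λ ¬Dy → ¬e (C , c , λ C⊆D → ¬Dy (C⊆D y Cy))))
      ... | yes (C , c , ¬C⊆D) with extreme-split (extreme (s C c)) t
      ...   | inj₁ D⊆C = check (C , c , extreme (s C c) t D⊆C ¬C⊆D x h)
      ...   | inj₂ q = ⊥-elim (¬C⊆D λ y k → q y (succ-⊇ C y k))

      total : ∀ {C D} → Stage C → Stage D → (C ⊆ D) ⊎ (D ⊆ C)
      total {C} s t with extreme-split (extreme s) t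
      ... | inj₁ p = inj₂ p
      ... | inj₂ q = inj₁ λ x h → q x (succ-⊇ C x h)

      -- The family of all stages is itself Bool-valued, hence an admissible argument of `lim`. So
      -- the union of all stages is again a stage, and no ordinals are involved.
      top : W → Bool
      top = ⋃ λ D → ⌊ Stage D ⌋

      top-stage : Stage top
      top-stage = lim _ λ _ → holds

      top-closed : succ top ⊆ top
      top-closed x h = check (succ top , check (step top-stage) , h)

  module _ {a r} {P : Set a} (_≤_ : P → P → Set r) where

    Chain : (P → Bool) → Set _
    Chain C = ∀ x y → T (C x) → T (C y) → (x ≤ y) ⊎ (y ≤ x)

    -- If no element is maximal, every chain C has a strict upper bound; adding
    -- it to C gives an inflationary map, which cannot have a fixed point.
    zorn : (∀ {x} → x ≤ x) → (∀ {x y z} → x ≤ y → y ≤ z → x ≤ z) →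
           (∀ C → Chain C → ∃ λ u → ∀ x → T (C x) → x ≤ u) →
           ∃ λ m → ∀ y → m ≤ y → y ≤ m
    zorn rfl tr ub with em {P = ∃ λ m → ∀ y → m ≤ y → y ≤ m}
    ... | yes p = p
    ... | no ¬max = ⊥-elim (proj₂ (proj₂ (strict top (holds chain-top))) (bound-in-top))
      where
      above : ∀ m → ∃ λ y → m ≤ y × ¬ (y ≤ m)
      above m = dne λ ¬a → ¬max (m , λ y p → dne λ ¬q → ¬a (y , p , ¬q))

      strict : ∀ C → Chain C → ∃ λ u → (∀ x → T (C x) → x ≤ u) × ¬ T (C u)
      strict C c = let (u , b) = ub C c ; (y , p , ¬q) = above u in
        y , (λ x h → tr (b x h) p) , λ h → ¬q (b y h)

      -- The chain proof enters as `T ⌊ Chain C ⌋`, which has at most one inhabitant, so the added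
      -- bound depends on `C` only; `stage-chain` relies on this when both elements are new.
      succ : (P → Bool) → P → Bool
      succ C x = ⌊ (T (C x) ⊎ Σ (T ⌊ Chain C ⌋) λ c → x ≡ proj₁ (strict C (holds c))) ⌋

      open Tower succ (λ C x h → check (inj₁ h))

      stage-chain : ∀ {C} → Stage C → Chain C
      stage-chain (step {C} s) x y h k with holds h | holds k
      ... | inj₁ p | inj₁ q = stage-chain s x y p q
      ... | inj₁ p | inj₂ (c , refl) = inj₁ (proj₁ (proj₂ (strict C (holds c))) x p)
      ... | inj₂ (c , refl) | inj₁ q = inj₂ (proj₁ (proj₂ (strict C (holds c))) y q)
      ... | inj₂ (c , refl) | inj₂ (c′ , refl) =
        inj₁ (subst (λ z → proj₁ (strict C (holds c)) ≤ proj₁ (strict C (holds z)))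
                    (T-irrelevant c c′) rfl)
      stage-chain (lim 𝒟 s) x y h k with holds h | holds k
      ... | D , d , p | E , e , q with total (s D d) (s E e)
      ... | inj₁ D⊆E = stage-chain (s E e) x y (D⊆E x p) q
      ... | inj₂ E⊆D = stage-chain (s D d) x y p (E⊆D y q)

      chain-top : T ⌊ Chain top ⌋
      chain-top = check (stage-chain top-stage)

      bound-in-top : T (top (proj₁ (strict top (holds chain-top))))
      bound-in-top = top-closed _ (check (inj₂ (chain-top , refl)))

  -- Cardinal arithmetic

  module _ {a} (X Y : Set a) where

    private
      record PartialInjection : Set a where
        field
          graph      : X → Y → Bool
          functional : ∀ {x y y′} → T (graph x y) → T (graph x y′) → y ≡ y′
          injective′ : ∀ {x x′ y} → T (graph x y) → T (graph x′ y) → x ≡ x′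

      open PartialInjection

      _≼_ : PartialInjection → PartialInjection → Set a
      R ≼ S = ∀ x y → T (graph R x y) → T (graph S x y)

      chain-bound : ∀ C → Chain _≼_ C → ∃ λ U → ∀ R → T (C R) → R ≼ U
      chain-bound C c = record
        { graph = λ x y → ⌊ (∃ λ R → T (C R) × T (graph R x y)) ⌋
        ; functional = λ h k → let (R , r , p) = holds h ; (S , s , q) = holds k in
            [ (λ l → functional S (l _ _ p) q) , (λ l → functional R p (l _ _ q)) ]′ (c R S r s)
        ; injective′ = λ h k → let (R , r , p) = holds h ; (S , s , q) = holds k in
            [ (λ l → injective′ S (l _ _ p) q) , (λ l → injective′ R p (l _ _ q)) ]′ (c R S r s)
        } , λ R r x y h → check (R , r , h)

    -- A maximal partial injection is total or onto, for otherwise a missed point on each side could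
    -- be added as a new pair. An onto one is inverted.
    comparable : (X ↣ Y) ⊎ (Y ↣ X)
    comparable with zorn _≼_ (λ x y → id) (λ p q x y → q x y ∘ p x y) chain-bound
    ... | R , max with em {P = ∀ x → ∃ λ y → T (graph R x y)} | em {P = ∀ y → ∃ λ x → T (graph R x y)}
    ... | yes tot | _ = inj₁ (mk↣ {to = proj₁ ∘ tot} λ {x} {x′} e →
            injective′ R (proj₂ (tot x)) (subst (T ∘ graph R x′) (sym e) (proj₂ (tot x′))))
    ... | no _ | yes sur = inj₂ (mk↣ {to = proj₁ ∘ sur} λ {y} {y′} e →
            functional R (proj₂ (sur y)) (subst (λ x → T (graph R x y′)) (sym e) (proj₂ (sur y′))))
    ... | no ¬tot | no ¬sur = ⊥-elim
            (¬tot λ x → dne λ ¬y → ¬sur λ y → dne λ ¬x →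
               ¬y (y , extend x y (λ y h → ¬y (y , h)) (λ x h → ¬x (x , h))))
      where
      extend : ∀ x y → (∀ y → ¬ T (graph R x y)) → (∀ x → ¬ T (graph R x y)) → T (graph R x y)
      extend x y ¬x ¬y = max S (λ _ _ → check ∘ inj₁) x y (check (inj₂ (refl , refl)))
        where
        S : PartialInjection
        S = record
          { graph = λ x′ y′ → ⌊ (T (graph R x′ y′) ⊎ (x ≡ x′ × y ≡ y′)) ⌋
          ; functional = λ h k → unique-image (holds h) (holds k)
          ; injective′ = λ h k → unique-source (holds h) (holds k)
          }
          where
          G : X → Y → Set a
          G x′ y′ = T (graph R x′ y′) ⊎ (x ≡ x′ × y ≡ y′)
          unique-image : ∀ {x y y′} → G x y → G x y′ → y ≡ y′
          unique-image (inj₁ p) (inj₁ q) = functional R p q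
          unique-image (inj₁ p) (inj₂ (refl , refl)) = ⊥-elim (¬x _ p)
          unique-image (inj₂ (refl , refl)) (inj₁ q) = ⊥-elim (¬x _ q)
          unique-image (inj₂ (refl , refl)) (inj₂ (refl , refl)) = refl
          unique-source : ∀ {x x′ y} → G x y → G x′ y → x ≡ x′
          unique-source (inj₁ p) (inj₁ q) = injective′ R p q
          unique-source (inj₁ p) (inj₂ (refl , refl)) = ⊥-elim (¬y _ p)
          unique-source (inj₂ (refl , refl)) (inj₁ q) = ⊥-elim (¬y _ q)
          unique-source (inj₂ (refl , refl)) (inj₂ (refl , refl)) = refl

  -- Injective because s² ≤ s² + a < (s + 1)² for a ≤ s.
  pairℕ : ℕ → ℕ → ℕ
  pairℕ a b = (a + b) * (a + b) + a

  pairℕ-mono : ∀ a b c d → a + b ℕ.< c + d → pairℕ a b ℕ.< pairℕ c d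
  pairℕ-mono a b c d l = begin-strict
    (a + b) * (a + b) + a        ≤⟨ ℕ.+-monoʳ-≤ _ (ℕ.m≤m+n a b) ⟩
    (a + b) * (a + b) + (a + b)  ≡⟨ ℕ.+-comm _ (a + b) ⟩
    suc (a + b) * (a + b)        <⟨ ℕ.*-monoʳ-< (suc (a + b)) (ℕ.n<1+n (a + b)) ⟩
    suc (a + b) * suc (a + b)    ≤⟨ ℕ.*-mono-≤ l l ⟩
    (c + d) * (c + d)            ≤⟨ ℕ.m≤m+n _ c ⟩
    (c + d) * (c + d) + c        ∎
    where open ℕ.≤-Reasoning

  pairℕ-injective : ∀ {a b c d} → pairℕ a b ≡ pairℕ c d → a ≡ c × b ≡ d
  pairℕ-injective {a} {b} {c} {d} e with ℕ.<-cmp (a + b) (c + d)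
  ... | tri< l _ _ = ⊥-elim (ℕ.<⇒≢ (pairℕ-mono a b c d l) e)
  ... | tri> _ _ l = ⊥-elim (ℕ.<⇒≢ (pairℕ-mono c d a b l) (sym e))
  ... | tri≈ _ s _ with ℕ.+-cancelˡ-≡ ((a + b) * (a + b)) a c
                          (trans e (cong (λ s → s * s + c) (sym s)))
  ...   | refl = refl , ℕ.+-cancelˡ-≡ a b d s

  restrict-≡ : ∀ {a} {Z : Set a} {D : Z → Bool} {u v : Σ Z (T ∘ D)} → proj₁ u ≡ proj₁ v → u ≡ v
  restrict-≡ {u = u , s} {.u , t} refl = cong (u ,_) (T-irrelevant s t)

  module _ {a} {Z : Set a} (ι : ℕ ↣ Z) where

    private
      -- Partial solutions for Zorn's lemma; `pr` is constrained on `dom` only. The image of ℕ is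
      -- kept inside every domain to start the construction and to supply tags.
      record Pairing : Set a where
        field
          dom    : Z → Bool
          pr     : Z → Z → Z
          base   : ∀ n → T (dom (ι ⟨$⟩ n))
          closed : ∀ {x y} → T (dom x) → T (dom y) → T (dom (pr x y))
          inj    : ∀ {x y x′ y′} → T (dom x) → T (dom y) → T (dom x′) → T (dom y′) →
                   pr x y ≡ pr x′ y′ → x ≡ x′ × y ≡ y′

      open Pairing

      _≼_ : Pairing → Pairing → Set a
      p ≼ q = (∀ x → T (dom p x) → T (dom q x)) ×
              (∀ x y → T (dom p x) → T (dom p y) → pr q x y ≡ pr p x y)

      initial : Pairing
      initial = record
        { dom    = λ z → ⌊ Img z ⌋
        ; pr     = λ x y → ι ⟨$⟩ pairℕ (inv em) (inv em)
        ; base   = λ n → check (n , refl)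
        ; closed = λ _ _ → check (_ , refl)
        ; inj    = λ h k h′ k′ e → let (p , q) = pairℕ-injective (injective ι e) in
                     inv-inj h h′ p , inv-inj k k′ q
        }
        where
        Img : Z → Set a
        Img z = ∃ λ n → ι ⟨$⟩ n ≡ z
        inv : ∀ {z} → Dec (Img z) → ℕ
        inv (yes (n , _)) = n
        inv (no _) = 0
        ι-inv : ∀ {z} (d : Dec (Img z)) → Img z → ι ⟨$⟩ inv d ≡ z
        ι-inv (yes (_ , e)) _ = e
        ι-inv (no ¬i) i = contradiction i ¬i
        inv-inj : ∀ {x y} → T ⌊ Img x ⌋ → T ⌊ Img y ⌋ → inv {x} em ≡ inv {y} em → x ≡ y
        inv-inj h k e = trans (sym (ι-inv em (holds h))) (trans (cong (ι ⟨$⟩_) e) (ι-inv em (holds k)))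

      chain-bound : ∀ C → Chain _≼_ C → ∃ λ U → ∀ p → T (C p) → p ≼ U
      chain-bound C c with em {P = ∃ λ p → T (C p)}
      ... | no ¬p = initial , λ p h → ⊥-elim (¬p (p , h))
      ... | yes (p₀ , h₀) = U , λ p h → (λ x k → check (p , h , k)) , λ x y k l → prU-≡ em p h k l
        where
        Dom : Z → Set a
        Dom z = ∃ λ p → T (C p) × T (dom p z)

        Dom₂ : Z → Z → Set a
        Dom₂ x y = ∃ λ p → T (C p) × T (dom p x) × T (dom p y)

        common : ∀ {x y} → Dom x → Dom y → Dom₂ x y
        common (p , h , k) (q , h′ , k′) =
          [ (λ l → q , h′ , proj₁ l _ k , k′) , (λ l → p , h , k , proj₁ l _ k′) ]′ (c p q h h′)

        prU : ∀ x y → Dec (Dom₂ x y) → Z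
        prU x y (yes (p , _)) = pr p x y
        prU x y (no _) = x

        prU-≡ : ∀ {x y} (d : Dec (Dom₂ x y)) p → T (C p) → T (dom p x) → T (dom p y) →
                prU x y d ≡ pr p x y
        prU-≡ (no ¬d) p h k l = contradiction (p , h , k , l) ¬d
        prU-≡ (yes (q , h′ , k′ , l′)) p h k l =
          [ (λ r → sym (proj₂ r _ _ k′ l′)) , (λ r → proj₂ r _ _ k l) ]′ (c q p h′ h)

        U : Pairing
        U = record
          { dom    = λ z → ⌊ Dom z ⌋
          ; pr     = λ x y → prU x y em
          ; base   = λ n → check (p₀ , h₀ , base p₀ n)
          ; closed = λ h k → let (p , r , h′ , k′) = common (holds h) (holds k) in
              check (p , r , subst (T ∘ dom p) (sym (prU-≡ em p r h′ k′)) (closed p h′ k′))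
          ; inj    = λ h k h′ k′ e → inj′ (common (holds h) (holds k)) (common (holds h′) (holds k′)) e
          }
          where
          inj′ : ∀ {x y x′ y′} → Dom₂ x y → Dom₂ x′ y′ →
                 prU x y em ≡ prU x′ y′ em → x ≡ x′ × y ≡ y′
          inj′ {x} {y} {x′} {y′} (p , r , h , k) (p′ , r′ , h′ , k′) e = [ left , right ]′ (c p p′ r r′)
            where
            e′ : pr p x y ≡ pr p′ x′ y′
            e′ = trans (sym (prU-≡ em p r h k)) (trans e (prU-≡ em p′ r′ h′ k′))
            left : p ≼ p′ → x ≡ x′ × y ≡ y′
            left (s , t) = inj p′ (s _ h) (s _ k) h′ k′ (trans (t _ _ h k) e′)
            right : p′ ≼ p → x ≡ x′ × y ≡ y′
            right (s , t) = inj p h k (s _ h′) (s _ k′) (trans e′ (sym (t _ _ h′ k′)))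

      Inside Outside : Pairing → Set a
      Inside p = Σ Z (T ∘ dom p)
      Outside p = Σ Z (T ∘ not ∘ dom p)

      -- Y = dom p is doubled by a disjoint copy h(Y); the three new parts of
      -- (Y ∪ h(Y))² are sent to h(Y), the part being recorded by a tag.
      double : ∀ p → Inside p ↣ Outside p → ∃ λ q → p ≼ q × ∃ λ z → T (dom q z) × ¬ T (dom p z)
      double p h =
        q , ((λ _ → check ∘ inj₁) , extends-pr) ,
        copy (ι ⟨$⟩ 0) , check (inj₂ (_ , base p 0 , refl)) , copy-new (base p 0)
        where
        copy′ : ∀ z → Dec (T (dom p z)) → Z
        copy′ z (yes d) = proj₁ (h ⟨$⟩ (z , d))
        copy′ z (no _) = z

        copy : Z → Z
        copy z = copy′ z (T? _)

        copy-new : ∀ {z} → T (dom p z) → ¬ T (dom p (copy z))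
        copy-new {z} d with T? (dom p z)
        ... | yes d′ = T-not⇒¬T (proj₂ (h ⟨$⟩ (z , d′)))
        ... | no ¬d = contradiction d ¬d

        copy-inj : ∀ {y z} → T (dom p y) → T (dom p z) → copy y ≡ copy z → y ≡ z
        copy-inj {y} {z} d e eq with T? (dom p y) | T? (dom p z)
        ... | no ¬d | _ = contradiction d ¬d
        ... | yes _ | no ¬e = contradiction e ¬e
        ... | yes d′ | yes e′ = cong proj₁ (injective h (restrict-≡ eq))

        Dom : Z → Set a
        Dom z = T (dom p z) ⊎ ∃ λ y → T (dom p y) × copy y ≡ z

        root : ∀ z → Dec (∃ λ y → T (dom p y) × copy y ≡ z) → Z
        root z (yes (y , _)) = y
        root z (no _) = z

        code′ : ∀ z → Dec (T (dom p z)) → Bool × Z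
        code′ z (yes _) = true , z
        code′ z (no _) = false , root z em

        code : Z → Bool × Z
        code z = code′ z (T? _)

        decode : Bool × Z → Z
        decode (true , z) = z
        decode (false , z) = copy z

        code-dom : ∀ {z} → Dom z → T (dom p (proj₂ (code z))) × decode (code z) ≡ z
        code-dom {z} d with T? (dom p z)
        ... | yes e = e , refl
        ... | no ¬e with em {P = ∃ λ y → T (dom p y) × copy y ≡ z}
        ...   | yes (y , k , eq) = k , eq
        ...   | no ¬c = ⊥-elim ([ ¬e , ¬c ]′ d)

        tag : Bool → Bool → ℕ
        tag true  true  = 0
        tag true  false = 1
        tag false true  = 2
        tag false false = 3

        untag : ℕ → Bool × Bool
        untag 0 = true , true
        untag 1 = true , false
        untag 2 = false , true
        untag _ = false , false

        untag-tag : ∀ s t → untag (tag s t) ≡ (s , t)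
        untag-tag true  true  = refl
        untag-tag true  false = refl
        untag-tag false true  = refl
        untag-tag false false = refl

        tag-inj : ∀ s t s′ t′ → tag s t ≡ tag s′ t′ → (s , t) ≡ (s′ , t′)
        tag-inj s t s′ t′ e = trans (sym (untag-tag s t)) (trans (cong untag e) (untag-tag s′ t′))

        tagged : Bool × Z → Bool × Z → Z
        tagged (s , x) (t , y) = pr p (ι ⟨$⟩ tag s t) (pr p x y)

        pair′ : Bool × Z → Bool × Z → Z
        pair′ (true , x) (true , y) = pr p x y
        pair′ u v = copy (tagged u v)

        -- A view with one constructor for the three parts that are sent to the copy, so that
        -- injectivity has four cases instead of sixteen.
        data Split : Bool × Z → Bool × Z → Set a where
          both  : ∀ x y → Split (true , x) (true , y)
          mixed : ∀ u v → pair′ u v ≡ copy (tagged u v) → Split u v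

        split : ∀ u v → Split u v
        split (true , x) (true , y) = both x y
        split (true , x) (false , y) = mixed _ _ refl
        split (false , x) (true , y) = mixed _ _ refl
        split (false , x) (false , y) = mixed _ _ refl

        tagged-dom : ∀ u v → T (dom p (proj₂ u)) → T (dom p (proj₂ v)) → T (dom p (tagged u v))
        tagged-dom u v d e = closed p (base p _) (closed p d e)

        pair′-inj : ∀ u v u′ v′ → T (dom p (proj₂ u)) → T (dom p (proj₂ v)) →
                    T (dom p (proj₂ u′)) → T (dom p (proj₂ v′)) →
                    pair′ u v ≡ pair′ u′ v′ → u ≡ u′ × v ≡ v′
        pair′-inj u v u′ v′ d e d′ e′ eq with split u v | split u′ v′
        ... | both x y | both x′ y′ with inj p d e d′ e′ eq
        ...   | refl , refl = refl , refl
        pair′-inj u v u′ v′ d e d′ e′ eq | both x y | mixed _ _ m =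
          ⊥-elim (copy-new (tagged-dom u′ v′ d′ e′) (subst (T ∘ dom p) (trans eq m) (closed p d e)))
        pair′-inj u v u′ v′ d e d′ e′ eq | mixed _ _ m | both x y =
          ⊥-elim (copy-new (tagged-dom u v d e) (subst (T ∘ dom p) (trans (sym eq) m) (closed p d′ e′)))
        pair′-inj (s , x) (t , y) (s′ , x′) (t′ , y′) d e d′ e′ eq | mixed _ _ m | mixed _ _ m′
          with inj p (base p _) (closed p d e) (base p _) (closed p d′ e′)
                 (copy-inj (tagged-dom (s , x) (t , y) d e) (tagged-dom (s′ , x′) (t′ , y′) d′ e′)
                   (trans (sym m) (trans eq m′)))
        ... | eq₁ , eq₂ with tag-inj s t s′ t′ (injective ι eq₁) | inj p d e d′ e′ eq₂
        ...   | refl | refl , refl = refl , refl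

        pair′-dom : ∀ u v → T (dom p (proj₂ u)) → T (dom p (proj₂ v)) → Dom (pair′ u v)
        pair′-dom u v d e with split u v
        ... | both x y = inj₁ (closed p d e)
        ... | mixed _ _ m = inj₂ (tagged u v , tagged-dom u v d e , sym m)

        code-inj : ∀ {x y} → Dom x → Dom y → code x ≡ code y → x ≡ y
        code-inj d e eq = trans (sym (proj₂ (code-dom d))) (trans (cong decode eq) (proj₂ (code-dom e)))

        extends-pr : ∀ x y → T (dom p x) → T (dom p y) → pair′ (code x) (code y) ≡ pr p x y
        extends-pr x y d e with T? (dom p x) | T? (dom p y)
        ... | no ¬d | _ = contradiction d ¬d
        ... | yes _ | no ¬e = contradiction e ¬e
        ... | yes _ | yes _ = refl

        q : Pairing
        q = record
          { dom    = λ z → ⌊ Dom z ⌋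
          ; pr     = λ x y → pair′ (code x) (code y)
          ; base   = λ n → check (inj₁ (base p n))
          ; closed = λ {x} {y} d e → check (pair′-dom (code x) (code y)
                       (proj₁ (code-dom (holds d))) (proj₁ (code-dom (holds e))))
          ; inj    = λ {x} {y} {x′} {y′} d e d′ e′ eq →
              let (r , s) = pair′-inj (code x) (code y) (code x′) (code y′)
                    (proj₁ (code-dom (holds d))) (proj₁ (code-dom (holds e)))
                    (proj₁ (code-dom (holds d′))) (proj₁ (code-dom (holds e′))) eq
              in code-inj (holds d) (holds d′) r , code-inj (holds e) (holds e′) s
          }

    -- For a maximal pairing the domain cannot embed in its complement, by `double`. So the
    -- complement embeds in the domain, and tagging with 0 and 1 squeezes all of `Z` into the
    -- domain, where pairs can be formed.
    square : (Z × Z) ↣ Z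
    square with zorn _≼_ ((λ _ → id) , λ _ _ _ _ → refl)
                  (λ (s , t) (s′ , t′) → (λ x → s′ x ∘ s x) , λ x y d e →
                     trans (t′ x y (s x d) (s y e)) (t x y d e)) chain-bound
    ... | p , max with comparable (Inside p) (Outside p)
    ...   | inj₁ h = let (q , le , z , d , ¬d) = double p h in ⊥-elim (¬d (proj₁ (max q le) z d))
    ...   | inj₂ k = mk↣ {to = λ (x , y) → pr p (shrink x) (shrink y)} λ {(x , y)} {(x′ , y′)} e →
              let (r , s) = inj p (shrink-dom x) (shrink-dom y) (shrink-dom x′) (shrink-dom y′) e in
              cong₂ _,_ (shrink-inj x x′ r) (shrink-inj y y′ s)
      where
      shrink : Z → Z
      shrink z with T? (dom p z)
      ... | yes d = pr p (ι ⟨$⟩ 0) z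
      ... | no ¬d = pr p (ι ⟨$⟩ 1) (proj₁ (k ⟨$⟩ (z , ¬T⇒T-not ¬d)))

      shrink-dom : ∀ z → T (dom p (shrink z))
      shrink-dom z with T? (dom p z)
      ... | yes d = closed p (base p 0) d
      ... | no ¬d = closed p (base p 1) (proj₂ (k ⟨$⟩ (z , ¬T⇒T-not ¬d)))

      shrink-inj : ∀ y z → shrink y ≡ shrink z → y ≡ z
      shrink-inj y z e with T? (dom p y) | T? (dom p z)
      ... | yes d | yes d′ = proj₂ (inj p (base p 0) d (base p 0) d′ e)
      ... | yes d | no ¬d with () ← injective ι (proj₁ (inj p (base p 0) d (base p 1) (proj₂ (k ⟨$⟩ _)) e))
      ... | no ¬d | yes d with () ← injective ι (proj₁ (inj p (base p 1) (proj₂ (k ⟨$⟩ _)) (base p 0) d e))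
      ... | no ¬d | no ¬d′ = cong proj₁ (injective k (restrict-≡ (proj₂
              (inj p (base p 1) (proj₂ (k ⟨$⟩ _)) (base p 1) (proj₂ (k ⟨$⟩ _)) e))))

  inj₁-↣ : ∀ {a b} {X : Set a} {Y : Set b} → X ↣ (X ⊎ Y)
  inj₁-↣ = mk↣ {to = inj₁} λ { refl → refl }

  inj₂-↣ : ∀ {a b} {X : Set a} {Y : Set b} → Y ↣ (X ⊎ Y)
  inj₂-↣ = mk↣ {to = inj₂} λ { refl → refl }

  ⋖-absorbs : ∀ {a} {X Z K : Set a} → X ↣ Z → Z ⋖ K → X ⋖ K
  ⋖-absorbs f (g , ¬h) = g ↣-∘ f , λ h → ¬h (f ↣-∘ h)

  position : ∀ {a} {A : Set a} {x : A} {xs} → x ∈ xs → ℕ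
  position (here _) = 0
  position (there i) = suc (position i)

  -- A membership proof is a position, so the points of a finite list are numbered even if it has
  -- repetitions. In a context the position also determines the sort.
  position-injective : ∀ {a} {A : Set a} {xs} {x y : A} {i : x ∈ xs} {j : y ∈ xs} →
                       position i ≡ position j → _≡_ {A = ∃ (_∈ xs)} (x , i) (y , j)
  position-injective {i = here refl} {here refl} e = refl
  position-injective {i = there i} {there j} e with position-injective {i = i} {j} (ℕ.suc-injective e)
  ... | refl = refl

  module Absorb {a} {Z : Set a} (ι : ℕ ↣ Z) (pr : (Z × Z) ↣ Z) where

    pr-injective : ∀ {x y x′ y′} → pr ⟨$⟩ (x , y) ≡ pr ⟨$⟩ (x′ , y′) → x ≡ x′ × y ≡ y′
    pr-injective e with injective pr e
    ... | refl = refl , refl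

    module _ {b c} {X : Set b} {Y : Set c} where

      ×-absorb : X ↣ Z → Y ↣ Z → (X × Y) ↣ Z
      ×-absorb f g = mk↣ {to = λ (x , y) → pr ⟨$⟩ (f ⟨$⟩ x , g ⟨$⟩ y)} λ e →
        let (p , q) = pr-injective e in cong₂ _,_ (injective f p) (injective g q)

      ⊎-absorb : X ↣ Z → Y ↣ Z → (X ⊎ Y) ↣ Z
      ⊎-absorb f g = mk↣ {to = encode₂} encode₂-injective
        where
        encode₂ : X ⊎ Y → Z
        encode₂ (inj₁ x) = pr ⟨$⟩ (ι ⟨$⟩ 0 , f ⟨$⟩ x)
        encode₂ (inj₂ y) = pr ⟨$⟩ (ι ⟨$⟩ 1 , g ⟨$⟩ y)
        encode₂-injective : ∀ {u v} → encode₂ u ≡ encode₂ v → u ≡ v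
        encode₂-injective {inj₁ x} {inj₁ x′} e = cong inj₁ (injective f (proj₂ (pr-injective e)))
        encode₂-injective {inj₂ y} {inj₂ y′} e = cong inj₂ (injective g (proj₂ (pr-injective e)))
        encode₂-injective {inj₁ x} {inj₂ y} e with () ← injective ι (proj₁ (pr-injective e))
        encode₂-injective {inj₂ y} {inj₁ x} e with () ← injective ι (proj₁ (pr-injective e))

    -- The code of `[]` may agree with that of a longer list, so the length is recorded separately.
    List-absorb : ∀ {b} {X : Set b} → X ↣ Z → List X ↣ Z
    List-absorb {X = X} f = mk↣ {to = λ xs → pr ⟨$⟩ (ι ⟨$⟩ length xs , code xs)} λ {xs} {ys} e →
      let (p , q) = pr-injective e in code-injective xs ys (injective ι p) q
      where
      code : List X → Z
      code [] = ι ⟨$⟩ 0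
      code (x ∷ xs) = pr ⟨$⟩ (f ⟨$⟩ x , code xs)

      code-injective : ∀ xs ys → length xs ≡ length ys → code xs ≡ code ys → xs ≡ ys
      code-injective [] [] l e = refl
      code-injective (x ∷ xs) (y ∷ ys) l e =
        let (p , q) = pr-injective e in
        cong₂ _∷_ (injective f p) (code-injective xs ys (ℕ.suc-injective l) q)

  -- `Z` is the larger of the two sets, which avoids any closure of `K` under sums; it is infinite
  -- since `X` embeds in it.
  absorbing : ∀ {a} {X Y K : Set a} → ℕ ↣ X → X ⋖ K → Y ⋖ K →
              ∃ λ (Z : Set a) → (ℕ ↣ Z) × ((Z × Z) ↣ Z) × (Z ⋖ K) × (X ↣ Z) × (Y ↣ Z)
  absorbing {X = X} {Y} ι x y with comparable X Y
  ... | inj₁ f = Y , f ↣-∘ ι , square (f ↣-∘ ι) , y , f , mk↣ {to = id} id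
  ... | inj₂ g = X , ι , square ι , x , mk↣ {to = id} id , g

  -- Renamings, connectives and the passage from L to L ∪ P

  ≡⇒⇔ : ∀ {a} {A B : Set a} → A ≡ B → A ⇔ B
  ≡⇒⇔ refl = ⇔-id _

  module _ {ℓ} {L : Language ℓ} where

    Renaming : Ctx L → Ctx L → Set ℓ
    Renaming Γ Δ = ∀ {s} → s ∈ Γ → s ∈ Δ

    under : ∀ {Γ Δ s} → Renaming Γ Δ → Renaming (s ∷ Γ) (s ∷ Δ)
    under ρ (here e) = here e
    under ρ (there x) = there (ρ x)

    mutual
      renameᵗ : ∀ {Γ Δ s} → Renaming Γ Δ → Term L Γ s → Term L Δ s
      renameᵗ ρ (var x) = var (ρ x)
      renameᵗ ρ (app f ts) = app f (renameᵗˢ ρ ts)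

      renameᵗˢ : ∀ {Γ Δ ss} → Renaming Γ Δ → All (Term L Γ) ss → All (Term L Δ) ss
      renameᵗˢ ρ [] = []
      renameᵗˢ ρ (t ∷ ts) = renameᵗ ρ t ∷ renameᵗˢ ρ ts

    rename : ∀ {Γ Δ} → Renaming Γ Δ → Formula L Γ → Formula L Δ
    rename ρ false = false
    rename ρ (t ≐ u) = (renameᵗ ρ t) ≐ (renameᵗ ρ u)
    rename ρ (rel R ts) = rel R (renameᵗˢ ρ ts)
    rename ρ (φ ⇒ ψ) = (rename ρ φ) ⇒ (rename ρ ψ)
    rename ρ (all s φ) = all s (rename (under ρ) φ)

    infixr 6 _∧ᶠ_
    _∧ᶠ_ : ∀ {Γ} → Formula L Γ → Formula L Γ → Formula L Γ
    φ ∧ᶠ ψ = ~ (φ ⇒ (~ ψ))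

    ⋀ : ∀ {Γ} n → (Fin n → Formula L Γ) → Formula L Γ
    ⋀ zero φ = ~ false
    ⋀ (suc n) φ = φ Fin.zero ∧ᶠ ⋀ n (φ ∘ Fin.suc)

    ∃* : ∀ Δ {Γ} → Formula L (Δ ++ Γ) → Formula L Γ
    ∃* [] φ = φ
    ∃* (s ∷ Δ) φ = ∃* Δ (~ (all s (~ φ)))

    _≐*_ : ∀ {Γ ss} → All (Term L Γ) ss → All (Term L Γ) ss → Formula L Γ
    [] ≐* [] = ~ false
    (t ∷ ts) ≐* (u ∷ us) = (t ≐ u) ∧ᶠ (ts ≐* us)

    vars : ∀ {Γ} Δ → Renaming Δ Γ → All (Term L Γ) Δ
    vars Δ ρ = All.tabulate λ x → var (ρ x)

    mutual
      embedᵗ : ∀ {Γ s} → Term L Γ s → Term (L ∪P) Γ s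
      embedᵗ (var x) = var x
      embedᵗ (app f ts) = app f (embedᵗˢ ts)

      embedᵗˢ : ∀ {Γ ss} → All (Term L Γ) ss → All (Term (L ∪P) Γ) ss
      embedᵗˢ [] = []
      embedᵗˢ (t ∷ ts) = embedᵗ t ∷ embedᵗˢ ts

    embed : ∀ {Γ} → Formula L Γ → Formula (L ∪P) Γ
    embed false = false
    embed (t ≐ u) = (embedᵗ t) ≐ (embedᵗ u)
    embed (rel R ts) = rel (old R) (embedᵗˢ ts)
    embed (φ ⇒ ψ) = (embed φ) ⇒ (embed ψ)
    embed (all s φ) = all s (embed φ)

    split-++ : ∀ Γ {Δ} {s : Sort L} (x : s ∈ Γ ++ Δ) →
               (∃ λ (y : s ∈ Γ) → ∈-++⁺ˡ y ≡ x) ⊎ (∃ λ (y : s ∈ Δ) → ∈-++⁺ʳ Γ y ≡ x)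
    split-++ [] x = inj₂ (x , refl)
    split-++ (_ ∷ Γ) (here e) = inj₁ (here e , refl)
    split-++ (_ ∷ Γ) (there x) with split-++ Γ x
    ... | inj₁ (y , refl) = inj₁ (there y , refl)
    ... | inj₂ (y , refl) = inj₂ (y , refl)

    module _ {σ : Ctx L} where

      block : ∀ n → Fin n → Renaming σ (_^_ {L = L} σ n)
      block (suc n) Fin.zero x = ∈-++⁺ˡ x
      block (suc n) (Fin.suc k) x = ∈-++⁺ʳ σ (block n k x)

      locate : ∀ n {s} (x : s ∈ _^_ {L = L} σ n) → Σ (Fin n) λ k → Σ (s ∈ σ) λ y → block n k y ≡ x
      locate (suc n) x = [ first , rest ]′ (split-++ σ {_^_ {L = L} σ n} x)
        where
        first : (∃ λ y → ∈-++⁺ˡ y ≡ x) → ∃ λ k → ∃ λ y → block (suc n) k y ≡ x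
        first (y , e) = Fin.zero , y , e
        rest : (∃ λ y → ∈-++⁺ʳ σ y ≡ x) → ∃ λ k → ∃ λ y → block (suc n) k y ≡ x
        rest (x′ , e) = let (k , y , e′) = locate n x′ in Fin.suc k , y , trans (cong (∈-++⁺ʳ σ) e′) e

    module _ {P : Sort L → Set ℓ} where

      lookup-++ˡ : ∀ {Γ Δ s} (v : All P Γ) (w : All P Δ) (x : s ∈ Γ) →
                   All.lookup (++⁺ v w) (∈-++⁺ˡ x) ≡ All.lookup v x
      lookup-++ˡ (_ ∷ v) w (here refl) = refl
      lookup-++ˡ (_ ∷ v) w (there x) = lookup-++ˡ v w x

      lookup-++ʳ : ∀ {Γ Δ s} (v : All P Γ) (w : All P Δ) (x : s ∈ Δ) →
                   All.lookup (++⁺ v w) (∈-++⁺ʳ Γ x) ≡ All.lookup w x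
      lookup-++ʳ [] w x = refl
      lookup-++ʳ (_ ∷ v) w x = lookup-++ʳ v w x

      lookup-tabulate : ∀ {Γ s} (f : ∀ {s} → s ∈ Γ → P s) (x : s ∈ Γ) →
                        All.lookup (All.tabulate {P = P} f) x ≡ f x
      lookup-tabulate f (here refl) = refl
      lookup-tabulate f (there x) = lookup-tabulate (f ∘ there) x

      lookup-ext : ∀ {Γ} (v w : All P Γ) →
                   (∀ {s} (x : s ∈ Γ) → All.lookup v x ≡ All.lookup w x) → v ≡ w
      lookup-ext [] [] h = refl
      lookup-ext (p ∷ v) (q ∷ w) h = cong₂ _∷_ (h (here refl)) (lookup-ext v w (h ∘ there))

    lookup-map : ∀ {P Q : Sort L → Set ℓ} (f : ∀ {s} → P s → Q s) {Γ s} (v : All P Γ) (x : s ∈ Γ) →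
                 All.lookup (All.map f v) x ≡ f (All.lookup v x)
    lookup-map f (_ ∷ v) (here refl) = refl
    lookup-map f (_ ∷ v) (there x) = lookup-map f v x

    module Semantics (𝔐 : Structure L) where

      infix 4 _⊩_
      _⊩_ : ∀ {Γ} → Tuple 𝔐 Γ → Formula L Γ → Set ℓ
      v ⊩ φ = 𝔐 ⊨ φ [ v ]

      Agree : ∀ {Γ Δ} → Renaming Γ Δ → Tuple 𝔐 Γ → Tuple 𝔐 Δ → Set ℓ
      Agree {Γ} ρ v w = ∀ {s} (x : s ∈ Γ) → All.lookup v x ≡ All.lookup w (ρ x)

      agree-under : ∀ {Γ Δ s} {ρ : Renaming Γ Δ} {v w} → Agree ρ v w → (a : Carrier 𝔐 s) →
                    Agree (under ρ) (a ∷ v) (a ∷ w)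
      agree-under h a (here refl) = refl
      agree-under h a (there x) = h x

      mutual
        eval-rename : ∀ {Γ Δ s} {ρ : Renaming Γ Δ} {v w} → Agree ρ v w → (t : Term L Γ s) →
                      eval 𝔐 w (renameᵗ ρ t) ≡ eval 𝔐 v t
        eval-rename h (var x) = sym (h x)
        eval-rename h (app f ts) = cong (fun 𝔐 f) (evals-rename h ts)

        evals-rename : ∀ {Γ Δ ss} {ρ : Renaming Γ Δ} {v w} → Agree ρ v w → (ts : All (Term L Γ) ss) →
                       evals 𝔐 w (renameᵗˢ ρ ts) ≡ evals 𝔐 v ts
        evals-rename h [] = refl
        evals-rename h (t ∷ ts) = cong₂ _∷_ (eval-rename h t) (evals-rename h ts)

      ⊩-rename : ∀ {Γ Δ} {ρ : Renaming Γ Δ} {v w} → Agree ρ v w → (φ : Formula L Γ) →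
                 (w ⊩ rename ρ φ) ⇔ (v ⊩ φ)
      ⊩-rename h false = ⇔-id _
      ⊩-rename h (t ≐ u) = ≡⇒⇔ (cong₂ _≡_ (eval-rename h t) (eval-rename h u))
      ⊩-rename h (rel R ts) = ≡⇒⇔ (cong (relation 𝔐 R) (evals-rename h ts))
      ⊩-rename h (φ ⇒ ψ) = mk⇔ (λ f p → fwd (⊩-rename h ψ) (f (bwd (⊩-rename h φ) p)))
                               (λ f p → bwd (⊩-rename h ψ) (f (fwd (⊩-rename h φ) p)))
      ⊩-rename h (all s φ) = mk⇔ (λ f a → fwd (⊩-rename (agree-under h a) φ) (f a))
                                 (λ f a → bwd (⊩-rename (agree-under h a) φ) (f a))

      ⊩-¬ : ∀ {Γ} {v : Tuple 𝔐 Γ} (φ : Formula L Γ) → (v ⊩ (~ φ)) ⇔ (¬ (v ⊩ φ))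
      ⊩-¬ φ = mk⇔ (λ f p → lower (f p)) (λ f p → lift (f p))

      ⊩-∧ : ∀ {Γ} {v : Tuple 𝔐 Γ} (φ ψ : Formula L Γ) → (v ⊩ φ ∧ᶠ ψ) ⇔ ((v ⊩ φ) × (v ⊩ ψ))
      ⊩-∧ φ ψ = mk⇔ (λ f → dne λ ¬pq → lower (f λ p q → lift (¬pq (p , q)))) (λ (p , q) f → f p q)

      ⊩-⋀ : ∀ {Γ} {v : Tuple 𝔐 Γ} n (φ : Fin n → Formula L Γ) → (v ⊩ ⋀ n φ) ⇔ (∀ i → v ⊩ φ i)
      ⊩-⋀ zero φ = mk⇔ (λ _ ()) (λ _ x → x)
      ⊩-⋀ (suc n) φ = mk⇔
        (λ h → let (p , q) = fwd (⊩-∧ (φ Fin.zero) (⋀ n (φ ∘ Fin.suc))) h in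
               λ { Fin.zero → p ; (Fin.suc i) → fwd (⊩-⋀ n (φ ∘ Fin.suc)) q i })
        (λ h → bwd (⊩-∧ (φ Fin.zero) (⋀ n (φ ∘ Fin.suc))) (h Fin.zero , bwd (⊩-⋀ n (φ ∘ Fin.suc)) (h ∘ Fin.suc)))

      ⊩-∃* : ∀ Δ {Γ} {v : Tuple 𝔐 Γ} (φ : Formula L (Δ ++ Γ)) →
             (v ⊩ ∃* Δ φ) ⇔ (∃ λ (d : Tuple 𝔐 Δ) → ++⁺ d v ⊩ φ)
      ⊩-∃* [] φ = mk⇔ ([] ,_) λ { ([] , h) → h }
      ⊩-∃* (s ∷ Δ) φ = mk⇔
        (λ h → let (d , k) = fwd (⊩-∃* Δ (~ (all s (~ φ)))) h in
               dne λ ¬e → lower (k λ a p → lift (¬e (a ∷ d , p))))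
        λ { (a ∷ d , h) → bwd (⊩-∃* Δ (~ (all s (~ φ)))) (d , λ f → f a h) }

      ⊩-≐* : ∀ {Γ ss} {v : Tuple 𝔐 Γ} (ts us : All (Term L Γ) ss) →
             (v ⊩ ts ≐* us) ⇔ (evals 𝔐 v ts ≡ evals 𝔐 v us)
      ⊩-≐* [] [] = mk⇔ (λ _ → refl) (λ _ x → x)
      ⊩-≐* (t ∷ ts) (u ∷ us) = mk⇔
        (λ h → let (p , q) = fwd (⊩-∧ (t ≐ u) (ts ≐* us)) h in cong₂ _∷_ p (fwd (⊩-≐* ts us) q))
        (λ e → let (p , q) = ∷-inj e in bwd (⊩-∧ (t ≐ u) (ts ≐* us)) (p , bwd (⊩-≐* ts us) q))
        where
        ∷-inj : ∀ {s ss} {a b : Carrier 𝔐 s} {v w : Tuple 𝔐 ss} →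
                _≡_ {A = Tuple 𝔐 (s ∷ ss)} (a ∷ v) (b ∷ w) → a ≡ b × v ≡ w
        ∷-inj refl = refl , refl

      evals-vars : ∀ {Γ} {w : Tuple 𝔐 Γ} Δ (ρ : Renaming Δ Γ) {v : Tuple 𝔐 Δ} → Agree ρ v w →
                   evals 𝔐 w (vars Δ ρ) ≡ v
      evals-vars [] ρ {[]} h = refl
      evals-vars (s ∷ Δ) ρ {a ∷ v} h = cong₂ _∷_ (sym (h (here refl))) (evals-vars Δ (ρ ∘ there) (h ∘ there))

      module _ {σ : Ctx L} where

        lookup-join : ∀ n (t : Fin n → Tuple 𝔐 σ) k {s} (x : s ∈ σ) →
                      All.lookup (join 𝔐 n t) (block n k x) ≡ All.lookup (t k) x
        lookup-join (suc n) t Fin.zero x = lookup-++ˡ (t Fin.zero) _ x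
        lookup-join (suc n) t (Fin.suc k) x =
          trans (lookup-++ʳ (t Fin.zero) _ (block n k x)) (lookup-join n (t ∘ Fin.suc) k x)

        component : ∀ n → Tuple 𝔐 (σ ^ n) → Fin n → Tuple 𝔐 σ
        component n c k = All.tabulate λ x → All.lookup c (block n k x)

        join-component : ∀ n (c : Tuple 𝔐 (σ ^ n)) → join 𝔐 n (component n c) ≡ c
        join-component n c = lookup-ext _ _ eq
          where
          eq : ∀ {s} (x : s ∈ _^_ {L = L} σ n) → All.lookup (join 𝔐 n (component n c)) x ≡ All.lookup c x
          eq x with locate n x
          ... | k , y , refl = trans (lookup-join n (component n c) k y) (lookup-tabulate _ y)

        join-cong : ∀ n {t u : Fin n → Tuple 𝔐 σ} → (∀ k → t k ≡ u k) → join 𝔐 n t ≡ join 𝔐 n u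
        join-cong zero h = refl
        join-cong (suc n) h = cong₂ ++⁺ (h Fin.zero) (join-cong n (h ∘ Fin.suc))

        relabel : ∀ {m n} → (Fin m → Fin n) → Renaming (_^_ {L = L} σ m) (_^_ {L = L} σ n)
        relabel {m} {n} r x = let (k , y , _) = locate m x in block n (r k) y

        agree-relabel : ∀ {m n} (r : Fin m → Fin n) (t : Fin n → Tuple 𝔐 σ) →
                        Agree (relabel r) (join 𝔐 m (t ∘ r)) (join 𝔐 n t)
        agree-relabel {m} {n} r t x with locate m x
        ... | k , y , refl = trans (lookup-join m (t ∘ r) k y) (sym (lookup-join n t (r k) y))

        equal : Formula L (_^_ {L = L} σ 2)
        equal = vars σ (block 2 Fin.zero) ≐* vars σ (block 2 (Fin.suc Fin.zero))

        ⊩-equal : (t : Fin 2 → Tuple 𝔐 σ) →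
                  (join 𝔐 2 t ⊩ equal) ⇔ (t Fin.zero ≡ t (Fin.suc Fin.zero))
        ⊩-equal t = ≡⇒⇔ (cong₂ _≡_ (evals-vars σ (block 2 Fin.zero) (λ x → sym (lookup-join 2 t Fin.zero x)))
                                   (evals-vars σ (block 2 (Fin.suc Fin.zero)) (λ x → sym (lookup-join 2 t (Fin.suc Fin.zero) x))))
                    ⇔-∘ ⊩-≐* (vars σ (block 2 Fin.zero)) (vars σ (block 2 (Fin.suc Fin.zero)))

    module _ (𝔐 : Structure L) (Q : ∀ {s} → Carrier 𝔐 s → Set ℓ) where

      private 𝔐ᴾ = expand 𝔐 Q

      mutual
        eval-embed : ∀ {Γ s} (v : Tuple 𝔐 Γ) (t : Term L Γ s) → eval 𝔐ᴾ v (embedᵗ t) ≡ eval 𝔐 v t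
        eval-embed v (var x) = refl
        eval-embed v (app f ts) = cong (fun 𝔐 f) (evals-embed v ts)

        evals-embed : ∀ {Γ ss} (v : Tuple 𝔐 Γ) (ts : All (Term L Γ) ss) →
                      evals 𝔐ᴾ v (embedᵗˢ ts) ≡ evals 𝔐 v ts
        evals-embed v [] = refl
        evals-embed v (t ∷ ts) = cong₂ _∷_ (eval-embed v t) (evals-embed v ts)

      ⊨-embed : ∀ {Γ} (φ : Formula L Γ) (v : Tuple 𝔐 Γ) → (𝔐ᴾ ⊨ embed φ [ v ]) ⇔ (𝔐 ⊨ φ [ v ])
      ⊨-embed false v = ⇔-id _
      ⊨-embed (t ≐ u) v = ≡⇒⇔ (cong₂ _≡_ (eval-embed v t) (eval-embed v u))
      ⊨-embed (rel R ts) v = ≡⇒⇔ (cong (relation 𝔐 R) (evals-embed v ts))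
      ⊨-embed (φ ⇒ ψ) v = mk⇔ (λ f p → fwd (⊨-embed ψ v) (f (bwd (⊨-embed φ v) p)))
                              (λ f p → bwd (⊨-embed ψ v) (f (fwd (⊨-embed φ v) p)))
      ⊨-embed (all s φ) v = mk⇔ (λ f a → fwd (⊨-embed φ (a ∷ v)) (f a))
                                (λ f a → bwd (⊨-embed φ (a ∷ v)) (f a))

  -- Ultrafilters

  -- Finite intersections and maximality suffice as axioms. Closure under supersets and
  -- intersections follows in `entail`, because a large complement would produce an empty finite
  -- intersection.
  record Ultrafilter {a} (X : Set a) : Set a where
    field
      large : (X → Bool) → Bool
      fip   : ∀ Ys → All (T ∘ large) Ys → ∃ λ x → All (λ Y → T (Y x)) Ys
      ultra : ∀ Y → T (large Y) ⊎ T (large (not ∘ Y))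

    entail : ∀ Ys Z → All (T ∘ large) Ys → (∀ x → All (λ Y → T (Y x)) Ys → T (Z x)) → T (large Z)
    entail Ys Z h k with ultra Z
    ... | inj₁ z = z
    ... | inj₂ ¬z with fip (_ ∷ Ys) (¬z ∷ h)
    ...   | x , ¬Zx ∷ Ysx = ⊥-elim (T-not⇒¬T ¬Zx (k x Ysx))

    ∀ᵁ : ∀ {b} → (X → Set b) → Set
    ∀ᵁ A = T (large λ x → ⌊ A x ⌋)

    module _ {b} {A : X → Set b} where

      ∀ᵁ-witness : ∀ᵁ A → ∃ A
      ∀ᵁ-witness h with fip _ (h ∷ [])
      ... | x , p ∷ [] = x , holds p

      ∀ᵁ-pure : (∀ x → A x) → ∀ᵁ A
      ∀ᵁ-pure h = entail [] _ [] λ x _ → check (h x)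

      ∀ᵁ-map : ∀ {c} {Q : X → Set c} → (∀ x → A x → Q x) → ∀ᵁ A → ∀ᵁ Q
      ∀ᵁ-map f h = entail _ _ (h ∷ []) λ { x (p ∷ []) → check (f x (holds p)) }

      ∀ᵁ-zip : ∀ {c d} {Q : X → Set c} {R : X → Set d} →
               (∀ x → A x → Q x → R x) → ∀ᵁ A → ∀ᵁ Q → ∀ᵁ R
      ∀ᵁ-zip f h k = entail _ _ (h ∷ k ∷ []) λ { x (p ∷ q ∷ []) → check (f x (holds p) (holds q)) }

      ∀ᵁ-contra : ∀ᵁ A → ∀ᵁ (¬_ ∘ A) → ⊥
      ∀ᵁ-contra h k with fip _ (h ∷ k ∷ [])
      ... | x , p ∷ q ∷ [] = holds q (holds p)

    ∀ᵁ-decide : ∀ {b} (A : X → Set b) → ∀ᵁ A ⊎ ∀ᵁ (¬_ ∘ A)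
    ∀ᵁ-decide A with ultra (λ x → ⌊ A x ⌋)
    ... | inj₁ h = inj₁ h
    ... | inj₂ h = inj₂ (entail _ _ (h ∷ []) λ { x (p ∷ []) → check (T-not⇒¬T p ∘ check) })

    ∀ᵁ-fin : ∀ n {b} {A : Fin n → X → Set b} → (∀ k → ∀ᵁ (A k)) → ∀ᵁ (λ x → ∀ k → A k x)
    ∀ᵁ-fin zero h = ∀ᵁ-pure λ x ()
    ∀ᵁ-fin (suc n) h = ∀ᵁ-zip (λ { x p q Fin.zero → p ; x p q (Fin.suc k) → q k })
                              (h Fin.zero) (∀ᵁ-fin n (h ∘ Fin.suc))

    ∀ᵁ-list : ∀ {b i} {I : Set i} {A : I → X → Set b} {is : List I} →
              All (λ i → ∀ᵁ (A i)) is → ∀ᵁ (λ x → All (λ i → A i x) is)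
    ∀ᵁ-list [] = ∀ᵁ-pure λ _ → []
    ∀ᵁ-list (h ∷ hs) = ∀ᵁ-zip (λ _ → _∷_) h (∀ᵁ-list hs)

  module _ {a b c} {X : Set a} {J : Set b} (S : J → X → Set c)
           (S-fip : ∀ js → ∃ λ x → All (λ j → S j x) js) where

    private
      FIP : ((X → Bool) → Bool) → Set a
      FIP 𝒢 = ∀ Ys → All (T ∘ 𝒢) Ys → ∃ λ x → All (λ Y → T (Y x)) Ys

      record Base : Set (a ⊔ b) where
        field
          family : (X → Bool) → Bool
          fip    : FIP family
          base   : ∀ j → T (family λ x → ⌊ S j x ⌋)

      open Base

      _≼_ : Base → Base → Set a
      p ≼ q = ∀ Y → T (family p Y) → T (family q Y)

      initial : Base
      initial = record
        { family = λ Y → ⌊ (∃ λ j → (λ x → ⌊ S j x ⌋) ≡ Y) ⌋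
        ; fip    = λ Ys h → let (js , f) = indices Ys h ; (x , s) = S-fip js in x , f x s
        ; base   = λ j → check (j , refl)
        }
        where
        indices : ∀ Ys → All (λ Y → T ⌊ (∃ λ j → (λ x → ⌊ S j x ⌋) ≡ Y) ⌋) Ys →
                  ∃ λ js → ∀ x → All (λ j → S j x) js → All (λ Y → T (Y x)) Ys
        indices [] [] = [] , λ x _ → []
        indices (Y ∷ Ys) (h ∷ hs) with holds h | indices Ys hs
        ... | j , refl | js , f = j ∷ js , λ { x (s ∷ ss) → check s ∷ f x ss }

      chain-bound : ∀ C → Chain _≼_ C → ∃ λ U → ∀ p → T (C p) → p ≼ U
      chain-bound C c with em {P = ∃ λ p → T (C p)}
      ... | no ¬p = initial , λ p h → ⊥-elim (¬p (p , h))
      ... | yes (p₀ , h₀) = record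
        { family = λ Y → ⌊ Mem Y ⌋
        ; fip    = λ Ys h → let (p , _ , k) = common Ys h in fip p Ys k
        ; base   = λ j → check (p₀ , h₀ , base p₀ j)
        } , λ p h Y k → check (p , h , k)
        where
        Mem : (X → Bool) → Set _
        Mem Y = ∃ λ p → T (C p) × T (family p Y)

        common : ∀ Ys → All (λ Y → T ⌊ Mem Y ⌋) Ys → ∃ λ p → T (C p) × All (T ∘ family p) Ys
        common [] [] = p₀ , h₀ , []
        common (Y ∷ Ys) (h ∷ hs) with holds h | common Ys hs
        ... | p , r , k | q , s , l =
          [ (λ le → q , s , le Y k ∷ l) , (λ le → p , r , k ∷ All.map (le _) l) ]′ (c p q r s)

      module _ (p : Base) (max : ∀ q → p ≼ q → q ≼ p) where

        Compatible : (X → Bool) → Set a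
        Compatible Z = ∀ Ys → All (T ∘ family p) Ys → ∃ λ x → T (Z x) × All (λ Y → T (Y x)) Ys

        compatible⇒member : ∀ Z → Compatible Z → T (family p Z)
        compatible⇒member Z comp = max q (λ _ → check ∘ inj₁) Z (check (inj₂ refl))
          where
          Fam : (X → Bool) → Set a
          Fam Y = T (family p Y) ⊎ Y ≡ Z

          members : ∀ Ys → All (T ∘ λ Y → ⌊ Fam Y ⌋) Ys → ∃ λ Ys′ → All (T ∘ family p) Ys′ ×
                    (∀ x → T (Z x) → All (λ Y → T (Y x)) Ys′ → All (λ Y → T (Y x)) Ys)
          members [] [] = [] , [] , λ _ _ _ → []
          members (Y ∷ Ys) (h ∷ hs) with holds h | members Ys hs
          ... | inj₁ k | Ys′ , k′ , f = Y ∷ Ys′ , k ∷ k′ , λ { x z (y ∷ ys) → y ∷ f x z ys }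
          ... | inj₂ refl | Ys′ , k′ , f = Ys′ , k′ , λ x z ys → z ∷ f x z ys

          q : Base
          q = record
            { family = λ Y → ⌊ Fam Y ⌋
            ; fip    = λ Ys h → let (Ys′ , k , f) = members Ys h ; (x , z , ys) = comp Ys′ k in x , f x z ys
            ; base   = λ j → check (inj₁ (base p j))
            }

        -- If neither side is compatible, one finite subfamily has no common point in `Z` and
        -- another has none outside it. Their concatenation has a common point, which must lie on
        -- one of the sides.
        member-or-not : ∀ Z → T (family p Z) ⊎ T (family p (not ∘ Z))
        member-or-not Z with em {P = Compatible Z}
        ... | yes comp = inj₁ (compatible⇒member Z comp)
        ... | no ¬comp = inj₂ (compatible⇒member (not ∘ Z) λ Ys h → dne λ ¬x →
                ¬comp λ Ys₀ h₀ → dne λ ¬x₀ →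
                let (x , every) = fip p (Ys₀ ++ Ys) (++⁺ h₀ h)
                    (all₀ , all₁) = ++⁻ Ys₀ every
                in ¬x (x , ¬T⇒T-not (λ z → ¬x₀ (x , z , all₀)) , all₁))

    ultrafilter : Σ (Ultrafilter X) λ U → ∀ j → Ultrafilter.∀ᵁ U (S j)
    ultrafilter with zorn _≼_ (λ Y → id) (λ f g Y → g Y ∘ f Y) chain-bound
    ... | p , max = record { large = family p ; fip = fip p ; ultra = member-or-not p max } , base p

  -- Coheir extensions of indiscernible sequences

  module Sequences {ℓ} {L : Language ℓ} (𝔐 : Structure L)
                   (Q : ∀ {s} → Carrier 𝔐 s → Set ℓ) (σ : Ctx L) where

    open Semantics 𝔐

    V : Set ℓ
    V = Tuple 𝔐 σ

    Fm : ℕ → Set ℓ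
    Fm m = Formula L (_^_ {L = L} σ m)

    infix 4 _⊩*_
    _⊩*_ : ∀ {m} → (Fin m → V) → Fm m → Set ℓ
    _⊩*_ {m} t θ = join 𝔐 m t ⊩ θ

    ⊩*-cong : ∀ {m} (θ : Fm m) {t u : Fin m → V} → (∀ k → t k ≡ u k) → t ⊩* θ → u ⊩* θ
    ⊩*-cong θ h = subst (_⊩ θ) (join-cong _ h)

    -- The elements of a non-constant indiscernible sequence are distinct, so the
    -- sequence is an ordered subset of V.
    record Seq : Set ℓ where
      field
        dom    : V → Bool
        lt     : V → V → Bool
        irrefl : ∀ {x} → T (dom x) → ¬ T (lt x x)
        trans< : ∀ {x y z} → T (dom x) → T (dom y) → T (dom z) → T (lt x y) → T (lt y z) → T (lt x z)
        tri    : ∀ {x y} → T (dom x) → T (dom y) → T (lt x y) ⊎ x ≡ y ⊎ T (lt y x)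
        inQ    : ∀ {x} → T (dom x) → AllIn 𝔐 Q x
        indisc : ∀ {m} (θ : Fm m) (t u : Fin m → V) →
                 (∀ k → T (dom (t k))) → (∀ k → T (dom (u k))) →
                 (∀ k l → T (lt (t k) (t l)) ⇔ T (lt (u k) (u l))) → t ⊩* θ → u ⊩* θ

    open Seq

    infix 4 _∈ˢ_
    _∈ˢ_ : V → Seq → Set
    x ∈ˢ B = T (dom B x)

    record El (B : Seq) : Set ℓ where
      constructor _,_
      field
        point  : V
        member : point ∈ˢ B

    open El

    -- Each block of variables of the matrix stands for one of the n variables or
    -- for an element of B.
    record OverSeq (B : Seq) (n : ℕ) : Set ℓ where
      constructor over
      field
        {arity} : ℕ
        matrix  : Fm arity
        args    : Fin arity → Fin n ⊎ El B

    value : ∀ {B n} → (Fin n → V) → Fin n ⊎ El B → V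
    value c = [ c , point ]′

    infix 4 _⊨ᵒ_
    record _⊨ᵒ_ {B n} (c : Fin n → V) (θ : OverSeq B n) : Set ℓ where
      constructor sat
      open OverSeq θ
      field
        unsat : (value c ∘ args) ⊩* matrix

    open _⊨ᵒ_

    ¬ᵒ_ : ∀ {B n} → OverSeq B n → OverSeq B n
    ¬ᵒ over θ g = over (~ θ) g

    infix 4 _⊑_
    record _⊑_ (B C : Seq) : Set ℓ where
      field
        sub    : ∀ {x} → x ∈ˢ B → x ∈ˢ C
        order  : ∀ {x y} → x ∈ˢ B → y ∈ˢ B → T (lt B x y) ⇔ T (lt C x y)
        coheir : ∀ {n} (θs : List (OverSeq B n)) (t : Fin n → V) → (∀ k → t k ∈ˢ C) →
                 All (t ⊨ᵒ_) θs → ∃ λ u → (∀ k → u k ∈ˢ B) × All (u ⊨ᵒ_) θs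

      promote : El B → El C
      promote (x , h) = x , sub h

      transport : ∀ {n} → OverSeq B n → OverSeq C n
      transport (over θ g) = over θ (Sum.map₂ promote ∘ g)

      transport-⇔ : ∀ {n} (θ : OverSeq B n) c → (c ⊨ᵒ transport θ) ⇔ (c ⊨ᵒ θ)
      transport-⇔ (over θ g) c = mk⇔ (λ h → sat (⊩*-cong θ (eq ∘ g) (unsat h)))
                                     (λ h → sat (⊩*-cong θ (sym ∘ eq ∘ g) (unsat h)))
        where
        eq : ∀ a → value {C} c (Sum.map₂ promote a) ≡ value {B} c a
        eq (inj₁ k) = refl
        eq (inj₂ x) = refl

    open _⊑_

    ⊑-refl : ∀ {B} → B ⊑ B
    ⊑-refl = record { sub = id ; order = λ _ _ → ⇔-id _ ; coheir = λ θs t h k → t , h , k }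

    ⊑-trans : ∀ {B C D} → B ⊑ C → C ⊑ D → B ⊑ D
    ⊑-trans p q = record
      { sub    = sub q ∘ sub p
      ; order  = λ h k → order q (sub p h) (sub p k) ⇔-∘ order p h k
      ; coheir = λ θs t h k →
          let (u , h′ , k′) = coheir q (List.map (transport p) θs) t h
                                (map⁺ (All.map (λ {θ} → bwd (transport-⇔ p θ t)) k))
          in coheir p θs u h′ (All.map (λ {θ} → fwd (transport-⇔ p θ u)) (map⁻ k′))
      }

    module _ {n} (φ : (Fin n → V) → Set ℓ) where

      Decides : ∀ {B} → List (OverSeq B n) → Set ℓ
      Decides θs = (∀ c → (∀ k → AllIn 𝔐 Q (c k)) → All (c ⊨ᵒ_) θs → φ c) ⊎
                   (∀ c → (∀ k → AllIn 𝔐 Q (c k)) → All (c ⊨ᵒ_) θs → ¬ φ c)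

      record Handled (B : Seq) : Set ℓ where
        field
          pieces : List (List (OverSeq B n))
          decide : All Decides pieces
          cover  : ∀ t → (∀ k → t k ∈ˢ B) → Any (All (t ⊨ᵒ_)) pieces

      open Handled

      -- A deciding list speaks about all of P and keeps its meaning. A tuple of `C` outside the
      -- cover fails one formula from each piece; these finitely many negations are formulas over
      -- `B`, so `coheir` produces a tuple of `B` outside the cover.
      handled-mono : ∀ {B C} → B ⊑ C → Handled B → Handled C
      handled-mono {B} {C} p H = record
        { pieces = List.map (List.map (transport p)) (pieces H)
        ; decide = map⁺ (All.map transport-decides (decide H))
        ; cover  = λ t h → Any.map⁺ (Any.map (λ a → map⁺ (All.map (λ {θ} → bwd (transport-⇔ p θ t)) a)) (cover-C t h))
        }
        where
        back : ∀ {θs} c → All (c ⊨ᵒ_) (List.map (transport p) θs) → All (c ⊨ᵒ_) θs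
        back c a = All.map (λ {θ} → fwd (transport-⇔ p θ c)) (map⁻ a)

        transport-decides : ∀ {θs} → Decides θs → Decides (List.map (transport p) θs)
        transport-decides = Sum.map (λ f c h a → f c h (back c a)) (λ f c h a → f c h (back c a))

        failing : ∀ (t : Fin n → V) (θss : List (List (OverSeq B n))) → ¬ Any (All (t ⊨ᵒ_)) θss →
                  ∃ λ ψs → All (t ⊨ᵒ_) ψs × (∀ u → All (u ⊨ᵒ_) ψs → ¬ Any (All (u ⊨ᵒ_)) θss)
        failing t [] ¬a = [] , [] , λ _ _ ()
        failing t (θs ∷ θss) ¬a with failing t θss (¬a ∘ there)
                                   | em {P = ∃ λ θ → θ ∈ θs × ¬ (t ⊨ᵒ θ)}
        ... | _ | no ¬e = ⊥-elim (¬a (here (All.tabulate λ {θ} i → dne λ ¬h → ¬e (θ , i , ¬h))))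
        ... | ψs , h , f | yes (θ , i , ¬h) = ¬ᵒ θ ∷ ψs , sat (λ k → lift (¬h (sat k))) ∷ h ,
                λ { u (k ∷ ks) (here a) → lower (unsat k (unsat (All.lookup a i))) ; u (k ∷ ks) (there a) → f u ks a }

        cover-C : ∀ t → (∀ k → t k ∈ˢ C) → Any (All (t ⊨ᵒ_)) (pieces H)
        cover-C t h = dne λ ¬a →
          let (ψs , k , f) = failing t (pieces H) ¬a
              (u , h′ , k′) = coheir p ψs t h k
          in f u k′ (cover H u h′)

    module _ (B : Seq) {Y : Set ℓ} (U : Ultrafilter Y) {n : ℕ} where

      open Ultrafilter U

      -- One implication is enough: applied to the negation it gives the converse, since the
      -- ultrafilter decides every formula. The index set `Y` is independent of `B`, so that one
      -- ultrafilter can be used again over a larger sequence.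
      IsLimit : (Fin n → Y → V) → (Fin n → V) → Set ℓ
      IsLimit e d = ∀ (θ : OverSeq B n) → ∀ᵁ (λ y → (λ k → e k y) ⊨ᵒ θ) → d ⊨ᵒ θ

      module Limit (e : Fin n → Y → V) (e∈ : ∀ k y → e k y ∈ˢ B)
                   (d : Fin n → V) (d∈Q : ∀ k → AllIn 𝔐 Q (d k)) (lim : IsLimit e d) where

        -- Names of the points of the extension. A point may have several names, for instance when a
        -- coordinate converges to an element of `B`; `value-≡` and `lt-germ` show that nothing
        -- depends on the choice.
        Germ : Set ℓ
        Germ = Fin n ⊎ El B

        rep : Germ → Y → V
        rep g y = value (λ k → e k y) g

        rep∈ : ∀ g y → rep g y ∈ˢ B
        rep∈ (inj₁ k) y = e∈ k y
        rep∈ (inj₂ (x , h)) y = h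

        -- The analogue of Łoś's theorem, with germs in place of elements of an ultrapower.
        lim-⇔ : ∀ {m} (θ : Fm m) (g : Fin m → Germ) →
                ∀ᵁ (λ y → (λ k → rep (g k) y) ⊩* θ) ⇔ ((value d ∘ g) ⊩* θ)
        lim-⇔ θ g = mk⇔
          (λ h → unsat (lim (over θ g) (∀ᵁ-map (λ _ → sat) h)))
          (λ h → [ id , (λ ¬θ → ⊥-elim (lower
             (unsat (lim (over (~ θ) g) (∀ᵁ-map (λ y k → sat (lift ∘ k)) ¬θ)) h))) ]′
             (∀ᵁ-decide λ y → (λ k → rep (g k) y) ⊩* θ))

        pairOf : Germ → Germ → Fin 2 → Germ
        pairOf g h Fin.zero = g
        pairOf g h (Fin.suc _) = h

        value-≡ : ∀ g h → ∀ᵁ (λ y → rep g y ≡ rep h y) ⇔ (value d g ≡ value d h)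
        value-≡ g h = mk⇔
          (λ k → fwd (⊩-equal (value d ∘ pairOf g h)) (fwd (lim-⇔ (equal {σ = σ}) (pairOf g h))
                   (∀ᵁ-map (λ y → bwd (⊩-equal λ i → rep (pairOf g h i) y)) k)))
          (λ k → ∀ᵁ-map (λ y → fwd (⊩-equal λ i → rep (pairOf g h i) y))
                   (bwd (lim-⇔ (equal {σ = σ}) (pairOf g h)) (bwd (⊩-equal (value d ∘ pairOf g h)) k)))

        dom′ : V → Set ℓ
        dom′ x = ∃ λ (g : Germ) → value d g ≡ x

        lt′ : V → V → Set ℓ
        lt′ x y = ∃ λ (g : Germ) → ∃ λ (h : Germ) →
          value d g ≡ x × value d h ≡ y × ∀ᵁ (λ i → T (lt B (rep g i) (rep h i)))

        -- The order is not given by a formula, so it is defined through the ultrafilter.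
        -- Independence of the names comes from equality, which is a formula: two names of one point
        -- have representatives that agree almost everywhere.
        lt-germ : ∀ g h → T ⌊ lt′ (value d g) (value d h) ⌋ ⇔ ∀ᵁ (λ y → T (lt B (rep g y) (rep h y)))
        lt-germ g h = mk⇔ to′ (λ k → check (g , h , refl , refl , k))
          where
          to′ : T ⌊ lt′ (value d g) (value d h) ⌋ → ∀ᵁ (λ y → T (lt B (rep g y) (rep h y)))
          to′ k with holds k
          ... | g′ , h′ , p , q , l = ∀ᵁ-zip (λ y eq l → subst (λ x → T (lt B x _)) eq l) (bwd (value-≡ g′ g) p)
                  (∀ᵁ-zip (λ y eq l → subst (λ x → T (lt B _ x)) eq l) (bwd (value-≡ h′ h) q) l)

        germ : ∀ {m} (t : Fin m → V) → (∀ k → T ⌊ dom′ (t k) ⌋) →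
               ∃ λ (g : Fin m → Germ) → ∀ k → value d (g k) ≡ t k
        germ t h = (λ k → proj₁ (holds (h k))) , λ k → proj₂ (holds (h k))

        limit : Seq
        limit = record
          { dom    = λ x → ⌊ dom′ x ⌋
          ; lt     = λ x y → ⌊ lt′ x y ⌋
          ; irrefl = λ h → irrefl′ (holds h)
          ; trans< = λ h k l → trans′ (holds h) (holds k) (holds l)
          ; tri    = λ h k → tri′ (holds h) (holds k)
          ; inQ    = λ h → inQ′ (holds h)
          ; indisc = λ θ t u h k → indisc′ θ t u (germ t h) (germ u k)
          }
          where
          irrefl′ : ∀ {x} → dom′ x → ¬ T ⌊ lt′ x x ⌋
          irrefl′ (g , refl) k = let (y , l) = ∀ᵁ-witness (fwd (lt-germ g g) k) in irrefl B (rep∈ g y) l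

          trans′ : ∀ {x y z} → dom′ x → dom′ y → dom′ z →
                   T ⌊ lt′ x y ⌋ → T ⌊ lt′ y z ⌋ → T ⌊ lt′ x z ⌋
          trans′ (g , refl) (h , refl) (i , refl) k l = bwd (lt-germ g i)
            (∀ᵁ-zip (λ y → trans< B (rep∈ g y) (rep∈ h y) (rep∈ i y)) (fwd (lt-germ g h) k) (fwd (lt-germ h i) l))

          tri′ : ∀ {x y} → dom′ x → dom′ y → T ⌊ lt′ x y ⌋ ⊎ x ≡ y ⊎ T ⌊ lt′ y x ⌋
          tri′ (g , refl) (h , refl) with ∀ᵁ-decide (λ y → T (lt B (rep g y) (rep h y)))
                                        | ∀ᵁ-decide (λ y → T (lt B (rep h y) (rep g y)))
          ... | inj₁ l | _ = inj₁ (bwd (lt-germ g h) l)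
          ... | inj₂ _ | inj₁ l = inj₂ (inj₂ (bwd (lt-germ h g) l))
          ... | inj₂ a | inj₂ b = inj₂ (inj₁ (fwd (value-≡ g h) (∀ᵁ-zip neither a b)))
            where
            neither : ∀ y → ¬ T (lt B (rep g y) (rep h y)) → ¬ T (lt B (rep h y) (rep g y)) → rep g y ≡ rep h y
            neither y ¬a ¬b with tri B (rep∈ g y) (rep∈ h y)
            ... | inj₁ l = contradiction l ¬a
            ... | inj₂ (inj₁ eq) = eq
            ... | inj₂ (inj₂ l) = contradiction l ¬b

          inQ′ : ∀ {x} → dom′ x → AllIn 𝔐 Q x
          inQ′ (inj₁ k , refl) = d∈Q k
          inQ′ (inj₂ (x , h) , refl) = inQ B h

          -- The order relations among finitely many germs are decided almost everywhere. At such an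
          -- index the two tuples of representatives have the same order type in `B`, and
          -- indiscernibility of `B` applies there.
          indisc′ : ∀ {m} (θ : Fm m) (t u : Fin m → V) →
                    (∃ λ (g : Fin m → Germ) → ∀ k → value d (g k) ≡ t k) →
                    (∃ λ (g : Fin m → Germ) → ∀ k → value d (g k) ≡ u k) →
                    (∀ k l → T ⌊ lt′ (t k) (t l) ⌋ ⇔ T ⌊ lt′ (u k) (u l) ⌋) → t ⊩* θ → u ⊩* θ
          indisc′ {m} θ t u (g , p) (h , q) so k = ⊩*-cong θ q (fwd (lim-⇔ θ h)
            (∀ᵁ-zip (λ y s → indisc B θ _ _ (λ i → rep∈ (g i) y) (λ i → rep∈ (h i) y) s)
               (∀ᵁ-fin m λ i → ∀ᵁ-fin m λ j → same i j)
               (bwd (lim-⇔ θ g) (⊩*-cong θ (sym ∘ p) k))))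
            where
            so′ : ∀ i j → T ⌊ lt′ (value d (g i)) (value d (g j)) ⌋ ⇔ T ⌊ lt′ (value d (h i)) (value d (h j)) ⌋
            so′ i j = subst₂ (λ A C → T A ⇔ T C)
              (cong₂ (λ x y → ⌊ lt′ x y ⌋) (sym (p i)) (sym (p j)))
              (cong₂ (λ x y → ⌊ lt′ x y ⌋) (sym (q i)) (sym (q j))) (so i j)

            same : ∀ i j → ∀ᵁ (λ y → T (lt B (rep (g i) y) (rep (g j) y)) ⇔ T (lt B (rep (h i) y) (rep (h j) y)))
            same i j with ∀ᵁ-decide (λ y → T (lt B (rep (g i) y) (rep (g j) y)))
                        | ∀ᵁ-decide (λ y → T (lt B (rep (h i) y) (rep (h j) y)))
            ... | inj₁ a | inj₁ b = ∀ᵁ-zip (λ y a b → mk⇔ (λ _ → b) (λ _ → a)) a b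
            ... | inj₂ a | inj₂ b = ∀ᵁ-zip (λ y a b → mk⇔ (⊥-elim ∘ a) (⊥-elim ∘ b)) a b
            ... | inj₁ a | inj₂ b = ⊥-elim (∀ᵁ-contra
                    (fwd (lt-germ (h i) (h j)) (fwd (so′ i j) (bwd (lt-germ (g i) (g j)) a))) b)
            ... | inj₂ a | inj₁ b = ⊥-elim (∀ᵁ-contra
                    (fwd (lt-germ (g i) (g j)) (bwd (so′ i j) (bwd (lt-germ (h i) (h j)) b))) a)

        limit-⊒ : B ⊑ limit
        limit-⊒ = record
          { sub    = λ h → check (inj₂ (_ , h) , refl)
          ; order  = λ h k → mk⇔
              (λ l → bwd (lt-germ (inj₂ (_ , h)) (inj₂ (_ , k))) (∀ᵁ-pure λ _ → l))
              (λ l → proj₂ (∀ᵁ-witness (fwd (lt-germ (inj₂ (_ , h)) (inj₂ (_ , k))) l)))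
          ; coheir = coheir′
          }
          where
          coheir′ : ∀ {m} (θs : List (OverSeq B m)) (t : Fin m → V) → (∀ k → T ⌊ dom′ (t k) ⌋) →
                    All (t ⊨ᵒ_) θs → ∃ λ u → (∀ k → u k ∈ˢ B) × All (u ⊨ᵒ_) θs
          coheir′ {m} θs t h ks with germ t h
          -- All names are evaluated at one index where every formula of the list holds.
          ... | g , p = let (y , k) = ∀ᵁ-witness (∀ᵁ-list (All.map eventually ks)) in
                        (λ k → rep (g k) y) , (λ k → rep∈ (g k) y) , k
            where
            compose : Fin m ⊎ El B → Germ
            compose = [ g , inj₂ ]′

            value-compose : ∀ a → value {B} t a ≡ value d (compose a)
            value-compose (inj₁ k) = sym (p k)
            value-compose (inj₂ x) = refl

            rep-compose : ∀ y a → rep (compose a) y ≡ value (λ k → rep (g k) y) a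
            rep-compose y (inj₁ k) = refl
            rep-compose y (inj₂ x) = refl

            eventually : ∀ {θ} → t ⊨ᵒ θ → ∀ᵁ (λ y → (λ k → rep (g k) y) ⊨ᵒ θ)
            eventually {over θ a} (sat k) = ∀ᵁ-map (λ y l → sat (⊩*-cong θ (rep-compose y ∘ a) l))
              (bwd (lim-⇔ θ (compose ∘ a)) (⊩*-cong θ (value-compose ∘ a) k))

        limit-new : ∀ {x} → x ∈ˢ limit → x ∈ˢ B ⊎ ∃ λ k → d k ≡ x
        limit-new h with holds h
        ... | inj₁ k , e = inj₂ (k , e)
        ... | inj₂ (x , h) , refl = inj₁ h

  -- Twins and the independence property

  module Extension {ℓ} {L : Language ℓ} (𝔐 : Structure L)
                   (Q : ∀ {s} → Carrier 𝔐 s → Set ℓ) (σ : Ctx L) where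

    open Semantics 𝔐
    open Sequences 𝔐 Q σ
    open Seq
    open El
    open _⊑_
    open Ultrafilter

    signed : Bool → Set ℓ → Set ℓ
    signed true X = X
    signed false X = ¬ X

    -- All that the twins require of saturation. The cardinal `κ` does not occur, which keeps the
    -- combinatorics of the sequences apart from questions of size.
    Realisable : ∀ {n} → ((Fin n → V) → Set ℓ) → Seq → Set (Level.suc ℓ)
    Realisable {n} φ B = ∀ (p : OverSeq B n → Set ℓ) β →
      (∀ θs → All p θs → ∃ λ c → (∀ k → AllIn 𝔐 Q (c k)) × All (c ⊨ᵒ_) θs × signed β (φ c)) →
      ∃ λ c → (∀ k → AllIn 𝔐 Q (c k)) × (∀ θ → p θ → c ⊨ᵒ θ) × signed β (φ c)

    -- The flag is the direction of the comparison, so that each exchange statement covers points to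
    -- the left and to the right of a twin.
    before : Bool → Seq → V → V → Set
    before true B x y = T (lt B x y)
    before false B x y = T (lt B y x)

    before-⊑ : ∀ {B C} δ → B ⊑ C → ∀ {x y} → x ∈ˢ B → y ∈ˢ B → before δ B x y ⇔ before δ C x y
    before-⊑ true p h k = order p h k
    before-⊑ false p h k = order p k h

    FiniteOver : Seq → Seq → Set ℓ
    FiniteOver B C = ∃ λ (xs : List V) → ∀ {x} → x ∈ˢ C → x ∈ˢ B ⊎ x ∈ xs

    finite-trans : ∀ {B C D} → FiniteOver B C → FiniteOver C D → FiniteOver B D
    finite-trans (xs , f) (ys , g) =
      xs ++ ys , λ h → [ Sum.map₂ ∈-++⁺ˡ ∘ f , inj₂ ∘ ∈-++⁺ʳ xs ]′ (g h)

    -- tw true and tw false realise the same ultrafilter limit over B.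
    record Twins {n} (φ : (Fin n → V) → Set ℓ) (B next : Seq) : Set ℓ where
      field
        U      : Ultrafilter (Fin n → El B)
        extend : B ⊑ next
        tw     : Bool → Fin n → V
        tw∈    : ∀ β k → tw β k ∈ˢ next
        new    : ∀ {x} → x ∈ˢ next → x ∈ˢ B ⊎ ∃ λ β → ∃ λ k → tw β k ≡ x
        germ-≡ : ∀ β (g h : Fin n ⊎ El B) →
                 ∀ᵁ U (λ y → value {B} (point ∘ y) g ≡ value (point ∘ y) h) ⇔
                 (value (tw β) g ≡ value (tw β) h)
        germ-< : ∀ δ β (g h : Fin n ⊎ El B) →
                 before δ next (value (tw β) g) (value (tw β) h) ⇔
                 ∀ᵁ U (λ y → before δ B (value (point ∘ y) g) (value (point ∘ y) h))
        sign   : ∀ β → signed β (φ (tw β))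

    module _ {n} (φ : (Fin n → V) → Set ℓ) where

      -- Not being handled says that no finite union of deciding sets covers the n-tuples of `B`,
      -- which is the finite intersection property of their complements.
      undecided : ∀ B → ¬ Handled φ B → Σ (Ultrafilter (Fin n → El B)) λ U →
                  ∀ (θs : List (OverSeq B n)) → Decides φ θs → ∀ᵁ U (λ y → ¬ All ((point ∘ y) ⊨ᵒ_) θs)
      undecided B ¬H =
        let (U , h) = ultrafilter {J = ∃ (Decides φ {B})} (λ j y → ¬ All ((point ∘ y) ⊨ᵒ_) (proj₁ j)) λ js → dne λ ¬x →
              ¬H record
                { pieces = List.map proj₁ js
                ; decide = map⁺ (All.tabulate λ {j} _ → proj₂ j)
                ; cover  = λ t t∈ → dne λ ¬a → ¬x ((λ k → t k , t∈ k) ,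
                    All.tabulate λ i a → ¬a (Any.map⁺ (Any.map (λ { refl → a }) i)))
                }
        in U , λ θs dec → h (θs , dec)

      module _ {B} (U : Ultrafilter (Fin n → El B)) where

        private
          e : Fin n → (Fin n → El B) → V
          e k y = point (y k)

        -- The second point is added over the extension by the first, because both have to lie in
        -- one indiscernible sequence. The ultrafilter still lives on tuples of `B`, so over `B`
        -- both have the same germs: compare `eq-c` with `D.value-≡` and `lt-c` with `lt-d`.
        module Twice (d : Fin n → V) (d∈Q : ∀ k → AllIn 𝔐 Q (d k)) (lim-d : IsLimit B U e d) where

          module D = Limit B U e (λ k y → member (y k)) d d∈Q lim-d

          module _ (c : Fin n → V) (c∈Q : ∀ k → AllIn 𝔐 Q (c k)) (lim-c : IsLimit D.limit U e c) where

            module C = Limit D.limit U e (λ k y → sub D.limit-⊒ (member (y k))) c c∈Q lim-c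

            lift-germ : D.Germ → C.Germ
            lift-germ = Sum.map₂ (promote D.limit-⊒)

            value-lift : ∀ v g → value {D.limit} v (lift-germ g) ≡ value {B} v g
            value-lift v (inj₁ k) = refl
            value-lift v (inj₂ x) = refl

            EqGerm LtGerm : (Fin n → V) → Set ℓ
            EqGerm t = ∀ (g h : D.Germ) → ∀ᵁ U (λ y → D.rep g y ≡ D.rep h y) ⇔ (value t g ≡ value t h)
            LtGerm t = ∀ (g h : D.Germ) → T (lt C.limit (value t g) (value t h)) ⇔
                       ∀ᵁ U (λ y → T (lt B (D.rep g y) (D.rep h y)))

            eq-c : EqGerm c
            eq-c g h = mk⇔
              (λ k → subst₂ _≡_ (value-lift c g) (value-lift c h) (fwd (C.value-≡ (lift-germ g) (lift-germ h))
                 (∀ᵁ-map U (λ y → subst₂ _≡_ (sym (value-lift _ g)) (sym (value-lift _ h))) k)))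
              (λ k → ∀ᵁ-map U (λ y → subst₂ _≡_ (value-lift _ g) (value-lift _ h))
                 (bwd (C.value-≡ (lift-germ g) (lift-germ h)) (subst₂ _≡_ (sym (value-lift c g)) (sym (value-lift c h)) k)))

            value∈ : ∀ g → value d g ∈ˢ D.limit
            value∈ g = check (g , refl)

            lt-d : LtGerm d
            lt-d g h = D.lt-germ g h ⇔-∘ ⇔-sym (order C.limit-⊒ (value∈ g) (value∈ h))

            lt-B : ∀ g h y → T (lt D.limit (C.rep (lift-germ g) y) (C.rep (lift-germ h) y)) ⇔
                             T (lt B (D.rep g y) (D.rep h y))
            lt-B g h y = subst₂ (λ x z → T (lt D.limit x z) ⇔ T (lt B (D.rep g y) (D.rep h y)))
              (sym (value-lift _ g)) (sym (value-lift _ h)) (⇔-sym (order D.limit-⊒ (D.rep∈ g y) (D.rep∈ h y)))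

            lt-c : LtGerm c
            lt-c g h = subst₂ (λ x z → T (lt C.limit x z) ⇔ ∀ᵁ U (λ y → T (lt B (D.rep g y) (D.rep h y))))
              (value-lift c g) (value-lift c h)
              (mk⇔ (∀ᵁ-map U (λ y → fwd (lt-B g h y))) (∀ᵁ-map U (λ y → bwd (lt-B g h y)))
               ⇔-∘ C.lt-germ (lift-germ g) (lift-germ h))

            d∈ : ∀ k → d k ∈ˢ C.limit
            d∈ k = sub C.limit-⊒ (value∈ (inj₁ k))

            c∈ : ∀ k → c k ∈ˢ C.limit
            c∈ k = check (inj₁ k , refl)

            split : ∀ {x} → x ∈ˢ C.limit → x ∈ˢ B ⊎ (∃ λ k → d k ≡ x) ⊎ (∃ λ k → c k ≡ x)
            split h with C.limit-new h
            ... | inj₂ k = inj₂ (inj₂ k)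
            ... | inj₁ h′ with D.limit-new h′
            ...   | inj₁ h″ = inj₁ h″
            ...   | inj₂ k = inj₂ (inj₁ k)

            directed : ∀ t → LtGerm t → ∀ δ g h → before δ C.limit (value t g) (value t h) ⇔
                       ∀ᵁ U (λ y → before δ B (D.rep g y) (D.rep h y))
            directed t l true g h = l g h
            directed t l false g h = l h g

            assemble : ∀ β → signed (not β) (φ d) → signed β (φ c) → Twins φ B C.limit
            assemble true φd φc = record
              { U = U ; extend = ⊑-trans D.limit-⊒ C.limit-⊒
              ; tw = λ { true → c ; false → d }
              ; tw∈ = λ { true → c∈ ; false → d∈ }
              ; new = λ h → Sum.map₂ [ (false ,_) , (true ,_) ]′ (split h)
              ; germ-≡ = λ { true → eq-c ; false → D.value-≡ }
              ; germ-< = λ { δ true → directed c lt-c δ ; δ false → directed d lt-d δ }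
              ; sign = λ { true → φc ; false → φd }
              }
            assemble false φd φc = record
              { U = U ; extend = ⊑-trans D.limit-⊒ C.limit-⊒
              ; tw = λ { false → c ; true → d }
              ; tw∈ = λ { false → c∈ ; true → d∈ }
              ; new = λ h → Sum.map₂ [ (true ,_) , (false ,_) ]′ (split h)
              ; germ-≡ = λ { false → eq-c ; true → D.value-≡ }
              ; germ-< = λ { δ false → directed c lt-c δ ; δ true → directed d lt-d δ }
              ; sign = λ { false → φc ; true → φd }
              }

      decides : ∀ {B} {θs : List (OverSeq B n)} β →
                ¬ (∃ λ c → (∀ k → AllIn 𝔐 Q (c k)) × All (c ⊨ᵒ_) θs × signed (not β) (φ c)) → Decides φ θs
      decides true h = inj₁ λ c c∈Q a → dne λ ¬φ → h (c , c∈Q , a , ¬φ)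
      decides false h = inj₂ λ c c∈Q a φc → h (c , c∈Q , a , φc)

      sign-of : ∀ {B} (U : Ultrafilter (Fin n → El B)) → ∃ λ β → ∀ᵁ U (λ y → signed β (φ (point ∘ y)))
      sign-of U with ∀ᵁ-decide U (λ y → φ (point ∘ y))
      ... | inj₁ h = true , h
      ... | inj₂ h = false , h

      -- The twin with the sign opposite to U exists because U avoids the
      -- deciding lists; the other one is approximated within B itself.
      twins : ∀ B → ¬ Handled φ B → Realisable φ B →
              (∀ C → B ⊑ C → FiniteOver B C → Realisable φ C) →
              ∃ (Twins φ B)
      twins B ¬H real real′ with undecided B ¬H
      ... | U , avoid with sign-of U
      ... | β , sgn with real (λ θ → Lift ℓ (∀ᵁ U (λ y → (point ∘ y) ⊨ᵒ θ))) (not β)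
                      (λ θs h → dne λ ¬c → ∀ᵁ-contra U (∀ᵁ-list U (All.map lower h)) (avoid θs (decides β ¬c)))
      ... | d , d∈Q , lim-d , φd = finish
        where
        open Twice U d d∈Q (λ θ h → lim-d θ (lift h))
        finish : ∃ (Twins φ B)
        finish with real′ D.limit D.limit-⊒
                      (List.tabulate d , λ h → Sum.map₂ (λ { (k , refl) → ∈-tabulate⁺ k }) (D.limit-new h))
                      (λ θ → Lift ℓ (∀ᵁ U (λ y → (point ∘ y) ⊨ᵒ θ))) β
                      (λ θs h →
                         let (y , a , s) = ∀ᵁ-witness U (∀ᵁ-zip U
                               {R = λ y → All ((point ∘ y) ⊨ᵒ_) θs × signed β (φ (point ∘ y))}
                               (λ _ → _,_) (∀ᵁ-list U (All.map lower h)) sgn) in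
                         point ∘ y , (λ k → inQ B (member (y k))) , a , s)
        ... | c , c∈Q , lim-c , φc = _ , assemble c c∈Q (λ θ h → lim-c θ (lift h)) β φd φc

  -- The tower of twins: origin of its points and exchange of twins

  module Stages {ℓ} {L : Language ℓ} (𝔐 : Structure L)
                (Q : ∀ {s} → Carrier 𝔐 s → Set ℓ) (σ : Ctx L) where

    open Semantics 𝔐
    open Sequences 𝔐 Q σ
    open Extension 𝔐 Q σ
    open Seq
    open El
    open _⊑_
    open Ultrafilter

    open Twins

    finite-next : ∀ {n φ B C} → Twins {n} φ B C → FiniteOver B C
    finite-next W = List.tabulate (tw W true) ++ List.tabulate (tw W false) , λ h → Sum.map₂
      (λ { (true , k , refl) → ∈-++⁺ˡ (∈-tabulate⁺ k)
         ; (false , k , refl) → ∈-++⁺ʳ (List.tabulate (tw W true)) (∈-tabulate⁺ k) }) (new W h)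

    module TwinTower {n} (φ : (Fin n → V) → Set ℓ) (B : ℕ → Seq)
                 (W : ∀ m → Twins φ (B m) (B (suc m)))
                 (finite : ∀ m → FiniteOver (B 0) (B m)) where

      climb : ∀ {l m} → l ℕ.≤ m → B l ⊑ B m
      climb p = climb′ (ℕ.≤⇒≤′ p)
        where
        climb′ : ∀ {l m} → l ℕ.≤′ m → B l ⊑ B m
        climb′ ℕ.≤′-refl = ⊑-refl
        climb′ (ℕ.≤′-step p) = ⊑-trans (climb′ p) (extend (W _))

      -- A twin that is a principal limit is an old point; a point is attributed only to the stage
      -- at which it first occurs.
      NewAt : ℕ → V → Set ℓ
      NewAt j x = (¬ x ∈ˢ B j) × ∃ λ β → ∃ λ k → tw (W j) β k ≡ x

      newAt-suc : ∀ {j x} → NewAt j x → x ∈ˢ B (suc j)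
      newAt-suc {j} (_ , β , k , refl) = tw∈ (W j) β k

      origin : ∀ m {x} → x ∈ˢ B m → x ∈ˢ B 0 ⊎ ∃ λ j → j ℕ.< m × NewAt j x
      origin zero h = inj₁ h
      origin (suc m) {x} h with em {P = x ∈ˢ B m} | new (W m) h
      ... | yes h′ | _ = Sum.map₂ (map₂ (λ (l , k) → ℕ.m≤n⇒m≤1+n l , k)) (origin m h′)
      ... | no ¬h′ | inj₁ h′ = contradiction h′ ¬h′
      ... | no ¬h′ | inj₂ k = inj₂ (m , ℕ.≤-refl , ¬h′ , k)

      Principal : ℕ → Fin n → Set ℓ
      Principal m k = Lift ℓ (∀ᵁ (U (W m)) λ y → point (y k) ∈ˢ B 0) ⊎
        ∃ λ x → ∀ᵁ (U (W m)) (λ y → point (y k) ≡ x) × x ∈ˢ B m × ∃ λ j → j ℕ.< m × NewAt j x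

      -- Only finitely many points of `B m` lie outside `B 0`, so an ultrafilter that does not
      -- concentrate on `B 0` concentrates on one of them, and `origin` tells where that point was
      -- new.
      principal : ∀ m k → Principal m k
      principal m k with ∀ᵁ-decide (U (W m)) (λ y → point (y k) ∈ˢ B 0)
      ... | inj₁ h = inj₁ (lift h)
      ... | inj₂ h = inj₂ (locate-new (proj₁ (finite m))
              (∀ᵁ-map (U (W m)) (λ y ¬h → [ (λ h → contradiction h ¬h) , id ]′ (proj₂ (finite m) (member (y k)))) h))
        where
        locate-new : ∀ xs → ∀ᵁ (U (W m)) (λ y → point (y k) ∈ xs) →
          ∃ λ x → ∀ᵁ (U (W m)) (λ y → point (y k) ≡ x) × x ∈ˢ B m × ∃ λ j → j ℕ.< m × NewAt j x
        locate-new [] h′ with () ← proj₂ (∀ᵁ-witness (U (W m)) h′)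
        locate-new (x ∷ xs) h′ with ∀ᵁ-decide (U (W m)) (λ y → point (y k) ≡ x)
        ... | inj₂ ≢x = locate-new xs (∀ᵁ-zip (U (W m))
                (λ { y (here e) ¬e → contradiction e ¬e ; y (there i) _ → i }) h′ ≢x)
        ... | inj₁ ≡x with ∀ᵁ-witness (U (W m)) (∀ᵁ-zip (U (W m))
                {R = λ y → point (y k) ≡ x × ¬ (point (y k) ∈ˢ B 0)} (λ y → _,_) ≡x h)
        ...   | y , refl , ¬h with origin m (member (y k))
        ...     | inj₁ h₀ = contradiction h₀ ¬h
        ...     | inj₂ o = x , ≡x , member (y k) , o

      -- The stage whose new point is the limit of the k-th coordinate at stage
      -- m; the junk value m stands for a limit concentrated on B 0.
      ref : ℕ → Fin n → ℕ
      ref m k with principal m k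
      ... | inj₁ _ = m
      ... | inj₂ (_ , _ , _ , j , _) = j

      Inseparable : ℕ → V → ℕ → Set
      Inseparable l x m = ∀ δ k β β′ → before δ (B m) (tw (W l) β k) x → before δ (B m) (tw (W l) β′ k) x

      -- The comparison with a point of `B l` is fixed by the ultrafilter of stage `l`, which both
      -- twins share; later extensions preserve the order.
      inseparable-old : ∀ {l m x} → l ℕ.< m → x ∈ˢ B l → Inseparable l x m
      inseparable-old {l} {m} {x} l<m x∈ δ k β β′ h =
        fwd (before-⊑ δ (climb l<m) (tw∈ (W l) β′ k) x∈′)
          (bwd (germ-< (W l) δ β′ (inj₁ k) (inj₂ (x , x∈)))
            (fwd (germ-< (W l) δ β (inj₁ k) (inj₂ (x , x∈)))
              (bwd (before-⊑ δ (climb l<m) (tw∈ (W l) β k) x∈′) h)))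
        where
        x∈′ : x ∈ˢ B (suc l)
        x∈′ = sub (extend (W l)) x∈

      -- A point that is new at stage `j` is not the limit of an ultrafilter principal at an element
      -- of `B j`, so its coordinate concentrates on `B 0`. Comparison with it reduces to comparison
      -- with points of `B 0`, which are old for stage `l`.
      inseparable-later : ∀ {l j m x} → l ℕ.< j → j ℕ.< m → NewAt j x → Inseparable l x m
      inseparable-later {l} {j} {m} l<j j<m (x∉ , γ , i , refl) δ k β β′ h =
        fwd (before-⊑ δ (climb j<m) (tw∈′ β′) (tw∈ (W j) γ i))
          (bwd (germ-< (W j) δ γ (inj₂ (tw (W l) β′ k , tw∈ᴮ β′)) (inj₁ i))
            (∀ᵁ-zip (U (W j)) (λ y y∈ → inseparable-old l<j (sub (climb ℕ.z≤n) y∈) δ k β β′) nonprincipal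
              (fwd (germ-< (W j) δ γ (inj₂ (tw (W l) β k , tw∈ᴮ β)) (inj₁ i))
                (bwd (before-⊑ δ (climb j<m) (tw∈′ β) (tw∈ (W j) γ i)) h))))
        where
        tw∈ᴮ : ∀ β → tw (W l) β k ∈ˢ B j
        tw∈ᴮ β = sub (climb l<j) (tw∈ (W l) β k)

        tw∈′ : ∀ β → tw (W l) β k ∈ˢ B (suc j)
        tw∈′ β = sub (extend (W j)) (tw∈ᴮ β)

        nonprincipal : ∀ᵁ (U (W j)) (λ y → point (y i) ∈ˢ B 0)
        nonprincipal with principal j i
        ... | inj₁ (lift h) = h
        ... | inj₂ (z , ≡z , z∈ , _) = ⊥-elim (x∉ (subst (_∈ˢ B j)
                (sym (fwd (germ-≡ (W j) γ (inj₁ i) (inj₂ (z , z∈))) ≡z)) z∈))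

      inseparable : ∀ {l j m x} → l ℕ.< m → j ℕ.< m → j ≢ l → NewAt j x → Inseparable l x m
      inseparable {l} {j} l<m j<m j≢l new with ℕ.<-cmp l j
      ... | tri< l<j _ _ = inseparable-later l<j j<m new
      ... | tri≈ _ l≡j _ = contradiction (sym l≡j) j≢l
      ... | tri> _ _ j<l = inseparable-old l<m (sub (climb j<l) (newAt-suc new))

      -- The comparison is decided at stage `m` by approximating the later twin in `B m`. Almost all
      -- approximations lie in `B 0`, or almost all equal one point that is new at a stage other
      -- than `l`; neither kind separates the twins of stage `l`.
      twins-exchange : ∀ {l m M} → l ℕ.< m → m ℕ.< M → (∀ k → ref m k ≢ l) →
        ∀ δ k k′ β β′ γ γ′ → before δ (B M) (tw (W l) β k) (tw (W m) γ k′) →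
        before δ (B M) (tw (W l) β′ k) (tw (W m) γ′ k′)
      twins-exchange {l} {m} {M} l<m m<M free δ k k′ β β′ γ γ′ h =
        fwd (before-⊑ δ (climb m<M) (tw∈′ β′) (tw∈ (W m) γ′ k′))
          (bwd (germ-< (W m) δ γ′ (inj₂ (tw (W l) β′ k , tw∈ᴮ β′)) (inj₁ k′))
            (exchange (fwd (germ-< (W m) δ γ (inj₂ (tw (W l) β k , tw∈ᴮ β)) (inj₁ k′))
              (bwd (before-⊑ δ (climb m<M) (tw∈′ β) (tw∈ (W m) γ k′)) h))))
        where
        tw∈ᴮ : ∀ β → tw (W l) β k ∈ˢ B m
        tw∈ᴮ β = sub (climb l<m) (tw∈ (W l) β k)

        tw∈′ : ∀ β → tw (W l) β k ∈ˢ B (suc m)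
        tw∈′ β = sub (extend (W m)) (tw∈ᴮ β)

        exchange : ∀ᵁ (U (W m)) (λ y → before δ (B m) (tw (W l) β k) (point (y k′))) →
                   ∀ᵁ (U (W m)) (λ y → before δ (B m) (tw (W l) β′ k) (point (y k′)))
        exchange with principal m k′ | free k′
        ... | inj₁ (lift h) | _ = ∀ᵁ-zip (U (W m))
                (λ y y∈ → inseparable-old l<m (sub (climb ℕ.z≤n) y∈) δ k β β′) h
        ... | inj₂ (x , ≡x , _ , j , j<m , new) | j≢l = ∀ᵁ-zip (U (W m))
                (λ { y refl → inseparable l<m j<m j≢l new δ k β β′ }) ≡x

  -- From the tower to the independence property

  module Shattering {ℓ} {L : Language ℓ} (𝔐 : Structure L)
                    (Q : ∀ {s} → Carrier 𝔐 s → Set ℓ) (σ : Ctx L) where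

    open Semantics 𝔐
    open Sequences 𝔐 Q σ
    open Extension 𝔐 Q σ
    open Stages 𝔐 Q σ
    open Seq
    open _⊑_
    open Twins

    module _ n {Δ} (φ : Formula L (_^_ {L = L} σ n ++ Δ)) where

      instanceOf : Tuple 𝔐 Δ → (Fin n → V) → Set ℓ
      instanceOf b c = ++⁺ (join 𝔐 n c) b ⊩ φ

      signedᶠ : ∀ {Γ} → Bool → Formula L Γ → Formula L Γ
      signedᶠ true ψ = ψ
      signedᶠ false ψ = ~ ψ

      ⊩-signed : ∀ β {Γ} (ψ : Formula L Γ) (v : Tuple 𝔐 Γ) → (v ⊩ signedᶠ β ψ) ⇔ signed β (v ⊩ ψ)
      ⊩-signed true ψ v = ⇔-id _
      ⊩-signed false ψ v = ⊩-¬ ψ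

      module _ {K : ℕ} where

        Side : ∀ {s} → s ∈ _^_ {L = L} σ n ++ Δ → Set ℓ
        Side {s} x = (∃ λ (y : s ∈ _^_ {L = L} σ n) → ∈-++⁺ˡ y ≡ x) ⊎
                     (∃ λ (y : s ∈ Δ) → ∈-++⁺ʳ (_^_ {L = L} σ n) y ≡ x)

        move : Fin K → ∀ {s} {x : s ∈ _^_ {L = L} σ n ++ Δ} → Side x → s ∈ Δ ++ _^_ {L = L} σ (K * n)
        move i (inj₁ (y , _)) = ∈-++⁺ʳ Δ (relabel (Fin.combine i) y)
        move i (inj₂ (y , _)) = ∈-++⁺ˡ y

        -- The shared parameters come first because `∃*` binds a prefix of the context; the
        -- variables of the `i`-th copy go to the `i`-th group of `n` blocks.
        row : Fin K → Renaming {L = L} (_^_ {L = L} σ n ++ Δ) (Δ ++ _^_ {L = L} σ (K * n))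
        row i x = move i (split-++ {L = L} (_^_ {L = L} σ n) x)

        agree-row : ∀ i (t : Fin (K * n) → V) d →
                    Agree (row i) (++⁺ (join 𝔐 n (t ∘ Fin.combine i)) d) (++⁺ d (join 𝔐 (K * n) t))
        agree-row i t d x = agree-move (split-++ {L = L} (_^_ {L = L} σ n) x)
          where
          agree-move : ∀ {s} {x : s ∈ _^_ {L = L} σ n ++ Δ} (c : Side x) →
                       All.lookup (++⁺ (join 𝔐 n (t ∘ Fin.combine i)) d) x ≡
                       All.lookup (++⁺ d (join 𝔐 (K * n) t)) (move i c)
          agree-move (inj₁ (y , refl)) = trans (lookup-++ˡ {L = L} (join 𝔐 n (t ∘ Fin.combine i)) d y)
            (trans (agree-relabel (Fin.combine i) t y)
                   (sym (lookup-++ʳ {L = L} d (join 𝔐 (K * n) t) (relabel (Fin.combine i) y))))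
          agree-move (inj₂ (y , refl)) = trans (lookup-++ʳ {L = L} (join 𝔐 n (t ∘ Fin.combine i)) d y)
            (sym (lookup-++ˡ {L = L} d (join 𝔐 (K * n) t) y))

        pattern-formula : (Fin K → Bool) → Fm (K * n)
        pattern-formula S = ∃* Δ (⋀ K λ i → signedᶠ (S i) (rename (row i) φ))

        ⊩-pattern : ∀ S t → (t ⊩* pattern-formula S) ⇔
                    (∃ λ d → ∀ i → signed (S i) (instanceOf d (t ∘ Fin.combine i)))
        ⊩-pattern S t = mk⇔
          (λ h → let (d , k) = fwd (⊩-∃* Δ conj) h in d , λ i → fwd (signed-map i d)
                   (fwd (⊩-signed (S i) (rename (row i) φ) _) (fwd (⊩-⋀ K conjunct) k i)))
          (λ (d , k) → bwd (⊩-∃* Δ conj) (d , bwd (⊩-⋀ K conjunct) λ i →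
                   bwd (⊩-signed (S i) (rename (row i) φ) _) (bwd (signed-map i d) (k i))))
          where
          conjunct : Fin K → Formula L (Δ ++ _^_ {L = L} σ (K * n))
          conjunct i = signedᶠ (S i) (rename (row i) φ)

          conj = ⋀ K conjunct

          signed-cong : ∀ β {X Y : Set ℓ} → X ⇔ Y → signed β X ⇔ signed β Y
          signed-cong true e = e
          signed-cong false e = mk⇔ (_∘ bwd e) (_∘ fwd e)

          signed-map : ∀ i d → signed (S i) (++⁺ d (join 𝔐 (K * n) t) ⊩ rename (row i) φ) ⇔
                       signed (S i) (instanceOf d (t ∘ Fin.combine i))
          signed-map i d = signed-cong (S i) (⊩-rename (agree-row i t d) φ)

      module _ (b : Tuple 𝔐 Δ) (B : ℕ → Seq)
               (W : ∀ m → Twins (instanceOf b) (B m) (B (suc m)))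
               (finite : ∀ m → FiniteOver (B 0) (B m)) where

        open TwinTower (instanceOf b) B W finite

        bound : ∀ K (s : Fin K → ℕ) → ∃ λ M → ∀ i → s i ℕ.< M
        bound zero s = 0 , λ ()
        bound (suc K) s = let (M , h) = bound K (s ∘ Fin.suc) in suc (s Fin.zero ℕ.⊔ M) ,
          λ { Fin.zero → ℕ.s≤s (ℕ.m≤m⊔n _ M)
            ; (Fin.suc i) → ℕ.≤-trans (h i) (ℕ.≤-trans (ℕ.m≤n⊔m (s Fin.zero) M) (ℕ.n≤1+n _)) }

        module _ (K : ℕ) where

          s : Fin K → ℕ
          s = proj₁ (independent n ref K)

          free : ∀ {i j} → i Fin.< j → s j ℕ.< s i × (∀ k → ref (s i) k ≢ s j)
          free = proj₂ (independent n ref K)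

          M : ℕ
          M = proj₁ (bound K s)

          s<M : ∀ i → s i ℕ.< M
          s<M = proj₂ (bound K s)

          point-at : (Fin K → Bool) → Fin K → Fin n → V
          point-at S i k = tw (W (s i)) (S i) k

          points : (Fin K → Bool) → Fin (K * n) → V
          points S x = let (i , k) = Fin.remQuot n x in point-at S i k

          points∈ : ∀ S x → points S x ∈ˢ B M
          points∈ S x = sub (climb (s<M _)) (tw∈ (W _) _ _)

          same-order : ∀ S S′ i k j k′ → T (lt (B M) (point-at S i k) (point-at S j k′)) →
                       T (lt (B M) (point-at S′ i k) (point-at S′ j k′))
          same-order S S′ i k j k′ h with Fin.<-cmp i j
          -- The chosen stages decrease with the index, so for `i < j` the earlier twin is the
          -- second argument; hence the direction `false`.
          ... | tri< i<j _ _ = twins-exchange (proj₁ (free i<j)) (s<M i) (proj₂ (free i<j)) false k′ k _ _ _ _ h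
          ... | tri> _ _ j<i = twins-exchange (proj₁ (free j<i)) (s<M j) (proj₂ (free j<i)) true k k′ _ _ _ _ h
          -- Within one stage both entries are coordinates of the same twin, and their order is read
          -- off the ultrafilter common to both twins.
          ... | tri≈ _ refl _ =
            fwd (order (climb (s<M i)) (tw∈ (W (s i)) (S′ i) k) (tw∈ (W (s i)) (S′ i) k′))
              (bwd (germ-< (W (s i)) true (S′ i) (inj₁ k) (inj₁ k′))
                (fwd (germ-< (W (s i)) true (S i) (inj₁ k) (inj₁ k′))
                  (bwd (order (climb (s<M i)) (tw∈ (W (s i)) (S i) k) (tw∈ (W (s i)) (S i) k′)) h)))

          points-combine : ∀ S i k → points S (Fin.combine i k) ≡ point-at S i k
          points-combine S i k = cong (λ (i , k) → point-at S i k) (Fin.remQuot-combine {n = K} i k)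

          -- For twins chosen according to `S` the single tuple `b` realises the pattern `S`.
          -- Passing to the `true` twins keeps the order type, so indiscernibility gives a parameter
          -- `d` for `S` on tuples that no longer depend on `S`.
          shatter : ∀ S → ∃ λ d → ∀ i → signed (S i) (instanceOf d (point-at (const true) i))
          shatter S =
            let (d , h) = fwd (⊩-pattern S (points (const true)))
                  (indisc (B M) (pattern-formula S) (points S) (points (const true)) (points∈ S) (points∈ (const true))
                    (λ x y → mk⇔ (same-order S (const true) _ _ _ _) (same-order (const true) S _ _ _ _))
                    (bwd (⊩-pattern S (points S)) (b , λ i → subst (λ t → signed (S i) (++⁺ t b ⊩ φ))
                      (sym (join-cong n (points-combine S i))) (sign (W (s i)) (S i)))))
            in d , λ i → subst (λ t → signed (S i) (++⁺ t d ⊩ φ)) (join-cong n (points-combine (const true) i)) (h i)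

        hasIP : HasIP 𝔐 (_^_ {L = L} σ n) Δ φ
        hasIP K = (λ i → join 𝔐 n (point-at K (const true) i)) , (λ S → proj₁ (shatter K (lookup S))) ,
          λ i S → member⇔ (lookup S i) (λ e → lookup⇒[]= i S e) (λ h → []=⇒lookup h) (proj₂ (shatter K (lookup S)) i)
          where
          member⇔ : ∀ {X : Set ℓ} {Y : Set} β → (β ≡ true → Y) → (Y → β ≡ true) → signed β X → X ⇔ Y
          member⇔ true f g x = mk⇔ (λ _ → f refl) (λ _ → x)
          member⇔ false f g ¬x = mk⇔ (λ x → contradiction x ¬x) (λ y → contradiction (g y) λ ())

  -- Handling one instance by finitely many new points

  dependent-choice : ∀ {a r} {S : Set a} {R : S → S → Set r} (s₀ : S) → (∀ s → ∃ (R s)) →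
                     ∃ λ (f : ℕ → S) → f 0 ≡ s₀ × ∀ m → R (f m) (f (suc m))
  dependent-choice {S = S} {R} s₀ step = f , refl , λ m → proj₂ (step (f m))
    where
    f : ℕ → S
    f zero = s₀
    f (suc m) = proj₁ (step (f m))

  module Handling {ℓ} {L : Language ℓ} (𝔐 : Structure L)
                  (Q : ∀ {s} → Carrier 𝔐 s → Set ℓ) (σ : Ctx L) where

    open Semantics 𝔐
    open Sequences 𝔐 Q σ
    open Extension 𝔐 Q σ
    open Stages 𝔐 Q σ
    open Shattering 𝔐 Q σ
    open Twins

    module _ n {Δ} (φ : Formula L (_^_ {L = L} σ n ++ Δ)) (b : Tuple 𝔐 Δ) (B₀ : Seq)
             (real : ∀ B → B₀ ⊑ B → FiniteOver B₀ B → Realisable (instanceOf n φ b) B) where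

      record Stage : Set ℓ where
        field
          seq    : Seq
          above  : B₀ ⊑ seq
          finite : FiniteOver B₀ seq

      open Stage

      Next : Stage → Stage → Set ℓ
      Next S S′ = Twins (instanceOf n φ b) (seq S) (seq S′)

      next : (∀ B → B₀ ⊑ B → FiniteOver B₀ B → ¬ Handled (instanceOf n φ b) B) → ∀ S → ∃ (Next S)
      next unhandled S =
        let (C , W) = twins (instanceOf n φ b) (seq S) (unhandled _ (above S) (finite S)) (real _ (above S) (finite S))
                        (λ C p f → real C (⊑-trans (above S) p) (finite-trans {B₀} {seq S} {C} (finite S) f))
        in record { seq = C ; above = ⊑-trans (above S) (extend W)
                  ; finite = finite-trans {B₀} {seq S} {C} (finite S) (finite-next W) } , W

      initial : Stage
      initial = record { seq = B₀ ; above = ⊑-refl ; finite = [] , inj₁ }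

      tower-hasIP : (f : ℕ → Stage) → f 0 ≡ initial → (∀ m → Next (f m) (f (suc m))) →
                    HasIP 𝔐 (_^_ {L = L} σ n) Δ φ
      tower-hasIP f e W = hasIP n φ b (seq ∘ f) W λ m →
        subst (λ S → FiniteOver (seq S) (seq (f m))) (sym e) (finite (f m))

      -- If no finite coheir extension handled the instance, twins could be added at every stage,
      -- and the resulting tower would shatter sets of every finite size.
      handle : ¬ HasIP 𝔐 (_^_ {L = L} σ n) Δ φ →
               ∃ λ B → B₀ ⊑ B × FiniteOver B₀ B × Handled (instanceOf n φ b) B
      handle ¬ip = dne λ ¬h →
        let (f , e , W) = dependent-choice initial (next λ B p fin H → ¬h (B , p , fin , H))
        in ¬ip (tower-hasIP f e W)

  -- Saturation of the pair

  module Encoding {ℓ} {L : Language ℓ} (𝔐 : Structure L)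
                  (Q : ∀ {s} → Carrier 𝔐 s → Set ℓ) (σ : Ctx L) where

    open Semantics 𝔐
    open Sequences 𝔐 Q σ
    open El
    open _⊨ᵒ_

    Coordinate : Seq → Sort L → Set ℓ
    Coordinate B s = El B × (s ∈ σ)

    coordinate : ∀ {B s} → Coordinate B s → Carrier 𝔐 s
    coordinate (x , i) = All.lookup (point x) i

    -- A parameter block that only stands for a variable gets the junk value x₀.
    module _ {B} (x₀ : El B) {n : ℕ} where

      module _ {m} (g : Fin m → Fin n ⊎ El B) where

        parameter : Fin n ⊎ El B → El B
        parameter = [ const x₀ , id ]′

        parameter-at : ∀ {s} → s ∈ _^_ {L = L} σ m → Coordinate B s
        parameter-at x = let (k , y , _) = locate m x in parameter (g k) , y

        parameters : All (Coordinate B) (_^_ {L = L} σ m)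
        parameters = All.tabulate parameter-at

        destination : ∀ {s} → Fin n ⊎ El B → s ∈ σ → s ∈ _^_ {L = L} σ m → s ∈ _^_ {L = L} σ n ++ _^_ {L = L} σ m
        destination (inj₁ i) y x = ∈-++⁺ˡ (block n i y)
        destination (inj₂ _) y x = ∈-++⁺ʳ (_^_ {L = L} σ n) x

        redirect : Renaming {L = L} (_^_ {L = L} σ m) (_^_ {L = L} σ n ++ _^_ {L = L} σ m)
        redirect x = let (k , y , _) = locate m x in destination (g k) y x

        agree-redirect : ∀ (c : Fin n → V) → Agree redirect (join 𝔐 m (value c ∘ g))
                           (++⁺ (join 𝔐 n c) (All.map (coordinate {B}) parameters))
        agree-redirect c {s} x = trans
          (trans (cong (All.lookup (join 𝔐 m (value c ∘ g))) (sym (proj₂ (proj₂ (locate m x)))))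
                 (lookup-join m (value c ∘ g) _ _))
          (case (g (proj₁ (locate m x))) refl)
          where
          y = proj₁ (proj₂ (locate m x))

          parameter-value : All.lookup (All.map (coordinate {B}) parameters) x ≡
                            All.lookup (point (parameter (g (proj₁ (locate m x))))) y
          parameter-value = trans (lookup-map {L = L} (coordinate {B}) parameters x)
                                  (cong (coordinate {B}) (lookup-tabulate {L = L} {P = Coordinate B} parameter-at x))

          case : ∀ a → g (proj₁ (locate m x)) ≡ a → All.lookup (value c a) y ≡
                 All.lookup (++⁺ (join 𝔐 n c) (All.map (coordinate {B}) parameters)) (destination a y x)
          case (inj₁ i) _ = sym (trans (lookup-++ˡ {L = L} (join 𝔐 n c) _ (block n i y)) (lookup-join n c i y))
          case (inj₂ z) e = sym (trans (lookup-++ʳ {L = L} (join 𝔐 n c) _ x)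
            (trans parameter-value (cong (λ a → All.lookup (point (parameter a)) y) e)))

      encode : OverSeq B n → FormulaOver {L = L} (Coordinate B) (σ ^ n)
      encode (over θ g) = rename (redirect g) θ at parameters g

      Sat-encode : ∀ θ c → Sat 𝔐 {B = Coordinate B} coordinate (join 𝔐 n c) (encode θ) ⇔ (c ⊨ᵒ θ)
      Sat-encode (over θ g) c = mk⇔ sat unsat ⇔-∘ ⊩-rename (agree-redirect g c) θ

  module Saturation {ℓ} {L : Language ℓ} (𝔐 : Structure L)
                    (Q : ∀ {s} → Carrier 𝔐 s → Set ℓ) (σ : Ctx L)
                    {κ : Set ℓ} (saturated : Saturated (_⋖ κ) (expand 𝔐 Q)) where

    open Semantics 𝔐
    open Sequences 𝔐 Q σ
    open Extension 𝔐 Q σ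
    open Shattering 𝔐 Q σ
    open Encoding 𝔐 Q σ

    module _ {C : Sort L → Set ℓ} (val : ∀ {s} → C s → Carrier 𝔐 s)
             {Z : Set ℓ} (ι : ℕ ↣ Z) (pr : (Z × Z) ↣ Z) (Z⋖κ : Z ⋖ κ) (C↣Z : Σ (Sort L) C ↣ Z)
             {B : Seq} (x₀ : El B) (B↣Z : El B ↣ Z) where

      open Absorb ι pr

      Name : Sort L → Set ℓ
      Name s = Coordinate B s ⊎ C s

      valuation : ∀ {s} → Name s → Carrier 𝔐 s
      valuation = [ coordinate , val ]′

      -- A coordinate is counted by a point and a position in `σ`. The position determines the sort,
      -- so the sorts are not counted separately.
      Name-small : Σ (Sort L) Name ⋖ κ
      Name-small = ⋖-absorbs (mk↣ {to = code} code-injective) (⋖-absorbs (⊎-absorb (×-absorb B↣Z ι) C↣Z) Z⋖κ)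
        where
        code : Σ (Sort L) Name → (El B × ℕ) ⊎ Σ (Sort L) C
        code (s , inj₁ (x , i)) = inj₁ (x , position i)
        code (s , inj₂ c) = inj₂ (s , c)

        code-injective : ∀ {u v} → code u ≡ code v → u ≡ v
        code-injective {s , inj₁ (x , i)} {s′ , inj₁ (y , j)} e
          with position-injective {i = i} {j} (cong proj₂ (injective inj₁-↣ e)) | cong proj₁ (injective inj₁-↣ e)
        ... | refl | refl = refl
        code-injective {s , inj₂ c} {s′ , inj₂ c′} refl = refl

      module _ {n Δ} (φ : Formula L (_^_ {L = L} σ n ++ Δ)) (b : All C Δ)
               (p : OverSeq B n → Set ℓ) (β : Bool) where

        private
          Γ = _^_ {L = L} σ n

          satᴾ : Tuple 𝔐 Γ → FormulaOver {L = L ∪P} Name Γ → Set ℓ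
          satᴾ = Sat (expand 𝔐 Q) {B = Name} valuation

        over-names : ∀ {D : Sort L → Set ℓ} → (∀ {s} → D s → Name s) →
                     FormulaOver {L = L} D Γ → FormulaOver {L = L ∪P} Name Γ
        over-names f (ψ at d) = embed ψ at All.map f d

        sat-over-names : ∀ {D : Sort L → Set ℓ} (f : ∀ {s} → D s → Name s) (ψ : FormulaOver {L = L} D Γ) v →
                         satᴾ v (over-names f ψ) ⇔ Sat 𝔐 {B = D} (λ d → valuation (f d)) v ψ
        sat-over-names f (ψ at d) v =
          ≡⇒⇔ (cong (λ w → 𝔐 ⊨ ψ [ ++⁺ v w ]) (map-map d)) ⇔-∘
          ⊨-embed 𝔐 Q ψ (++⁺ v (All.map valuation (All.map f d)))
          where
          map-map : ∀ {Δ} (d : All _ Δ) → All.map valuation (All.map f d) ≡ All.map (λ d → valuation (f d)) d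
          map-map [] = refl
          map-map (x ∷ d) = cong (_ ∷_) (map-map d)

        inPᶠ : ∀ {s} → s ∈ Γ → FormulaOver {L = L ∪P} Name Γ
        inPᶠ {s} x = rel (RelP.P s) (var (∈-++⁺ˡ x) ∷ []) at []

        sat-inP : ∀ {s} (x : s ∈ Γ) v → satᴾ v (inPᶠ x) ⇔ Q (All.lookup v x)
        sat-inP x v = ≡⇒⇔ (cong Q (lookup-++ˡ {L = L} v [] x))

        signed-instance : FormulaOver {L = L ∪P} Name Γ
        signed-instance = over-names inj₂ (signedᶠ n φ β φ at b)

        -- Membership in P is part of the type, so saturation of the pair places the realisation in
        -- P.
        Type : FormulaOver {L = L ∪P} Name Γ → Set ℓ
        Type ψ = (∃ λ θ → p θ × over-names inj₁ (encode x₀ θ) ≡ ψ) ⊎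
                 (∃ λ s → ∃ λ (x : s ∈ Γ) → inPᶠ x ≡ ψ) ⊎ signed-instance ≡ ψ

        Solution : List (OverSeq B n) → (Fin n → V) → Set ℓ
        Solution θs c = (∀ k → AllIn 𝔐 Q (c k)) × All (c ⊨ᵒ_) θs × signed β (instanceOf n φ (All.map val b) c)

        sat-θ : ∀ θ c → satᴾ (join 𝔐 n c) (over-names inj₁ (encode x₀ θ)) ⇔ (c ⊨ᵒ θ)
        sat-θ θ c = Sat-encode x₀ θ c ⇔-∘ sat-over-names inj₁ (encode x₀ θ) (join 𝔐 n c)

        sat-sign : ∀ c → satᴾ (join 𝔐 n c) signed-instance ⇔ signed β (instanceOf n φ (All.map val b) c)
        sat-sign c = ⊩-signed n φ β φ (++⁺ (join 𝔐 n c) (All.map val b)) ⇔-∘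
                     sat-over-names inj₂ (signedᶠ n φ β φ at b) (join 𝔐 n c)

        finite-part : ∀ ψs → All Type ψs → ∃ λ θs → All p θs ×
                      (∀ c → Solution θs c → All (satᴾ (join 𝔐 n c)) ψs)
        finite-part [] [] = [] , [] , λ _ _ → []
        finite-part (ψ ∷ ψs) (h ∷ hs) with h | finite-part ψs hs
        ... | inj₁ (θ , pθ , refl) | θs , pθs , f = θ ∷ θs , pθ ∷ pθs ,
                λ { c (q , t ∷ ts , s) → bwd (sat-θ θ c) t ∷ f c (q , ts , s) }
        ... | inj₂ (inj₁ (s , x , refl)) | θs , pθs , f = θs , pθs ,
                λ { c (q , ts , s) → bwd (sat-inP x (join 𝔐 n c)) (inQ-join c q x) ∷ f c (q , ts , s) }
          where
          inQ-join : ∀ c → (∀ k → AllIn 𝔐 Q (c k)) → ∀ {s} (x : s ∈ Γ) → Q (All.lookup (join 𝔐 n c) x)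
          inQ-join c q x with locate n x
          ... | k , y , refl = subst Q (sym (lookup-join n c k y)) (q k y)
        ... | inj₂ (inj₂ refl) | θs , pθs , f = θs , pθs ,
                λ { c (q , ts , s) → bwd (sat-sign c) s ∷ f c (q , ts , s) }

        realise : (∀ θs → All p θs → ∃ (Solution θs)) →
                  ∃ λ c → (∀ k → AllIn 𝔐 Q (c k)) × (∀ θ → p θ → c ⊨ᵒ θ) ×
                          signed β (instanceOf n φ (All.map val b) c)
        realise h =
          let (v , r) = saturated Name Name-small valuation Type λ ψs hs →
                let (θs , pθs , f) = finite-part ψs hs ; (c , s) = h θs pθs in join 𝔐 n c , f c s
              c = component n v
              r′ = λ ψ t → subst (λ v → satᴾ v ψ) (sym (join-component n v)) (r ψ t)
          in c , (λ k {s} x → subst Q (lookup-join n c k x) (fwd (sat-inP (block n k x) (join 𝔐 n c))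
                   (r′ _ (inj₂ (inj₁ (s , block n k x , refl))))))
               , (λ θ pθ → fwd (sat-θ θ c) (r′ _ (inj₁ (θ , pθ , refl))))
               , fwd (sat-sign c) (r′ _ (inj₂ (inj₂ refl)))

      realisable : ∀ {n Δ} (φ : Formula L (_^_ {L = L} σ n ++ Δ)) (b : All C Δ) →
                   Realisable (instanceOf n φ (All.map val b)) B
      realisable φ b p β = realise φ b p β

  -- Sorting finite tuples of indices

  module _ {a r} {I : Set a} {_<_ : I → I → Set r} (order : IsStrictTotalOrder _≡_ _<_) where

    private module O = IsStrictTotalOrder order

    module _ {m} (i : Fin m → I) where

      Sorted : List (Fin m) → Set r
      Sorted = AllPairs (λ a b → i a < i b)

      insert : Fin m → List (Fin m) → List (Fin m)
      insert a [] = a ∷ []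
      insert a (x ∷ xs) with O.compare (i a) (i x)
      ... | tri< _ _ _ = a ∷ x ∷ xs
      ... | tri≈ _ _ _ = x ∷ xs
      ... | tri> _ _ _ = x ∷ insert a xs

      insert-above : ∀ {y} a xs → i y < i a → All (λ b → i y < i b) xs → All (λ b → i y < i b) (insert a xs)
      insert-above a [] p [] = p ∷ []
      insert-above a (x ∷ xs) p (q ∷ qs) with O.compare (i a) (i x)
      ... | tri< _ _ _ = p ∷ q ∷ qs
      ... | tri≈ _ _ _ = q ∷ qs
      ... | tri> _ _ _ = q ∷ insert-above a xs p qs

      insert-sorted : ∀ a {xs} → Sorted xs → Sorted (insert a xs)
      insert-sorted a [] = [] ∷ []
      insert-sorted a {x ∷ xs} (x< ∷ s) with O.compare (i a) (i x)
      ... | tri< l _ _ = (l ∷ All.map (O.trans l) x<) ∷ x< ∷ s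
      ... | tri≈ _ _ _ = x< ∷ s
      ... | tri> _ _ g = insert-above a xs g x< ∷ insert-sorted a s

      Covers : List (Fin m) → Fin m → Set a
      Covers xs k = Any (λ b → i b ≡ i k) xs

      insert-covers : ∀ a xs → Covers (insert a xs) a
      insert-covers a [] = here refl
      insert-covers a (x ∷ xs) with O.compare (i a) (i x)
      ... | tri< _ _ _ = here refl
      ... | tri≈ _ e _ = here (sym e)
      ... | tri> _ _ _ = there (insert-covers a xs)

      insert-keeps : ∀ a {xs k} → Covers xs k → Covers (insert a xs) k
      insert-keeps a {x ∷ xs} c with O.compare (i a) (i x)
      ... | tri< _ _ _ = there c
      ... | tri≈ _ _ _ = c
      insert-keeps a {x ∷ xs} (here e) | tri> _ _ _ = here e
      insert-keeps a {x ∷ xs} (there c) | tri> _ _ _ = there (insert-keeps a c)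

      sort : ∀ (ks : List (Fin m)) → ∃ λ xs → Sorted xs × (∀ {k} → k ∈ ks → Covers xs k)
      sort [] = [] , [] , λ ()
      sort (k ∷ ks) = let (xs , s , c) = sort ks in insert k xs , insert-sorted k s ,
        λ { (here refl) → insert-covers k xs ; (there l) → insert-keeps k (c l) }

      sorted-lookup : ∀ {xs} → Sorted xs → ∀ {k l} → k Fin.< l → i (List.lookup xs k) < i (List.lookup xs l)
      sorted-lookup (x< ∷ s) {Fin.zero} {Fin.suc l} _ = All.lookup x< (∈-lookup l)
      sorted-lookup (x< ∷ s) {Fin.suc k} {Fin.suc l} k<l = sorted-lookup s (ℕ.s≤s⁻¹ k<l)

      -- Sorting and removing repetitions factors an arbitrary finite tuple through a strictly
      -- increasing one, to which indiscernibility applies.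
      enumerate : ∃ λ p → ∃ λ (r : Fin p → Fin m) → ∃ λ (pos : Fin m → Fin p) →
                  (∀ {k l} → k Fin.< l → i (r k) < i (r l)) × (∀ k → i (r (pos k)) ≡ i k)
      enumerate =
        let (xs , s , c) = sort (List.allFin m) in
        List.length xs , List.lookup xs , (λ k → Any.index (c (∈-allFin k))) , sorted-lookup s ,
        λ k → Any.lookup-index (c (∈-allFin k))

  -- The initial ordered set and directed unions

  module Base {ℓ} {L : Language ℓ} (𝔐 : Structure L)
              (Q : ∀ {s} → Carrier 𝔐 s → Set ℓ) (σ : Ctx L) where

    open Semantics 𝔐
    open Sequences 𝔐 Q σ
    open Seq
    open El
    open _⊑_
    open Sequence using (_<_)

    module _ (A : Sequence 𝔐 σ) (A⊆Q : SequenceIn Q A) (nonconst : NonConstant A) (indA : Indiscernible A) where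

      private
        module O = IsStrictTotalOrder (isOrder A)

        _≺ᴬ_ : Index A → Index A → Set ℓ
        _≺ᴬ_ = _<_ A

        two : Index A → Index A → Fin 2 → Index A
        two i j Fin.zero = i
        two i j (Fin.suc _) = j

        two-increasing : ∀ {i j} → i ≺ᴬ j → Increasing A (two i j)
        two-increasing l {Fin.zero} {Fin.suc Fin.zero} _ = l
        two-increasing l {Fin.suc Fin.zero} {Fin.suc Fin.zero} (ℕ.s≤s ())

      equal-transfer : ∀ {i j i′ j′} → i ≺ᴬ j → i′ ≺ᴬ j′ → elem A i ≡ elem A j → elem A i′ ≡ elem A j′
      equal-transfer {i} {j} {i′} {j′} l l′ e =
        fwd (⊩-equal (elem A ∘ two i′ j′))
          (fwd (indA 2 (equal {σ = σ}) (two i j) (two i′ j′) (two-increasing l) (two-increasing l′))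
            (bwd (⊩-equal (elem A ∘ two i j)) e))

      -- By indiscernibility one coincidence at distinct indices would spread to all of them and
      -- make the sequence constant.
      increasing-distinct : ∀ {i j} → i ≺ᴬ j → elem A i ≢ elem A j
      increasing-distinct l e = let (i₀ , j₀ , ≢) = nonconst in distinct i₀ j₀ ≢
        where
        distinct : ∀ i₀ j₀ → elem A i₀ ≢ elem A j₀ → ⊥
        distinct i₀ j₀ ≢ with O.compare i₀ j₀
        ... | tri< l₀ _ _ = ≢ (equal-transfer l l₀ e)
        ... | tri≈ _ refl _ = ≢ refl
        ... | tri> _ _ g = ≢ (sym (equal-transfer l g e))

      elem-injective : ∀ {i j} → elem A i ≡ elem A j → i ≡ j
      elem-injective {i} {j} e with O.compare i j
      ... | tri< l _ _ = contradiction e (increasing-distinct l)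
      ... | tri≈ _ eq _ = eq
      ... | tri> _ _ g = contradiction (sym e) (increasing-distinct g)

      Dom : V → Set ℓ
      Dom x = ∃ λ i → elem A i ≡ x

      Lt : V → V → Set ℓ
      Lt x y = ∃ λ i → ∃ λ j → elem A i ≡ x × elem A j ≡ y × i ≺ᴬ j

      lt-elem : ∀ {i j} → T ⌊ Lt (elem A i) (elem A j) ⌋ ⇔ i ≺ᴬ j
      lt-elem {i} {j} = mk⇔ (λ h → index-order (holds h)) (λ l → check (i , j , refl , refl , l))
        where
        index-order : Lt (elem A i) (elem A j) → i ≺ᴬ j
        index-order (i′ , j′ , p , q , l) = subst₂ _≺ᴬ_ (elem-injective p) (elem-injective q) l

      base : Seq
      base = record
        { dom    = λ x → ⌊ Dom x ⌋
        ; lt     = λ x y → ⌊ Lt x y ⌋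
        ; irrefl = λ h → irrefl′ (holds h)
        ; trans< = λ h k l → trans′ (holds h) (holds k) (holds l)
        ; tri    = λ h k → tri′ (holds h) (holds k)
        ; inQ    = λ h → inQ′ (holds h)
        ; indisc = λ θ t u h k so → indisc′ θ t u (λ i → holds (h i)) (λ i → holds (k i)) so
        }
        where
        irrefl′ : ∀ {x} → Dom x → ¬ T ⌊ Lt x x ⌋
        irrefl′ (i , refl) h = O.irrefl refl (fwd lt-elem h)

        trans′ : ∀ {x y z} → Dom x → Dom y → Dom z → T ⌊ Lt x y ⌋ → T ⌊ Lt y z ⌋ → T ⌊ Lt x z ⌋
        trans′ (i , refl) (j , refl) (k , refl) h h′ = bwd lt-elem (O.trans (fwd lt-elem h) (fwd lt-elem h′))

        tri′ : ∀ {x y} → Dom x → Dom y → T ⌊ Lt x y ⌋ ⊎ x ≡ y ⊎ T ⌊ Lt y x ⌋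
        tri′ (i , refl) (j , refl) with O.compare i j
        ... | tri< l _ _ = inj₁ (bwd lt-elem l)
        ... | tri≈ _ refl _ = inj₂ (inj₁ refl)
        ... | tri> _ _ g = inj₂ (inj₂ (bwd lt-elem g))

        inQ′ : ∀ {x} → Dom x → AllIn 𝔐 Q x
        inQ′ (i , refl) = A⊆Q i

        -- `Indiscernible` concerns increasing tuples only, whereas `t` and `u` are arbitrary tuples
        -- of equal order type. The positions that sort `t` sort `u` as well, and the rearrangement
        -- is absorbed into the formula by renaming.
        indisc′ : ∀ {m} (θ : Fm m) (t u : Fin m → V) → (∀ k → Dom (t k)) → (∀ k → Dom (u k)) →
                  (∀ k l → T ⌊ Lt (t k) (t l) ⌋ ⇔ T ⌊ Lt (u k) (u l) ⌋) → t ⊩* θ → u ⊩* θ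
        indisc′ {m} θ t u h k so = transfer (enumerate (isOrder A) i)
          where
          i i′ : Fin m → Index A
          i x = proj₁ (h x)
          i′ x = proj₁ (k x)

          so′ : ∀ x y → (i x ≺ᴬ i y) ⇔ (i′ x ≺ᴬ i′ y)
          so′ x y = lt-elem ⇔-∘ (subst₂ (λ P Q → T P ⇔ T Q)
            (sym (cong₂ (λ v w → ⌊ Lt v w ⌋) (proj₂ (h x)) (proj₂ (h y))))
            (sym (cong₂ (λ v w → ⌊ Lt v w ⌋) (proj₂ (k x)) (proj₂ (k y)))) (so x y)
            ⇔-∘ ⇔-sym lt-elem)

          same-eq : ∀ x y → i x ≡ i y → i′ x ≡ i′ y
          same-eq x y e with O.compare (i′ x) (i′ y)
          ... | tri≈ _ eq _ = eq
          ... | tri< l _ _ = ⊥-elim (O.irrefl e (bwd (so′ x y) l))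
          ... | tri> _ _ g = ⊥-elim (O.irrefl (sym e) (bwd (so′ y x) g))

          transfer : (∃ λ p → ∃ λ (r : Fin p → Fin m) → ∃ λ (pos : Fin m → Fin p) →
                      (∀ {k l} → k Fin.< l → i (r k) ≺ᴬ i (r l)) × (∀ k → i (r (pos k)) ≡ i k)) →
                     t ⊩* θ → u ⊩* θ
          transfer (p , r , pos , inc , cov) hold =
            ⊩*-cong θ (λ x → trans (cong (elem A) (same-eq (r (pos x)) x (cov x))) (proj₂ (k x)))
              (fwd (⊩-rename (agree-relabel pos (elem A ∘ i′ ∘ r)) θ)
                (fwd (indA p (rename (relabel pos) θ) (i ∘ r) (i′ ∘ r) inc (λ l → fwd (so′ _ _) (inc l)))
                  (bwd (⊩-rename (agree-relabel pos (elem A ∘ i ∘ r)) θ)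
                    (⊩*-cong θ (λ x → sym (trans (cong (elem A) (cov x)) (proj₂ (h x)))) hold))))

    module Union {I : Set ℓ} (S : I → Seq) (i₀ : I)
                 (directed : ∀ i j → ∃ λ k → S i ⊑ S k × S j ⊑ S k) where

      Domᵁ : V → Set ℓ
      Domᵁ x = ∃ λ i → x ∈ˢ S i

      Ltᵁ : V → V → Set ℓ
      Ltᵁ x y = ∃ λ i → x ∈ˢ S i × y ∈ˢ S i × T (lt (S i) x y)

      -- The member is found above a prescribed `j`: indiscernibility needs one that contains two
      -- tuples, and the coheir condition one that extends a given member.
      common : ∀ {m} (t : Fin m → V) → (∀ k → Domᵁ (t k)) → ∀ j → ∃ λ i → S j ⊑ S i × (∀ k → t k ∈ˢ S i)
      common {zero} t h j = j , ⊑-refl , λ ()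
      common {suc m} t h j =
        let (i , p , h′) = common (t ∘ Fin.suc) (h ∘ Fin.suc) j
            (i₁ , h₁) = h Fin.zero
            (k , q , q₁) = directed i i₁
        in k , ⊑-trans p q , λ { Fin.zero → sub q₁ h₁ ; (Fin.suc x) → sub q (h′ x) }

      ltᵁ : ∀ {i x y} → x ∈ˢ S i → y ∈ˢ S i → T ⌊ Ltᵁ x y ⌋ ⇔ T (lt (S i) x y)
      ltᵁ {i} {x} {y} h k = mk⇔ (λ l → restrict (holds l)) (λ l → check (i , h , k , l))
        where
        restrict : Ltᵁ x y → T (lt (S i) x y)
        restrict (j , h′ , k′ , l) = let (_ , p , q) = directed i j in
          bwd (order p h k) (fwd (order q h′ k′) l)

      triple : V → V → V → Fin 3 → V
      triple x y z Fin.zero = x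
      triple x y z (Fin.suc Fin.zero) = y
      triple x y z (Fin.suc (Fin.suc _)) = z

      common₃ : ∀ {x y z} → Domᵁ x → Domᵁ y → Domᵁ z → ∃ λ i → x ∈ˢ S i × y ∈ˢ S i × z ∈ˢ S i
      common₃ {x} {y} {z} h k l =
        let (i , _ , f) = common (triple x y z) (λ { Fin.zero → h ; (Fin.suc Fin.zero) → k ; (Fin.suc (Fin.suc _)) → l }) i₀
        in i , f Fin.zero , f (Fin.suc Fin.zero) , f (Fin.suc (Fin.suc Fin.zero))

      -- Every condition involves finitely many points at a time, and these lie in one member of the
      -- directed family.
      union : Seq
      union = record
        { dom    = λ x → ⌊ Domᵁ x ⌋
        ; lt     = λ x y → ⌊ Ltᵁ x y ⌋
        ; irrefl = λ h l → let (i , k) = holds h in irrefl (S i) k (fwd (ltᵁ k k) l)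
        ; trans< = λ h k l p q → let (i , h′ , k′ , l′) = common₃ (holds h) (holds k) (holds l) in
            bwd (ltᵁ h′ l′) (trans< (S i) h′ k′ l′ (fwd (ltᵁ h′ k′) p) (fwd (ltᵁ k′ l′) q))
        ; tri    = λ h k → let (i , h′ , k′ , _) = common₃ (holds h) (holds k) (holds k) in
            Sum.map (bwd (ltᵁ h′ k′)) (Sum.map₂ (bwd (ltᵁ k′ h′))) (tri (S i) h′ k′)
        ; inQ    = λ h → let (i , k) = holds h in inQ (S i) k
        ; indisc = λ θ t u h k so →
            let (i , _ , h′) = common t (λ x → holds (h x)) i₀
                (j , p , k′) = common u (λ x → holds (k x)) i
            in indisc (S j) θ t u (λ x → sub p (h′ x)) k′ λ x y →
               ltᵁ (k′ x) (k′ y) ⇔-∘ (so x y ⇔-∘ ⇔-sym (ltᵁ (sub p (h′ x)) (sub p (h′ y))))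
        }

      union-⊒ : ∀ i → S i ⊑ union
      union-⊒ i = record
        { sub    = λ h → check (i , h)
        ; order  = λ h k → ⇔-sym (ltᵁ h k)
        ; coheir = λ θs t h ks → let (j , p , h′) = common t (λ x → holds (h x)) i in coheir p θs t h′ ks
        }

  -- Counting formulas

  module _ {ℓ} {L : Language ℓ} where

    -- Pairwise distinct sentences available in every language; they make the set of formulas
    -- infinite.
    implications : ℕ → Formula L []
    implications zero = false
    implications (suc k) = false ⇒ implications k

    implications-injective : ∀ {k l} → implications k ≡ implications l → k ≡ l
    implications-injective {zero} {zero} e = refl
    implications-injective {suc k} {suc l} e = cong suc (implications-injective (⇒-inj e))
      where
      ⇒-inj : ∀ {Γ} {φ φ′ ψ ψ′ : Formula L Γ} → φ ⇒ ψ ≡ φ′ ⇒ ψ′ → ψ ≡ ψ′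
      ⇒-inj refl = refl

    ℕ↣formulas : ℕ ↣ ∣ L ∣ᴸ
    ℕ↣formulas = mk↣ {to = λ k → [] , implications k} (implications-injective ∘ unpair)
      where
      unpair : ∀ {φ ψ : Formula L []} → _≡_ {A = ∣ L ∣ᴸ} ([] , φ) ([] , ψ) → φ ≡ ψ
      unpair refl = refl

    module _ {C : Sort L → Set ℓ} where

      -- Entries carry their sorts, so the list determines the context as well as the parameters.
      entries : ∀ {Δ} → All C Δ → List (Σ (Sort L) C)
      entries [] = []
      entries (c ∷ cs) = (_ , c) ∷ entries cs

      entries-injective : ∀ {Δ Δ′} (b : All C Δ) (b′ : All C Δ′) → entries b ≡ entries b′ →
                          _≡_ {A = Σ (Ctx L) (All C)} (Δ , b) (Δ′ , b′)
      entries-injective [] [] e = refl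
      entries-injective (c ∷ b) (c′ ∷ b′) e with ∷-injective e
      ... | refl , e′ with entries-injective b b′ e′
      ...   | refl = refl

    InstanceFormula : (Sort L → Set ℓ) → Ctx L → Set ℓ
    InstanceFormula C σ = Σ ℕ λ n → FormulaOver {L = L} C (_^_ {L = L} σ n)

    module _ {Z : Set ℓ} (ι : ℕ ↣ Z) (pr : (Z × Z) ↣ Z) {C : Sort L → Set ℓ} {σ : Ctx L} where

      open Absorb ι pr

      formulas-absorb : Σ (Sort L) C ↣ Z → ∣ L ∣ᴸ ↣ Z → InstanceFormula C σ ↣ Z
      formulas-absorb f g = ×-absorb ι (×-absorb g (List-absorb f)) ↣-∘ mk↣ {to = code} code-injective
        where
        code : InstanceFormula C σ → ℕ × ∣ L ∣ᴸ × List (Σ (Sort L) C)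
        code (n , (φ at b)) = n , (_ , φ) , entries b

        code-injective : ∀ {u v} → code u ≡ code v → u ≡ v
        code-injective {n , (φ at b)} {n′ , (φ′ at b′)} e
          with cong proj₁ e | entries-injective b b′ (cong (proj₂ ∘ proj₂) e)
        ... | refl | refl with cong (proj₁ ∘ proj₂) e
        ...   | refl = refl

  -- The maximal extension

  module Maximal {ℓ} {L : Language ℓ} (𝔐 : Structure L)
                 (Q : ∀ {s} → Carrier 𝔐 s → Set ℓ) (σ : Ctx L)
                 {κ : Set ℓ} (saturated : Saturated (_⋖ κ) (expand 𝔐 Q))
                 {C : Sort L → Set ℓ} (val : ∀ {s} → C s → Carrier 𝔐 s)
                 {Z : Set ℓ} (ι : ℕ ↣ Z) (pr : (Z × Z) ↣ Z) (Z⋖κ : Z ⋖ κ)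
                 (C↣Z : Σ (Sort L) C ↣ Z) (L↣Z : ∣ L ∣ᴸ ↣ Z)
                 (nip : ∀ n {Δ} (φ : Formula L (_^_ {L = L} σ n ++ Δ)) → ¬ HasIP 𝔐 (_^_ {L = L} σ n) Δ φ) where

    open Semantics 𝔐
    open Sequences 𝔐 Q σ
    open Extension 𝔐 Q σ
    open Shattering 𝔐 Q σ
    open Handling 𝔐 Q σ
    open Saturation 𝔐 Q σ saturated
    open Base 𝔐 Q σ
    open Absorb ι pr
    open Seq
    open El
    open _⊑_

    El-≡ : ∀ {B} {x y : El B} → point x ≡ point y → x ≡ y
    El-≡ {x = x , h} {.x , k} refl = cong (x ,_) (T-irrelevant h k)

    finite-absorb : ∀ {B D} → FiniteOver B D → El B ↣ Z → El D ↣ Z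
    finite-absorb {B} {D} (xs , f) i = ⊎-absorb i ι ↣-∘ mk↣ {to = λ x → code (f (member x))}
      λ {x} {y} e → El-≡ (code-injective (f (member x)) (f (member y)) e)
      where
      code : ∀ {x} → x ∈ˢ B ⊎ x ∈ xs → El B ⊎ ℕ
      code {x} = Sum.map (x ,_) position

      code-injective : ∀ {x y} (c : x ∈ˢ B ⊎ x ∈ xs) (d : y ∈ˢ B ⊎ y ∈ xs) → code c ≡ code d → x ≡ y
      code-injective (inj₁ h) (inj₁ k) refl = refl
      code-injective (inj₂ h) (inj₂ k) e = cong proj₁ (position-injective {i = h} {k} (injective inj₂-↣ e))

    Instance : Set ℓ
    Instance = InstanceFormula {L = L} C σ

    HandledAt : Instance → Seq → Set ℓ
    HandledAt (n , (φ at b)) B = Handled (instanceOf n φ (All.map val b)) B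

    handledAt-mono : ∀ f {B D} → B ⊑ D → HandledAt f B → HandledAt f D
    handledAt-mono (n , (φ at b)) = handled-mono (instanceOf n φ (All.map val b))

    module _ (A₀ : Seq) (x₀ : El A₀) {J : Set ℓ} (J↣Z : J ↣ Z) (label₀ : V → J)
             (label₀-injective : ∀ {x y} → x ∈ˢ A₀ → y ∈ˢ A₀ → label₀ x ≡ label₀ y → x ≡ y) where

      Label : Set ℓ
      Label = J ⊎ (Instance × ℕ)

      Label↣Z : Label ↣ Z
      Label↣Z = ⊎-absorb J↣Z (×-absorb (formulas-absorb ι pr C↣Z L↣Z) ι)

      -- The labels bound the size of seq: only finitely many points are added
      -- for each handled instance.
      record Node : Set ℓ where
        field
          seq   : Seq
          above : A₀ ⊑ seq
          label : V → Label
          label-injective : ∀ {x y} → x ∈ˢ seq → y ∈ˢ seq → label x ≡ label y → x ≡ y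
          label-handled   : ∀ {x f k} → x ∈ˢ seq → label x ≡ inj₂ (f , k) → HandledAt f seq

      open Node

      -- Labels never change, so the union of a chain inherits an injective labelling.
      _≼_ : Node → Node → Set ℓ
      p ≼ q = seq p ⊑ seq q × ∀ {x} → x ∈ˢ seq p → label p x ≡ label q x

      ≼-refl : ∀ {p} → p ≼ p
      ≼-refl = ⊑-refl , λ _ → refl

      ≼-trans : ∀ {p q r} → p ≼ q → q ≼ r → p ≼ r
      ≼-trans (p , f) (q , g) = ⊑-trans p q , λ h → trans (f h) (g (sub p h))

      node-small : ∀ p → El (seq p) ↣ Z
      node-small p = Label↣Z ↣-∘ mk↣ {to = label p ∘ point}
        λ {x} {y} e → El-≡ (label-injective p (member x) (member y) e)

      start : Node
      start = record
        { seq = A₀ ; above = ⊑-refl ; label = inj₁ ∘ label₀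
        ; label-injective = λ h k e → label₀-injective h k (injective inj₁-↣ e)
        ; label-handled = λ _ ()
        }

      chain-bound : ∀ 𝒞 → Chain _≼_ 𝒞 → ∃ λ u → ∀ p → T (𝒞 p) → p ≼ u
      chain-bound 𝒞 c with em {P = ∃ λ p → T (𝒞 p)}
      ... | no ¬p = start , λ p h → ⊥-elim (¬p (p , h))
      ... | yes i₀ = limit , λ p h → union-⊒ (p , h) , λ x∈ → sym (label-≡ em (p , h) x∈)
        where
        I : Set ℓ
        I = ∃ λ p → T (𝒞 p)

        directed≼ : ∀ (i j : I) → ∃ λ (k : I) → proj₁ i ≼ proj₁ k × proj₁ j ≼ proj₁ k
        directed≼ (p , h) (q , k) = [ (λ l → (q , k) , l , ≼-refl {q}) , (λ l → (p , h) , ≼-refl {p} , l) ]′ (c p q h k)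

        directed : ∀ (i j : I) → ∃ λ (k : I) → seq (proj₁ i) ⊑ seq (proj₁ k) × seq (proj₁ j) ⊑ seq (proj₁ k)
        directed i j = let (k , (p , _) , (q , _)) = directed≼ i j in k , p , q

        open Union (seq ∘ proj₁) i₀ directed

        labelᵁ : ∀ x → Dec (Domᵁ x) → Label
        labelᵁ x (yes ((p , _) , _)) = label p x
        labelᵁ x (no _) = inj₁ (label₀ x)

        label-≡ : ∀ {x} (d : Dec (Domᵁ x)) (i : I) → x ∈ˢ seq (proj₁ i) → labelᵁ x d ≡ label (proj₁ i) x
        label-≡ (no ¬d) i h = contradiction (i , h) ¬d
        label-≡ (yes (j , k)) i h = let (_ , (_ , f) , (_ , g)) = directed≼ i j in trans (g k) (sym (f h))

        limit : Node
        limit = record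
          { seq = union
          ; above = ⊑-trans (above (proj₁ i₀)) (union-⊒ i₀)
          ; label = λ x → labelᵁ x em
          ; label-injective = λ h k e → let (i , h′ , k′ , _) = common₃ (holds h) (holds k) (holds k) in
              label-injective (proj₁ i) h′ k′ (trans (sym (label-≡ em i h′)) (trans e (label-≡ em i k′)))
          ; label-handled = λ {x} {f} h e → let (i , h′) = holds h in
              handledAt-mono f (union-⊒ i) (label-handled (proj₁ i) h′ (trans (sym (label-≡ em i h′)) e))
          }

      module _ (p : Node) (max : ∀ q → p ≼ q → q ≼ p) where

        -- `handle` yields an extension by finitely many points that handles `f`. If `seq p` did not
        -- handle `f`, this would be a node above `p`; maximality puts it below `p`, and
        -- `handledAt-mono` then makes `seq p` handle `f` after all.
        maximal-handles : ∀ f → HandledAt f (seq p)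
        maximal-handles f@(n , (φ at b)) = dne λ ¬H → ¬H (handledAt-mono f (proj₁ (max (extended ¬H) (extended-⊒ ¬H))) handledB)
          where
          result : ∃ λ B → seq p ⊑ B × FiniteOver (seq p) B × HandledAt f B
          result = handle n φ (All.map val b) (seq p)
            (λ B le fin → realisable val ι pr Z⋖κ C↣Z (promote (⊑-trans (above p) le) x₀)
                            (finite-absorb {seq p} {B} fin (node-small p)) φ b)
            (nip n φ)

          B = proj₁ result
          p⊑B = proj₁ (proj₂ result)
          xs = proj₁ (proj₁ (proj₂ (proj₂ result)))
          new : ∀ {x} → x ∈ˢ B → x ∈ˢ seq p ⊎ x ∈ xs
          new = proj₂ (proj₁ (proj₂ (proj₂ result)))
          handledB : HandledAt f B
          handledB = proj₂ (proj₂ (proj₂ result))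

          module _ (¬H : ¬ HandledAt f (seq p)) where

            label′ : ∀ x → Dec (x ∈ˢ seq p) → Dec (x ∈ xs) → Label
            label′ x (yes _) _ = label p x
            label′ x (no _) (yes i) = inj₂ (f , position i)
            label′ x (no _) (no _) = inj₁ (label₀ x)

            -- The new points receive labels at the instance `f`. No old point has such a label,
            -- since `label-handled` would then say that `f` was handled already.
            label′-injective : ∀ {x y} → x ∈ˢ B → y ∈ˢ B → ∀ d d′ e e′ →
                               label′ x d d′ ≡ label′ y e e′ → x ≡ y
            label′-injective h k (yes u) _ (yes v) _ eq = label-injective p u v eq
            label′-injective h k (yes u) _ (no _) (yes i) eq = ⊥-elim (¬H (label-handled p u eq))
            label′-injective h k (no _) (yes i) (yes v) _ eq = ⊥-elim (¬H (label-handled p v (sym eq)))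
            label′-injective h k (no _) (yes i) (no _) (yes j) eq =
              cong proj₁ (position-injective {i = i} {j} (cong proj₂ (injective inj₂-↣ eq)))
            label′-injective h k (no ¬u) (no ¬i) _ _ eq = ⊥-elim ([ ¬u , ¬i ]′ (new h))
            label′-injective h k (yes _) _ (no ¬v) (no ¬j) eq = ⊥-elim ([ ¬v , ¬j ]′ (new k))
            label′-injective h k (no _) (yes _) (no ¬v) (no ¬j) eq = ⊥-elim ([ ¬v , ¬j ]′ (new k))

            label′-handled : ∀ {x g k} → ∀ d d′ → label′ x d d′ ≡ inj₂ (g , k) → HandledAt g B
            label′-handled {g = g} (yes u) _ eq = handledAt-mono g p⊑B (label-handled p u eq)
            label′-handled (no _) (yes i) refl = handledB

            label′-old : ∀ {x} → x ∈ˢ seq p → ∀ d d′ → label p x ≡ label′ x d d′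
            label′-old h (yes _) _ = refl
            label′-old h (no ¬h) _ = contradiction h ¬h

            extended : Node
            extended = record
              { seq = B
              ; above = ⊑-trans (above p) p⊑B
              ; label = λ x → label′ x em em
              ; label-injective = λ h k → label′-injective h k em em em em
              ; label-handled = λ {x} _ → label′-handled {x} em em
              }

            extended-⊒ : p ≼ extended
            extended-⊒ = p⊑B , λ h → label′-old h em em

      saturated-extension : ∃ λ B → A₀ ⊑ B × (El B ↣ Z) × (∀ f → HandledAt f B)
      saturated-extension =
        let (p , max) = zorn _≼_ (λ {p} → ≼-refl {p}) (λ {p} {q} {r} → ≼-trans {p} {q} {r}) chain-bound
        in seq p , above p , node-small p , maximal-handles p max

  -- Types finitely realised in the final sequence

  module Conclusion {ℓ} {L : Language ℓ} (𝔐 : Structure L)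
                    (Q : ∀ {s} → Carrier 𝔐 s → Set ℓ) (σ : Ctx L) where

    open Semantics 𝔐
    open Sequences 𝔐 Q σ
    open Shattering 𝔐 Q σ
    open Encoding 𝔐 Q σ
    open Handled
    open Seq
    open El

    module _ (B : Seq) where

      _≺ᴮ_ : El B → El B → Set ℓ
      x ≺ᴮ y = Lift ℓ (T (lt B (point x) (point y)))

      asym : ∀ {x y : El B} → x ≺ᴮ y → ¬ y ≺ᴮ x
      asym {x} {y} (lift l) (lift g) = irrefl B (member x) (trans< B (member x) (member y) (member x) l g)

      compare : Trichotomous _≡_ _≺ᴮ_
      compare x y with tri B (member x) (member y)
      ... | inj₁ l = tri< (lift l) (λ { refl → irrefl B (member x) l }) (asym {x} {y} (lift l))
      ... | inj₂ (inj₂ g) = tri> (asym {y} {x} (lift g)) (λ { refl → irrefl B (member x) g }) (lift g)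
      compare (x , h) (.x , k) | inj₂ (inj₁ refl) with T-irrelevant h k
      ... | refl = tri≈ (irrefl B h ∘ lower) refl (irrefl B h ∘ lower)

      sequence : Sequence 𝔐 σ
      sequence = record
        { Index = El B
        ; _<_ = _≺ᴮ_
        ; isOrder = record
          { isStrictPartialOrder = record
            { isEquivalence = isEquivalence
            ; irrefl = λ { {x} refl (lift l) → irrefl B (member x) l }
            ; trans = λ { {x} {y} {z} (lift l) (lift g) → lift (trans< B (member x) (member y) (member z) l g) }
            ; <-resp-≈ = (λ { refl l → l }) , (λ { refl l → l })
            }
          ; compare = compare
          }
        ; elem = point
        }

      sequence-indiscernible : Indiscernible sequence
      sequence-indiscernible n φ t u inc-t inc-u = mk⇔ (slide t u inc-t inc-u) (slide u t inc-u inc-t)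
        where
        preserve : ∀ t u → Increasing sequence t → Increasing sequence u → ∀ {k l : Fin n} →
                   T (lt B (point (t k)) (point (t l))) → T (lt B (point (u k)) (point (u l)))
        preserve t u inc-t inc-u {k} {l} h with Fin.<-cmp k l
        ... | tri< k<l _ _ = lower (inc-u k<l)
        ... | tri≈ _ refl _ = ⊥-elim (irrefl B (member (t k)) h)
        ... | tri> _ _ l<k = ⊥-elim (asym {t k} {t l} (lift h) (inc-t l<k))

        slide : ∀ t u → Increasing sequence t → Increasing sequence u →
               (point ∘ t) ⊩* φ → (point ∘ u) ⊩* φ
        slide t u inc-t inc-u = indisc B φ (point ∘ t) (point ∘ u) (member ∘ t) (member ∘ u)
          λ k l → mk⇔ (preserve t u inc-t inc-u) (preserve u t inc-u inc-t)

      module _ (x₀ : El B) n (q : FormulaOver {L = L} (Coordinate B) (_^_ {L = L} σ n) → Set ℓ)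
               (q-or-not : ∀ ψ → q ψ ⊎ q (~ᵒ ψ)) (realised : FinitelyRealisedIn sequence n q) where

        Contained : List (OverSeq B n) → Set ℓ
        Contained θs = All (λ θ → q (encode x₀ θ)) θs

        refute : ∀ (pieces : List (List (OverSeq B n))) → ¬ Any Contained pieces →
                 ∃ λ ψs → All q ψs × ∀ (t : Fin n → El B) →
                 All (Sat 𝔐 {B = Coordinate B} coordinate (join 𝔐 n (point ∘ t))) ψs →
                 ¬ Any (All ((point ∘ t) ⊨ᵒ_)) pieces
        refute [] _ = [] , [] , λ _ _ ()
        refute (θs ∷ pieces) ¬a with refute pieces (¬a ∘ there)
                                   | em {P = ∃ λ θ → θ ∈ θs × ¬ q (encode x₀ θ)}
        ... | _ | no ¬e = ⊥-elim (¬a (here (All.tabulate λ {θ} i → dne λ ¬h → ¬e (θ , i , ¬h))))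
        ... | ψs , qψs , f | yes (θ , i , ¬q) =
          ~ᵒ encode x₀ θ ∷ ψs , [ (λ h → contradiction h ¬q) , id ]′ (q-or-not (encode x₀ θ)) ∷ qψs ,
          λ { t (s ∷ ss) (here a) → lower (s (bwd (Sat-encode x₀ θ (point ∘ t)) (All.lookup a i)))
            ; t (s ∷ ss) (there a) → f t ss a }

        -- If `q` contained no piece entirely, it would contain the negation of a formula from every
        -- piece. A tuple of `B` realising these finitely many negations would lie outside the
        -- cover.
        contained : ∀ (pieces : List (List (OverSeq B n))) →
                    (∀ (t : Fin n → El B) → Any (All ((point ∘ t) ⊨ᵒ_)) pieces) → Any Contained pieces
        contained pieces cov = dne λ ¬a →
          let (ψs , qψs , f) = refute pieces ¬a ; (t , ss) = realised ψs qψs in f t ss (cov t)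

        -- Both realisations of `q` satisfy the piece contained in `q`, and this piece fixes the
        -- truth value of the instance throughout P.
        implies : ∀ {Δ} (φ : Formula L (_^_ {L = L} σ n ++ Δ)) (b : Tuple 𝔐 Δ) → Handled (instanceOf n φ b) B →
                  ∀ c d → (∀ k → AllIn 𝔐 Q (c k)) → (∀ k → AllIn 𝔐 Q (d k)) →
                  (∀ ψ → q ψ → Sat 𝔐 {B = Coordinate B} coordinate (join 𝔐 n c) ψ) →
                  (∀ ψ → q ψ → Sat 𝔐 {B = Coordinate B} coordinate (join 𝔐 n d) ψ) →
                  instanceOf n φ b c → instanceOf n φ b d
        implies φ b H c d c∈ d∈ rc rd φc =
          decided (All.lookupAny (decide H) (contained (pieces H) λ t → cover H (point ∘ t) (member ∘ t)))
          where
          satisfied : ∀ {θs} c → (∀ ψ → q ψ → Sat 𝔐 {B = Coordinate B} coordinate (join 𝔐 n c) ψ) →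
                      Contained θs → All (c ⊨ᵒ_) θs
          satisfied c r = All.map λ {θ} h → fwd (Sat-encode x₀ θ c) (r _ h)

          decided : ∀ {θs} → Decides (instanceOf n φ b) θs × Contained θs → instanceOf n φ b d
          decided (inj₁ pos , k) = pos d d∈ (satisfied d rd k)
          decided (inj₂ neg , k) = contradiction φc (neg c c∈ (satisfied c rc k))

lemma1p3 : (∀ {a} → ExcludedMiddle a) →
    (∀ {a b} → Extensionality a b) →
    ∀ {ℓ} (L : Language ℓ) (T : Theory L) → Complete T → NIP T →
    (M : Structure L) → M ⊨ᵀ T →
    (N : Structure L) (ι : M ≺ N) →
    Saturated (λ B → B ↣ (∣ M ∣ ⊎ ∣ L ∣ᴸ)) N →
    (N′ : Structure L) (M′ : ∀ {s} → Carrier N′ s → Set ℓ) →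
    (j : pair ι ≺ expand N′ M′) →
    (κ : Set ℓ) → (∣ N ∣ ⊎ ∣ L ∣ᴸ) ⋖ κ →
    Saturated (_⋖ κ) (expand N′ M′) →
    StronglyHomogeneous (_⋖ κ) (expand N′ M′) →
    (σ : Ctx L) (A : Sequence N′ σ) →
    Index A ⋖ κ → SequenceIn M′ A → NonConstant A → Indiscernible A →
    Σ (Sequence N′ σ) λ A′ →
    Index A′ ⋖ κ × SequenceIn M′ A′ × Indiscernible A′ × (A′ Extends A) ×
    (∀ (n : ℕ) (q : PartialType (Coord A′) (σ ^ n)) →
    IsCompleteType N′ (coord A′) q →
    FinitelyRealisedIn A′ n q →
    ∀ (c d : Tuple N′ (σ ^ n)) → AllIn N′ M′ c → AllIn N′ M′ d →
    Realises N′ (coord A′) c q → Realises N′ (coord A′) d q →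
    SameType N′ {B = Carrier N} (to j) c d)
lemma1p3 em ext {ℓ} L T complete nip M M⊨T N ι satN N′ M′ j κ N⋖κ satN′ hom σ A A⋖κ A⊆M′ nonconst indA =
  -- The formulas make `∣ N ∣ ⊎ ∣ L ∣ᴸ` infinite. The resulting `Z` has room for the parameters, the
  -- instances and the given sequence, and absorbs products.
  build (absorbing {X = ∣ N ∣ ⊎ ∣ L ∣ᴸ} {Y = Index A}
    (inj₂-↣ ↣-∘ ℕ↣formulas) N⋖κ A⋖κ)
  where
  open Classical em ext
  open Semantics N′
  open Sequences N′ M′ σ
  open Base N′ M′ σ
  open Encoding N′ M′ σ
  open Conclusion N′ M′ σ
  open El

  -- `NIP` is applied in `N′`, where the shattered tuples lie. Sentences of `L` pass from `M` to `N`
  -- and then, read in the language of pairs, along `j`.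
  N′⊨T : N′ ⊨ᵀ T
  N′⊨T φ t = fwd (⊨-embed N′ M′ φ [])
    (fwd (elementary j (embed φ) [])
      (bwd (⊨-embed N _ φ []) (fwd (elementary ι φ []) (M⊨T φ t))))

  A₀ : Seq
  A₀ = base A A⊆M′ nonconst indA

  i₀ : Index A
  i₀ = proj₁ nonconst

  member₀ : ∀ i → elem A i ∈ˢ A₀
  member₀ i = check (i , refl)

  label : ∀ {x} → Dec (∃ λ i → elem A i ≡ x) → Index A
  label (yes (i , _)) = i
  -- A default value: labels are compared only for points of the sequence.
  label (no _) = i₀

  label-elem : ∀ {x} (d : Dec (∃ λ i → elem A i ≡ x)) → (∃ λ i → elem A i ≡ x) → elem A (label d) ≡ x
  label-elem (yes (_ , e)) _ = e
  label-elem (no ¬e) e = contradiction e ¬e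

  label-injective : ∀ {x y} → x ∈ˢ A₀ → y ∈ˢ A₀ → label {x} em ≡ label {y} em → x ≡ y
  label-injective h k e = trans (sym (label-elem em (holds h)))
                         (trans (cong (elem A) e) (label-elem em (holds k)))

  build : (∃ λ (Z : Set ℓ) → (ℕ ↣ Z) × ((Z × Z) ↣ Z) × (Z ⋖ κ) ×
             ((∣ N ∣ ⊎ ∣ L ∣ᴸ) ↣ Z) × (Index A ↣ Z)) → _
  build (Z , ω , pr , Z⋖κ , NL↣Z , A↣Z) =
    finish (saturated-extension A₀ (elem A i₀ , member₀ i₀) A↣Z (λ x → label {x} em) label-injective)
    where
    open Maximal N′ M′ σ satN′ {C = Carrier N} (to j) ω pr Z⋖κ
      (NL↣Z ↣-∘ inj₁-↣) (NL↣Z ↣-∘ inj₂-↣) (λ n {Δ} φ → nip (_^_ {L = L} σ n) Δ φ N′ N′⊨T)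

    finish : (∃ λ B → A₀ ⊑ B × (El B ↣ Z) × (∀ f → HandledAt f B)) → _
    finish (B , A₀⊑B , B↣Z , handled) =
      sequence B , ⋖-absorbs B↣Z Z⋖κ , (λ i → Seq.inQ B (member i)) , sequence-indiscernible B ,
      ((λ i → elem A i , _⊑_.sub A₀⊑B (member₀ i))
        , (λ {i} {i′} l → lift (fwd (_⊑_.order A₀⊑B (member₀ i) (member₀ i′)) (bwd (lt-elem A A⊆M′ nonconst indA) l)))
        , λ i → refl) ,
      same-type
      where
      x₀ : El B
      x₀ = elem A i₀ , _⊑_.sub A₀⊑B (member₀ i₀)

      same-type : ∀ n (q : PartialType (Coord (sequence B)) (_^_ {L = L} σ n)) →
        IsCompleteType N′ (coord (sequence B)) q → FinitelyRealisedIn (sequence B) n q →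
        ∀ (c d : Tuple N′ (_^_ {L = L} σ n)) → AllIn N′ M′ c → AllIn N′ M′ d →
        Realises N′ (coord (sequence B)) c q → Realises N′ (coord (sequence B)) d q →
        SameType N′ {B = Carrier N} (to j) c d
      same-type n q (_ , q-or-not) realised c d c∈ d∈ rc rd (φ at b) = mk⇔ (half c d c∈ d∈ rc rd) (half d c d∈ c∈ rd rc)
        where
        in-M′ : ∀ c → AllIn N′ M′ c → ∀ k → AllIn N′ M′ (component {σ = σ} n c k)
        in-M′ c c∈ k x = subst M′ (sym (lookup-tabulate {L = L} _ x)) (c∈ _)

        half : ∀ c d → AllIn N′ M′ c → AllIn N′ M′ d →
               Realises N′ (coord (sequence B)) c q → Realises N′ (coord (sequence B)) d q →
               Sat N′ {B = Carrier N} (to j) c (φ at b) → Sat N′ {B = Carrier N} (to j) d (φ at b)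
        half c d c∈ d∈ rc rd h = subst (λ v → Sat N′ {B = Carrier N} (to j) v (φ at b)) (join-component n d)
          (implies B x₀ n q q-or-not realised φ (All.map (to j) b) (handled (n , (φ at b)))
            (component n c) (component n d) (in-M′ c c∈) (in-M′ d d∈)
            (λ ψ k → subst (λ v → Sat N′ {B = Coordinate B} coordinate v ψ) (sym (join-component n c)) (rc ψ k))
            (λ ψ k → subst (λ v → Sat N′ {B = Coordinate B} coordinate v ψ) (sym (join-component n d)) (rd ψ k))
            (subst (λ v → Sat N′ {B = Carrier N} (to j) v (φ at b)) (sym (join-component n c)) h))
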